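{- There are necklace-preserving bijections \[ \mathcal{F}_0^{\circ}\equiv\mathbf{C}^{\circ}\equiv(\mathrm{box}+\mathrm{box}\text{ --- }\mathbf{C}_{\mathrm{dot}})\times\mathcal{Q}(\mathrm{dot}\text{ --- }\mathbf{C}_{\mathrm{box}},\ \mathrm{diamond}\text{ --- }\mathbf{C}_{\mathrm{triangle}},\ \mathrm{triangle}\text{ --- }\mathbf{C}_{\mathrm{diamond}}). \] In particular the generating function $\frac{d}{dt}f$ of non-negative $\mathcal{Q}$-trees with excess 0 and a marked necklace is \[ \frac{d}{dt}f=(1+C_{\mathrm{dot}})\cdot Q(C_{\mathrm{box}},C_{\mathrm{triangle}},C_{\mathrm{diamond}}). \]
   Context: Pearls are of four kinds: box-pearls, dot-pearls, red diamond-pearls and blue triangle-pearls. $\mathcal{Q}$ is a set of words on the alphabet {dot, diamond, triangle}, each identified with a clockwise oriented necklace carrying one box-pearl followed by the letters as pearls; it contains a necklace with no dot- or diamond-pearl. $Q(v,w,u)=\sum_{s\in\mathcal{Q}}v^{|s|_{\mathrm{dot}}}w^{|s|_{\mathrm{diamond}}}u^{|s|_{\mathrm{triangle}}}$. A rooted $\mathcal{Q}$-tree is a box-rooted plane tree whose vertices are necklaces of $\mathcal{Q}$, with black edges joining a dot-pearl to a box-pearl and red edges joining a diamond-pearl to a box-pearl, all pearls incident to exactly one edge except the root box-pearl and the (free) triangle-pearls. Excess of a pearl $x$: number of triangle-pearls minus number of diamond-pearls in the subtree at $x$, $x$ included. A non-negative $\mathcal{Q}$-tree has non-negative excess at every pearl;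 $\mathcal{F}_0$ is those of total excess $0$, $\mathcal{F}_0^{\circ}$ those with a marked necklace, and $f=F(t,0)$ is the generating function of $\mathcal{F}_0$ by number of vertices $t$. A rooted $\mathcal{Q}$-companion tree is a pearl-rooted plane tree whose vertices are necklaces of $\mathcal{Q}$, with black edges (dot-pearl to box-pearl) and blue edges (diamond-pearl to triangle-pearl), each non-root dot- or diamond-pearl incident to exactly one edge, the root pearl free, each box- or triangle-pearl incident to at most one edge; non-root free triangle-pearls are defects. $\mathbf{C}_{\mathrm{box}},\mathbf{C}_{\mathrm{dot}},\mathbf{C}_{\mathrm{diamond}},\mathbf{C}_{\mathrm{triangle}}$ are the classes of such trees without defects rooted at a box-, dot-, diamond-, triangle-pearl, with generating functions $C_{\mathrm{box}},C_{\mathrm{dot}},C_{\mathrm{diamond}},C_{\mathrm{triangle}}$ by number of vertices. $\mathbf{C}^{\circ}$ is the class of unrooted (i.e. box-rooted up to rerooting) $\mathcal{Q}$-companion trees without defects with a marked necklace. The notation $(\mathrm{box}+\mathrm{box}\text{ --- }\mathbf{C}_{\mathrm{dot}})\times\mathcal{Q}(\dots)$ means: take a necklace of $\mathcal{Q}$, attach to each dot-pearl a black edge to a tree of $\mathbf{C}_{\mathrm{box}}$, to each diamond-pearl a blue edge to a tree of $\mathbf{C}_{\mathrm{triangle}}$, to each triangle-pearl a blue edge to a tree of $\mathbf{C}_{\mathrm{diamond}}$, and either leave its box-pearl free or attach it by a black edge to a tree of $\mathbf{C}_{\mathrm{dot}}$. -}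

module Defs where

open import Data.Nat using (ℕ; zero; suc; _+_; _≤_)
open import Data.List using (List; []; _∷_; map; _++_)
open import Data.List.Relation.Unary.All using (All)
open import Data.Maybe using (Maybe; just; nothing)
open import Data.Product using (Σ; _×_; _,_)
open import Data.Unit using (⊤)
open import Relation.Binary.PropositionalEquality using (_≡_)

-- Necklaces: a necklace is a box-pearl followed (clockwise) by a word on
-- the alphabet {dot, diamond, triangle}; we identify it with that word.

data Letter : Set where
  dot diamond triangle : Letter

Word : Set
Word = List Letter

-- A vertex is a necklace given
-- by the list of its letter-pearls in clockwise order after the box-pearl;
-- a dot-pearl carries a black edge to the box-pearl of a child tree, a
-- diamond-pearl carries a red edge to the box-pearl of a child tree, a
-- triangle-pearl is free.  (Membership of the necklaces in Q is imposed
-- separately, see QTreeIn.)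

mutual
  data QTree : Set where
    node : List QPearl → QTree

  data QPearl : Set where
    dotE : QTree → QPearl
    diaE : QTree → QPearl
    triP : QPearl

qLetter : QPearl → Letter
qLetter (dotE _) = dot
qLetter (diaE _) = diamond
qLetter triP     = triangle

mutual
  necklacesQ : QTree → List Word
  necklacesQ (node ps) = map qLetter ps ∷ necklacesQs ps

  necklacesQs : List QPearl → List Word
  necklacesQs []            = []
  necklacesQs (dotE t ∷ ps) = necklacesQ t ++ necklacesQs ps
  necklacesQs (diaE t ∷ ps) = necklacesQ t ++ necklacesQs ps
  necklacesQs (triP   ∷ ps) = necklacesQs ps

mutual
  triT : QTree → ℕ
  triT (node ps) = triPs ps

  triPs : List QPearl → ℕ
  triPs []            = 0
  triPs (dotE t ∷ ps) = triT t + triPs ps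
  triPs (diaE t ∷ ps) = triT t + triPs ps
  triPs (triP   ∷ ps) = suc (triPs ps)

mutual
  diaT : QTree → ℕ
  diaT (node ps) = diaPs ps

  diaPs : List QPearl → ℕ
  diaPs []            = 0
  diaPs (dotE t ∷ ps) = diaT t + diaPs ps
  diaPs (diaE t ∷ ps) = suc (diaT t + diaPs ps)
  diaPs (triP   ∷ ps) = diaPs ps

-- Non-negativity: excess ≥ 0 at every pearl.
--  * box-pearl of a necklace: subtree = the whole subtree hanging from it;
--  * dot-pearl: subtree = itself + child subtree (dot contributes nothing);
--  * diamond-pearl: subtree = itself + child subtree;
--  * triangle-pearl: subtree = itself (excess 1).
mutual
  NonNeg : QTree → Set
  NonNeg t@(node ps) = (diaT t ≤ triT t) × NonNegs ps

  NonNegs : List QPearl → Set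
  NonNegs []            = ⊤
  NonNegs (dotE t ∷ ps) = (diaT t ≤ triT t) × NonNeg t × NonNegs ps
  NonNegs (diaE t ∷ ps) = (suc (diaT t) ≤ triT t) × NonNeg t × NonNegs ps
  NonNegs (triP   ∷ ps) = NonNegs ps

mutual
  data MarkQ : QTree → Set where
    here   : ∀ {t} → MarkQ t
    inside : ∀ {ps} → MarkQs ps → MarkQ (node ps)

  data MarkQs : List QPearl → Set where
    inDot : ∀ {t ps} → MarkQ t → MarkQs (dotE t ∷ ps)
    inDia : ∀ {t ps} → MarkQ t → MarkQs (diaE t ∷ ps)
    later : ∀ {p ps} → MarkQs ps → MarkQs (p ∷ ps)

F0∘ : (Q : Word → Set) → Set
F0∘ Q = Σ QTree λ t →
          All Q (necklacesQ t) × NonNeg t × (triT t ≡ diaT t) × MarkQ t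

-- CTree k = tree rooted at a
-- pearl of kind k (the root pearl is free).  Non-root pearls of the root
-- necklace: a dot-pearl carries a black edge to a C_box tree, a
-- diamond-pearl a blue edge to a C_triangle tree, a triangle-pearl (no
-- defect) a blue edge to a C_diamond tree, and a non-root box-pearl is
-- either free or carries a black edge to a C_dot tree.

data Kind : Set where
  box   : Kind
  pearl : Letter → Kind

mutual
  data CTree : Kind → Set where
    -- root at the box-pearl; letter-pearls in clockwise order
    boxRoot    : List CPearl → CTree box
    -- root at a letter pearl ℓ; box attachment, the letter-pearls before
    -- the root pearl, and those after it (clockwise from the box-pearl)
    letterRoot : (ℓ : Letter) → Maybe (CTree (pearl dot)) →
                 List CPearl → List CPearl → CTree (pearl ℓ)

  data CPearl : Set where
    cDot : CTree box → CPearl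
    cDia : CTree (pearl triangle) → CPearl
    cTri : CTree (pearl diamond) → CPearl

cLetter : CPearl → Letter
cLetter (cDot _) = dot
cLetter (cDia _) = diamond
cLetter (cTri _) = triangle

mutual
  necklacesC : ∀ {k} → CTree k → List Word
  necklacesC (boxRoot ps) = map cLetter ps ∷ necklacesCs ps
  necklacesC (letterRoot ℓ mb bs as) =
    (map cLetter bs ++ ℓ ∷ map cLetter as) ∷
      (necklacesCm mb ++ (necklacesCs bs ++ necklacesCs as))

  necklacesCm : Maybe (CTree (pearl dot)) → List Word
  necklacesCm nothing  = []
  necklacesCm (just t) = necklacesC t

  necklacesCs : List CPearl → List Word
  necklacesCs []            = []
  necklacesCs (cDot t ∷ ps) = necklacesC t ++ necklacesCs ps
  necklacesCs (cDia t ∷ ps) = necklacesC t ++ necklacesCs ps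
  necklacesCs (cTri t ∷ ps) = necklacesC t ++ necklacesCs ps

-- (box + box---C_dot) × Q(dot---C_box, diamond---C_triangle,
-- triangle---C_diamond): a necklace of Q whose box-pearl is free or
-- attached to a C_dot tree, dot-pearls attached to C_box trees,
-- diamond-pearls to C_triangle trees, triangle-pearls to C_diamond trees.
-- This is also the representation of C° (unrooted defect-free companion
-- trees with a marked necklace), viewed from the marked necklace.

ProdRaw : Set
ProdRaw = Maybe (CTree (pearl dot)) × List CPearl

necklacesP : ProdRaw → List Word
necklacesP (mb , ps) = map cLetter ps ∷ (necklacesCm mb ++ necklacesCs ps)

ProdClass : (Q : Word → Set) → Set
ProdClass Q = Σ ProdRaw λ x → All Q (necklacesP x)

-- In a non-negative Q-tree, match every diamond-pearl with the first triangle-pearl of its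
-- subtree not already matched by a diamond-pearl below it; non-negativity says such a
-- triangle-pearl always exists, and total excess 0 says that every triangle-pearl gets
-- matched.  Replacing each red edge by a blue edge between the matched pearls, and
-- re-hanging the tree from the marked necklace, yields a companion tree without defects
-- seen from a necklace, i.e. an element of (box + box---C_dot) × Q(...).  Following the
-- blue edges back recovers the red ones, so the construction is invertible.
--
-- Necklaces are only moved around, never changed.  To make this precise, and to carry
-- the proofs of membership in Q along, the construction is carried out on trees whose
-- vertices bear arbitrary labels, instantiated with necklaces together with those proofs.

module Submission where

open import Defs
open import Data.List using (List)
open import Data.List.Relation.Unary.All using (All)
open import Data.Product using (Σ; _×_; _,_; proj₁; ∃)
open import Relation.Binary.PropositionalEquality using (_≡_)
open import Data.List.Relation.Binary.Permutation.Propositional using (_↭_)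
open import Function.Bundles using (_↔_; Inverse)

module ListFacts where

  open import Data.Nat using (zero; suc; pred; _+_; _∸_; _<_; _≤_; s≤s)
  open import Data.Nat.Properties
  open import Data.Nat.Tactic.RingSolver using (solve-∀)
  open import Data.List using (List; []; _∷_; _++_; take; drop; length)
  open import Data.List.Properties using (take++drop≡id)
  open import Data.List.Relation.Unary.All using (All; []; _∷_)
  open import Data.List.Relation.Unary.All.Properties using (++⁺; ++⁻ˡ; ++⁻ʳ)
  open import Relation.Nullary using (yes; no)
  open import Relation.Binary.PropositionalEquality
  open import Relation.Binary.Definitions using (DecidableEquality)
  open import Data.Product using (Σ; _,_)
  open import Function.Bundles using (_↔_; Inverse; mk↔ₛ′)
  import Data.List.Properties as ListProperties
  import Axiom.UniquenessOfIdentityProofs as UIP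

  module _ {A : Set} where
    length-take-+ : ∀ n r (xs : List A) → length xs ≡ n + r → length (take n xs) ≡ n
    length-take-+ zero r xs e = refl
    length-take-+ (suc n) r [] ()
    length-take-+ (suc n) r (x ∷ xs) e = cong suc (length-take-+ n r xs (suc-injective e))

    length-drop-+ : ∀ n r (xs : List A) → length xs ≡ n + r → length (drop n xs) ≡ r
    length-drop-+ zero r xs e = e
    length-drop-+ (suc n) r [] ()
    length-drop-+ (suc n) r (x ∷ xs) e = length-drop-+ n r xs (suc-injective e)

    take-prefix : ∀ n (xs ys : List A) → length xs ≡ n → take n (xs ++ ys) ≡ xs
    take-prefix zero [] ys e = refl
    take-prefix (suc n) (x ∷ xs) ys e = cong (x ∷_) (take-prefix n xs ys (suc-injective e))

    drop-prefix : ∀ n (xs ys : List A) → length xs ≡ n → drop n (xs ++ ys) ≡ ys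
    drop-prefix zero [] ys e = refl
    drop-prefix (suc n) (x ∷ xs) ys e = drop-prefix n xs ys (suc-injective e)

    take-++-≤ : ∀ n (xs ys : List A) → n ≤ length xs → take n (xs ++ ys) ≡ take n xs
    take-++-≤ zero xs ys _ = refl
    take-++-≤ (suc n) (x ∷ xs) ys (s≤s le) = cong (x ∷_) (take-++-≤ n xs ys le)

    drop-++-≤ : ∀ n (xs ys : List A) → n ≤ length xs → drop n (xs ++ ys) ≡ drop n xs ++ ys
    drop-++-≤ zero xs ys _ = refl
    drop-++-≤ (suc n) (x ∷ xs) ys (s≤s le) = drop-++-≤ n xs ys le

    take++drop≡id₃ : ∀ a b (ts : List A) → take a ts ++ (take b (drop a ts) ++ drop (a + b) ts) ≡ ts
    take++drop≡id₃ zero b ts = take++drop≡id b ts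
    take++drop≡id₃ (suc a) zero [] = refl
    take++drop≡id₃ (suc a) (suc b) [] = refl
    take++drop≡id₃ (suc a) b (x ∷ ts) = cong (x ∷_) (take++drop≡id₃ a b ts)

  m>0⇒suc[pred[m]]≡m : ∀ m → 0 < m → suc (pred m) ≡ m
  m>0⇒suc[pred[m]]≡m (suc m) _ = refl

  0≢m+suc[n] : ∀ m n → 0 ≢ m + suc n
  0≢m+suc[n] m n e = 0≢1+n (trans e (+-suc m n))

  [m+suc[n]]∸suc[m]≡n : ∀ m n → (m + suc n) ∸ suc m ≡ n
  [m+suc[n]]∸suc[m]≡n m n = trans (cong (_∸ suc m) (+-suc m n)) (m+n∸m≡n m n)

  m<n⇒n≡m+suc[n∸suc[m]] : ∀ n m → m < n → n ≡ m + suc (n ∸ suc m)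
  m<n⇒n≡m+suc[n∸suc[m]] n m m<n = trans (sym (m+[n∸m]≡n m<n)) (sym (+-suc m (n ∸ suc m)))

  m<n∧n+o≡m+suc[p]⇒[n∸suc[m]]+o≡p : ∀ n o m p → m < n → n + o ≡ m + suc p → (n ∸ suc m) + o ≡ p
  m<n∧n+o≡m+suc[p]⇒[n∸suc[m]]+o≡p n o m p m<n eq = +-cancelˡ-≡ (suc m) _ _ (begin
    suc m + ((n ∸ suc m) + o) ≡⟨ +-assoc (suc m) (n ∸ suc m) o ⟨
    (suc m + (n ∸ suc m)) + o ≡⟨ cong (_+ o) (m+[n∸m]≡n m<n) ⟩
    n + o                     ≡⟨ eq ⟩
    m + suc p                 ≡⟨ +-suc m p ⟩
    suc m + p                 ∎)
    where open ≡-Reasoning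

  m≤n∧m+o≡n+p⇒o≡[n∸m]+p : ∀ m o n p → m ≤ n → m + o ≡ n + p → o ≡ (n ∸ m) + p
  m≤n∧m+o≡n+p⇒o≡[n∸m]+p m o n p m≤n eq = +-cancelˡ-≡ m _ _ (begin
    m + o                 ≡⟨ eq ⟩
    n + p                 ≡⟨ cong (_+ p) (m+[n∸m]≡n m≤n) ⟨
    (m + (n ∸ m)) + p     ≡⟨ +-assoc m (n ∸ m) p ⟩
    m + ((n ∸ m) + p)     ∎)
    where open ≡-Reasoning

  m+[[n+suc[o]]+p]≡[m+n]+suc[o+p] : ∀ m n o p → m + ((n + suc o) + p) ≡ (m + n) + suc (o + p)
  m+[[n+suc[o]]+p]≡[m+n]+suc[o+p] = solve-∀

  [m+n]+[o+p]≡[m+o]+[n+p] : ∀ m n o p → (m + n) + (o + p) ≡ (m + o) + (n + p)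
  [m+n]+[o+p]≡[m+o]+[n+p] = solve-∀

  [suc[m]+n]+[o+p]≡[m+o]+suc[n+p] : ∀ m n o p → (suc m + n) + (o + p) ≡ (m + o) + suc (n + p)
  [suc[m]+n]+[o+p]≡[m+o]+suc[n+p] = solve-∀

  cong₃ : ∀ {A B C D : Set} (f : A → B → C → D) {a a′ b b′ c c′} →
          a ≡ a′ → b ≡ b′ → c ≡ c′ → f a b c ≡ f a′ b′ c′
  cong₃ f refl refl refl = refl

  cong₄ : ∀ {A B C D E : Set} (f : A → B → C → D → E) {a a′ b b′ c c′ d d′} →
          a ≡ a′ → b ≡ b′ → c ≡ c′ → d ≡ d′ → f a b c d ≡ f a′ b′ c′ d′
  cong₄ f refl refl refl refl = refl

  _≟ℓ_ : DecidableEquality Letter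
  dot ≟ℓ dot = yes refl
  dot ≟ℓ diamond = no λ ()
  dot ≟ℓ triangle = no λ ()
  diamond ≟ℓ dot = no λ ()
  diamond ≟ℓ diamond = yes refl
  diamond ≟ℓ triangle = no λ ()
  triangle ≟ℓ dot = no λ ()
  triangle ≟ℓ diamond = no λ ()
  triangle ≟ℓ triangle = yes refl

  Word-≡-irrelevant : ∀ {w w' : Word} (p q : w ≡ w') → p ≡ q
  Word-≡-irrelevant = UIP.Decidable⇒UIP.≡-irrelevant (ListProperties.≡-dec _≟ℓ_)

  module _ {A : Set} {P : A → Set} where
    ++⁻ˡ-++⁺ : ∀ xs {ys} (a : All P xs) (b : All P ys) → ++⁻ˡ xs (++⁺ a b) ≡ a
    ++⁻ˡ-++⁺ [] [] b = refl
    ++⁻ˡ-++⁺ (x ∷ xs) (px ∷ a) b = cong (px ∷_) (++⁻ˡ-++⁺ xs a b)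
    ++⁻ʳ-++⁺ : ∀ xs {ys} (a : All P xs) (b : All P ys) → ++⁻ʳ xs (++⁺ a b) ≡ b
    ++⁻ʳ-++⁺ [] [] b = refl
    ++⁻ʳ-++⁺ (x ∷ xs) (px ∷ a) b = ++⁻ʳ-++⁺ xs a b
    ++⁺-++⁻ : ∀ xs {ys} (p : All P (xs ++ ys)) → ++⁺ (++⁻ˡ xs p) (++⁻ʳ xs p) ≡ p
    ++⁺-++⁻ [] p = refl
    ++⁺-++⁻ (x ∷ xs) (px ∷ p) = cong (px ∷_) (++⁺-++⁻ xs p)

  module _ {A : Set} {P : A → Set} (P-irrelevant : ∀ {a} (p q : P a) → p ≡ q) where
    Σ-≡-irrelevant : ∀ {a a′} {p : P a} {p′ : P a′} → a ≡ a′ → (a , p) ≡ (a′ , p′)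
    Σ-≡-irrelevant {p = p} {p′} refl = cong (_ ,_) (P-irrelevant p p′)

  ↔-restrict : ∀ {A B : Set} {P : A → Set} {R : B → Set} (φ : A ↔ B) →
               (∀ {a} (p q : P a) → p ≡ q) → (∀ {b} (r s : R b) → r ≡ s) →
               (∀ {a} → P a → R (Inverse.to φ a)) → (∀ {b} → R b → P (Inverse.from φ b)) →
               Σ A P ↔ Σ B R
  ↔-restrict φ P-irrelevant R-irrelevant to-R from-P =
    mk↔ₛ′ (λ (a , p) → to a , to-R p) (λ (b , r) → from b , from-P r)
          (λ (b , _) → Σ-≡-irrelevant R-irrelevant (strictlyInverseˡ b))
          (λ (a , _) → Σ-≡-irrelevant P-irrelevant (strictlyInverseʳ a))
    where open Inverse φ

module Trees (L : Set) where

  open import Data.Nat using (ℕ; suc; _+_; _∸_; pred; _<_; _<?_)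
  open import Data.List using (List; []; _∷_; _++_; take; drop)
  open import Data.Maybe using (Maybe; just; nothing)
  open import Data.Product using (Σ; _×_; _,_; proj₁; proj₂)
  open import Data.Unit using (⊤)
  open import Relation.Nullary using (yes; no)

  -- Labelled versions of QTree (black = dotE, red = diaE, free = triP) and of
  -- CTree box and CTree (pearl ℓ).
  mutual
    data Tree : Set where
      vertex : L → List Pearl → Tree
    data Pearl : Set where
      black : Tree → Pearl
      red : Tree → Pearl
      free : Pearl

  mutual
    data CBox : Set where
      boxRooted : L → List CEdge → CBox
    data CRooted : Letter → Set where
      pearlRooted : (ℓ : Letter) → L → Maybe (CRooted dot) → List CEdge → List CEdge → CRooted ℓ
    data CEdge : Set where
      toBox : CBox → CEdge
      toTriangle : CRooted triangle → CEdge
      toDiamond : CRooted diamond → CEdge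

  -- A vertex cut open at the pearl through which the inverse map re-enters it: its
  -- label, the frame at its box-pearl, and the pearls before and after that pearl,
  -- each with the frames of the vertices their free pearls are matched with.
  data Frame : Set where
    frame : L → Maybe Frame → List Pearl → List Frame → List Pearl → List Frame → Frame

  CDiamond CDot CTriangle : Set
  CDiamond = CRooted diamond
  CDot = CRooted dot
  CTriangle = CRooted triangle

  -- Excess counted in ℕ, with `pred` for a diamond-pearl: on a valid tree nothing is
  -- truncated, and non-negativity at box- and dot-pearls comes for free.
  mutual
    excess : Tree → ℕ
    excess (vertex l ps) = excessPs ps
    excessPs : List Pearl → ℕ
    excessPs [] = 0
    excessPs (p ∷ ps) = excessP p + excessPs ps
    excessP : Pearl → ℕ
    excessP (black t) = excess t
    excessP (red t) = pred (excess t)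
    excessP free = 1

  mutual
    Valid : Tree → Set
    Valid (vertex l ps) = ValidPs ps
    ValidPs : List Pearl → Set
    ValidPs [] = ⊤
    ValidPs (p ∷ ps) = ValidP p × ValidPs ps
    ValidP : Pearl → Set
    ValidP (black t) = Valid t
    ValidP (red t) = (0 < excess t) × Valid t
    ValidP free = ⊤

  -- The unmatched triangle-pearls of t are the `excess t` free pearls left over
  -- when each diamond-pearl is matched with the first unmatched free pearl below
  -- it; `companion t ts` attaches the trees ts to them in clockwise order.
  mutual
    companion : Tree → List CDiamond → CBox
    companion (vertex l ps) ts = boxRooted l (companionPs l ps ts)

    companionPs : L → List Pearl → List CDiamond → List CEdge
    companionPs d [] ts = []
    companionPs d (p ∷ ps) ts = companionP d p (take (excessP p) ts) ∷ companionPs d ps (drop (excessP p) ts)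

    companionP : L → Pearl → List CDiamond → CEdge
    companionP d (black t) ts = toBox (companion t ts)
    companionP d (red t) ts = toTriangle (companionTri t ts)
    companionP d free [] = toDiamond (pearlRooted diamond d nothing [] [])  -- junk: ts is never short
    companionP d free (a ∷ ts) = toDiamond a

    -- Rerooting at the first unmatched triangle-pearl, the one the diamond-pearl
    -- above t is matched with.
    companionTri : Tree → List CDiamond → CTriangle
    companionTri t ts = reroot t 0 [] ts nothing

    -- `reroot t k bef aft mb` reroots t at its k-th unmatched triangle-pearl; bef and
    -- aft serve the unmatched ones before and after it, mb hangs from its box-pearl.
    reroot : Tree → ℕ → List CDiamond → List CDiamond → Maybe CDot → CTriangle
    reroot (vertex l ps) k bef aft mb = rerootPs l [] ps k bef aft mb

    rerootPs : L → List CEdge → List Pearl → ℕ → List CDiamond → List CDiamond → Maybe CDot → CTriangle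
    rerootPs l accC [] k bef aft mb = pearlRooted triangle l mb accC []
    rerootPs l accC (p ∷ ps) k bef aft mb with k <? excessP p
    ... | yes _ = rerootAt l accC p ps k bef aft mb
    ... | no _ = rerootPs l (accC ++ companionP l p (take (excessP p) bef) ∷ []) ps (k ∸ excessP p) (drop (excessP p) bef) aft mb

    rerootAt : L → List CEdge → Pearl → List Pearl → ℕ → List CDiamond → List CDiamond → Maybe CDot → CTriangle
    rerootAt l accC (black c) ps k bef aft mb =
      reroot c k bef (take (excess c ∸ suc k) aft)
        (just (pearlRooted dot l mb accC (companionPs l ps (drop (excess c ∸ suc k) aft))))
    -- The current vertex, seen from its diamond-pearl, now hangs from the first
    -- unmatched triangle-pearl of c.
    rerootAt l accC (red c) ps k bef aft mb =
      reroot c (suc k)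
        (pearlRooted diamond l mb accC (companionPs l ps (drop (pred (excess c) ∸ suc k) aft)) ∷ bef)
        (take (pred (excess c) ∸ suc k) aft) nothing
    rerootAt l accC free ps k bef aft mb = pearlRooted triangle l mb accC (companionPs l ps aft)

  mutual
    data Mark : Tree → Set where
      here : ∀ {t} → Mark t
      inside : ∀ {l ps} → MarkPs ps → Mark (vertex l ps)
    data MarkPs : List Pearl → Set where
      inBlack : ∀ {t ps} → Mark t → MarkPs (black t ∷ ps)
      inRed : ∀ {t ps} → Mark t → MarkPs (red t ∷ ps)
      later : ∀ {p ps} → MarkPs ps → MarkPs (p ∷ ps)

  Prod : Set
  Prod = Maybe CDot × L × List CEdge

  -- The marked vertex becomes the root; the path leading to it is rerooted.
  mutual
    rootAtMark : (t : Tree) → Mark t → List CDiamond → Maybe CDot → Prod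
    rootAtMark (vertex l ps) here ts mb = mb , l , companionPs l ps ts
    rootAtMark (vertex l ps) (inside m) ts mb = rootAtMarkPs l [] ps m ts mb

    rootAtMarkPs : L → List Pearl → (ps : List Pearl) → MarkPs ps → List CDiamond → Maybe CDot → Prod
    rootAtMarkPs l acc (p ∷ ps) (later m) ts mb = rootAtMarkPs l (acc ++ p ∷ []) ps m ts mb
    rootAtMarkPs l acc (black c ∷ ps) (inBlack m) ts mb =
      rootAtMark c m (drop (excessPs acc + excessPs ps) ts)
        (just (pearlRooted dot l mb (companionPs l acc (take (excessPs acc) ts)) (companionPs l ps (take (excessPs ps) (drop (excessPs acc) ts)))))
    rootAtMarkPs l acc (red c ∷ ps) (inRed m) ts mb =
      rootAtMark c m (pearlRooted diamond l mb (companionPs l acc (take (excessPs acc) ts)) (companionPs l ps (take (excessPs ps) (drop (excessPs acc) ts)))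
                 ∷ drop (excessPs acc + excessPs ps) ts) nothing

  mutual
    unBox : CBox → Tree × List Frame
    unBox (boxRooted l cs) = vertex l (proj₁ (unPs cs)) , proj₂ (unPs cs)

    unPs : List CEdge → List Pearl × List Frame
    unPs [] = [] , []
    unPs (toBox b ∷ cs) = black (proj₁ (unBox b)) ∷ proj₁ (unPs cs) , proj₂ (unBox b) ++ proj₂ (unPs cs)
    unPs (toTriangle r ∷ cs) = red (proj₁ (unTri r)) ∷ proj₁ (unPs cs) , proj₂ (unTri r) ++ proj₂ (unPs cs)
    unPs (toDiamond a ∷ cs) = free ∷ proj₁ (unPs cs) , toFrame a ∷ proj₂ (unPs cs)

    unTri : CTriangle → Tree × List Frame
    unTri (pearlRooted .triangle l mb bs as) =
      resumeR (vertex l (proj₁ (unPs bs) ++ free ∷ proj₁ (unPs as))) (toFrameM mb) (proj₂ (unPs bs)) (proj₂ (unPs as))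

    toFrame : ∀ {ℓ} → CRooted ℓ → Frame
    toFrame (pearlRooted ℓ l mb bs as) = frame l (toFrameM mb) (proj₁ (unPs bs)) (proj₂ (unPs bs)) (proj₁ (unPs as)) (proj₂ (unPs as))

    toFrameM : Maybe CDot → Maybe Frame
    toFrameM nothing = nothing
    toFrameM (just d) = just (toFrame d)

    toFrames : List CDiamond → List Frame
    toFrames [] = []
    toFrames (a ∷ as) = toFrame a ∷ toFrames as

    glueDotR : Maybe Frame → Tree × List Frame → Tree × List Frame
    glueDotR nothing s = s
    glueDotR (just (frame l mb pb tb pa' ta)) (cur , aft) =
      glueDiasR tb (glueDotR mb (vertex l (pb ++ black cur ∷ pa') , aft ++ ta))

    glueDiaR : Frame → Tree × List Frame → Tree × List Frame
    glueDiaR (frame l mb pb tb pa' ta) (cur , aft) =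
      glueDiasR tb (glueDotR mb (vertex l (pb ++ red cur ∷ pa') , aft ++ ta))

    glueDiasR : List Frame → Tree × List Frame → Tree × List Frame
    glueDiasR [] s = s
    glueDiasR (f ∷ fs) s = glueDiasR fs (glueDiaR f s)

    resumeR : Tree → Maybe Frame → List Frame → List Frame → Tree × List Frame
    resumeR cur mb bef aft = glueDiasR bef (glueDotR mb (cur , aft))

  markAfter : ∀ (pb : List Pearl) {ps} → MarkPs ps → MarkPs (pb ++ ps)
  markAfter [] m = m
  markAfter (p ∷ pb) m = later (markAfter pb m)

  MarkedTree : Set
  MarkedTree = Σ Tree Mark

  mutual
    glueDotU : Maybe Frame → MarkedTree → MarkedTree
    glueDotU nothing s = s
    glueDotU (just (frame l mb pb tb pa' ta)) (cur , m) =
      glueDiasU ta (glueDiasU tb (glueDotU mb (vertex l (pb ++ black cur ∷ pa') , inside (markAfter pb (inBlack m)))))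

    glueDiaU : Frame → MarkedTree → MarkedTree
    glueDiaU (frame l mb pb tb pa' ta) (cur , m) =
      glueDiasU ta (glueDiasU tb (glueDotU mb (vertex l (pb ++ red cur ∷ pa') , inside (markAfter pb (inRed m)))))

    glueDiasU : List Frame → MarkedTree → MarkedTree
    glueDiasU [] s = s
    glueDiasU (f ∷ fs) s = glueDiasU fs (glueDiaU f s)

  resumeU : MarkedTree → Maybe Frame → List Frame → MarkedTree
  resumeU s mb ts = glueDiasU ts (glueDotU mb s)

  unProd : Prod → MarkedTree
  unProd (mb , l , cs) = resumeU (vertex l (proj₁ (unPs cs)) , here) (toFrameM mb) (proj₂ (unPs cs))

  mutual
    fromFrame : (ℓ : Letter) → Frame → CRooted ℓ
    fromFrame ℓ (frame l mb pb tb pa' ta) = pearlRooted ℓ l (fromFrameM mb) (companionPs l pb (fromFrames tb)) (companionPs l pa' (fromFrames ta))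
    fromFrameM : Maybe Frame → Maybe CDot
    fromFrameM nothing = nothing
    fromFrameM (just f) = just (fromFrame dot f)
    fromFrames : List Frame → List CDiamond
    fromFrames [] = []
    fromFrames (f ∷ fs) = fromFrame diamond f ∷ fromFrames fs

module LeftInverse (L : Set) where

  open import Data.Nat using (zero; suc; _+_; _∸_; pred; _<_; _≤_; s≤s; _<?_)
  open import Data.Nat.Properties
  open import Data.List using (List; []; _∷_; _++_; take; drop; length)
  open import Data.List.Properties using (++-assoc; ++-identityʳ; take++drop≡id)
  open import Data.Maybe using (Maybe; just; nothing)
  open import Data.Product using (Σ; _,_; proj₁; proj₂)
  open import Data.Unit using (tt)
  open import Data.Empty using (⊥-elim)
  open import Relation.Nullary using (yes; no)
  open import Relation.Binary.PropositionalEquality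
  open ListFacts
  open Trees L

  toFrames-++ : ∀ xs ys → toFrames (xs ++ ys) ≡ toFrames xs ++ toFrames ys
  toFrames-++ [] ys = refl
  toFrames-++ (x ∷ xs) ys = cong (toFrame x ∷_) (toFrames-++ xs ys)

  glueDiasR-++ : ∀ xs ys s → glueDiasR (xs ++ ys) s ≡ glueDiasR ys (glueDiasR xs s)
  glueDiasR-++ [] ys s = refl
  glueDiasR-++ (x ∷ xs) ys s = glueDiasR-++ xs ys (glueDiaR x s)

  glueDiasU-++ : ∀ xs ys s → glueDiasU (xs ++ ys) s ≡ glueDiasU ys (glueDiasU xs s)
  glueDiasU-++ [] ys s = refl
  glueDiasU-++ (x ∷ xs) ys s = glueDiasU-++ xs ys (glueDiaU x s)

  unPs-++ : ∀ xs ys → unPs (xs ++ ys) ≡ (proj₁ (unPs xs) ++ proj₁ (unPs ys) , proj₂ (unPs xs) ++ proj₂ (unPs ys))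
  unPs-++ [] ys = refl
  unPs-++ (toBox b ∷ xs) ys rewrite unPs-++ xs ys =
    cong (λ z → (black (proj₁ (unBox b)) ∷ proj₁ (unPs xs) ++ proj₁ (unPs ys)) , z) (sym (++-assoc (proj₂ (unBox b)) _ _))
  unPs-++ (toTriangle r ∷ xs) ys rewrite unPs-++ xs ys =
    cong (λ z → (red (proj₁ (unTri r)) ∷ proj₁ (unPs xs) ++ proj₁ (unPs ys)) , z) (sym (++-assoc (proj₂ (unTri r)) _ _))
  unPs-++ (toDiamond a ∷ xs) ys rewrite unPs-++ xs ys = refl

  mutual
    unBox-companion : ∀ t ts → Valid t → length ts ≡ excess t → unBox (companion t ts) ≡ (t , toFrames ts)
    unBox-companion (vertex l ps) ts v e rewrite unPs-companionPs l ps ts v e = refl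

    unPs-companionPs : ∀ d ps ts → ValidPs ps → length ts ≡ excessPs ps → unPs (companionPs d ps ts) ≡ (ps , toFrames ts)
    unPs-companionPs d [] [] v e = refl
    unPs-companionPs d (p ∷ ps) ts (vp , vps) e
      rewrite unPs-companionP d p (take (excessP p) ts) (companionPs d ps (drop (excessP p) ts)) vp (length-take-+ (excessP p) (excessPs ps) ts e)
            | unPs-companionPs d ps (drop (excessP p) ts) vps (length-drop-+ (excessP p) (excessPs ps) ts e)
            = cong (λ z → p ∷ ps , z) (trans (sym (toFrames-++ (take (excessP p) ts) (drop (excessP p) ts))) (cong toFrames (take++drop≡id (excessP p) ts)))

    unPs-companionP : ∀ d p Tp rest → ValidP p → length Tp ≡ excessP p →
          unPs (companionP d p Tp ∷ rest) ≡ (p ∷ proj₁ (unPs rest) , toFrames Tp ++ proj₂ (unPs rest))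
    unPs-companionP d (black t) Tp rest v e rewrite unBox-companion t Tp v e = refl
    unPs-companionP d (red t) Tp rest (p0 , v) e rewrite unTri-companionTri t Tp p0 v e = refl
    unPs-companionP d free (a ∷ []) rest v e = refl

    unTri-companionTri : ∀ t ts → 0 < excess t → Valid t → length ts ≡ pred (excess t) → unTri (companionTri t ts) ≡ (t , toFrames ts)
    unTri-companionTri t ts p0 v e = unTri-reroot t 0 [] ts nothing v refl (trans (sym (m>0⇒suc[pred[m]]≡m (excess t) p0)) (cong suc (sym e)))

    unTri-reroot : ∀ t k bef aft mb → Valid t → length bef ≡ k → excess t ≡ k + suc (length aft) →
               unTri (reroot t k bef aft mb) ≡ resumeR t (toFrameM mb) (toFrames bef) (toFrames aft)
    unTri-reroot (vertex l ps) k bef aft mb v eb ee = unTri-rerootPs l [] [] [] ps k bef aft mb refl v eb ee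

    unTri-rerootPs : ∀ l accC acc T ps k bef aft mb → unPs accC ≡ (acc , T) → ValidPs ps → length bef ≡ k →
                 excessPs ps ≡ k + suc (length aft) →
                 unTri (rerootPs l accC ps k bef aft mb) ≡ resumeR (vertex l (acc ++ ps)) (toFrameM mb) (T ++ toFrames bef) (toFrames aft)
    unTri-rerootPs l accC acc T [] k bef aft mb h v eb ee = ⊥-elim (0≢m+suc[n] k (length aft) ee)
    unTri-rerootPs l accC acc T (p ∷ ps) k bef aft mb h (vp , vps) eb ee with k <? excessP p
    ... | yes k< = unTri-rerootAt l accC acc T p ps k bef aft mb h vp vps eb ee k<
    ... | no k≮ = goal
      where
        x≤k : excessP p ≤ k
        x≤k = ≮⇒≥ k≮
        Tp = take (excessP p) bef
        eTp : length Tp ≡ excessP p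
        eTp = length-take-+ (excessP p) (k ∸ excessP p) bef (trans eb (sym (m+[n∸m]≡n x≤k)))
        eDp : length (drop (excessP p) bef) ≡ k ∸ excessP p
        eDp = length-drop-+ (excessP p) (k ∸ excessP p) bef (trans eb (sym (m+[n∸m]≡n x≤k)))
        h' : unPs (accC ++ companionP l p Tp ∷ []) ≡ (acc ++ p ∷ [] , T ++ toFrames Tp)
        h' rewrite unPs-++ accC (companionP l p Tp ∷ []) | h | unPs-companionP l p Tp [] vp eTp | ++-identityʳ (toFrames Tp) = refl
        ih = unTri-rerootPs l (accC ++ companionP l p Tp ∷ []) (acc ++ p ∷ []) (T ++ toFrames Tp) ps (k ∸ excessP p)
               (drop (excessP p) bef) aft mb h' vps eDp (m≤n∧m+o≡n+p⇒o≡[n∸m]+p (excessP p) (excessPs ps) k (suc (length aft)) x≤k ee)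
        goal : unTri (rerootPs l (accC ++ companionP l p Tp ∷ []) ps (k ∸ excessP p) (drop (excessP p) bef) aft mb)
               ≡ resumeR (vertex l (acc ++ p ∷ ps)) (toFrameM mb) (T ++ toFrames bef) (toFrames aft)
        goal rewrite ih | ++-assoc acc (p ∷ []) ps | ++-assoc T (toFrames Tp) (toFrames (drop (excessP p) bef))
                   | sym (toFrames-++ Tp (drop (excessP p) bef)) | take++drop≡id (excessP p) bef = refl

    unTri-rerootAt : ∀ l accC acc T p ps k bef aft mb → unPs accC ≡ (acc , T) → ValidP p → ValidPs ps → length bef ≡ k →
                 excessP p + excessPs ps ≡ k + suc (length aft) → k < excessP p →
                 unTri (rerootAt l accC p ps k bef aft mb) ≡ resumeR (vertex l (acc ++ p ∷ ps)) (toFrameM mb) (T ++ toFrames bef) (toFrames aft)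
    unTri-rerootAt l accC acc T free ps zero [] aft mb h vp vps eb ee k<
      rewrite h | unPs-companionPs l ps aft vps (sym (suc-injective ee)) | ++-identityʳ T = refl
    unTri-rerootAt l accC acc T free ps zero (x ∷ bef) aft mb h vp vps () ee k<
    unTri-rerootAt l accC acc T free ps (suc k) bef aft mb h vp vps eb ee (s≤s ())
    unTri-rerootAt l accC acc T (black c) ps k bef aft mb h vc vps eb ee k< =
      begin
        unTri (reroot c k bef Ta (just Dd))
      ≡⟨ unTri-reroot c k bef Ta (just Dd) vc eb (trans (m<n⇒n≡m+suc[n∸suc[m]] (excess c) k k<) (cong (λ z → k + suc z) (sym eTa))) ⟩
        resumeR c (just (toFrame Dd)) (toFrames bef) (toFrames Ta)
      ≡⟨ cong (λ f → resumeR c (just f) (toFrames bef) (toFrames Ta)) frameD ⟩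
        glueDiasR (toFrames bef) (glueDiasR T (glueDotR (toFrameM mb) (vertex l (acc ++ black c ∷ ps) , toFrames Ta ++ toFrames Dr)))
      ≡⟨ sym (glueDiasR-++ T (toFrames bef) _) ⟩
        glueDiasR (T ++ toFrames bef) (glueDotR (toFrameM mb) (vertex l (acc ++ black c ∷ ps) , toFrames Ta ++ toFrames Dr))
      ≡⟨ cong (λ z → glueDiasR (T ++ toFrames bef) (glueDotR (toFrameM mb) (vertex l (acc ++ black c ∷ ps) , z)))
           (trans (sym (toFrames-++ Ta Dr)) (cong toFrames (take++drop≡id na aft))) ⟩
        resumeR (vertex l (acc ++ black c ∷ ps)) (toFrameM mb) (T ++ toFrames bef) (toFrames aft)
      ∎
      where
        open ≡-Reasoning
        na = excess c ∸ suc k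
        Ta = take na aft
        Dr = drop na aft
        ea : length aft ≡ na + excessPs ps
        ea = sym (m<n∧n+o≡m+suc[p]⇒[n∸suc[m]]+o≡p (excess c) (excessPs ps) k (length aft) k< ee)
        eTa : length Ta ≡ na
        eTa = length-take-+ na (excessPs ps) aft ea
        eDr : length Dr ≡ excessPs ps
        eDr = length-drop-+ na (excessPs ps) aft ea
        Dd = pearlRooted dot l mb accC (companionPs l ps Dr)
        frameD : toFrame Dd ≡ frame l (toFrameM mb) acc T ps (toFrames Dr)
        frameD rewrite h | unPs-companionPs l ps Dr vps eDr = refl
    unTri-rerootAt l accC acc T (red c) ps k bef aft mb h (p0 , vc) vps eb ee k< =
      begin
        unTri (reroot c (suc k) (Ad ∷ bef) Ta nothing)
      ≡⟨ unTri-reroot c (suc k) (Ad ∷ bef) Ta nothing vc (cong suc eb)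
           (trans (sym (m>0⇒suc[pred[m]]≡m (excess c) p0)) (cong suc (trans (m<n⇒n≡m+suc[n∸suc[m]] (pred (excess c)) k k<) (cong (λ z → k + suc z) (sym eTa))))) ⟩
        glueDiasR (toFrames bef) (glueDiaR (toFrame Ad) (c , toFrames Ta))
      ≡⟨ cong (λ f → glueDiasR (toFrames bef) (glueDiaR f (c , toFrames Ta))) frameA ⟩
        glueDiasR (toFrames bef) (glueDiasR T (glueDotR (toFrameM mb) (vertex l (acc ++ red c ∷ ps) , toFrames Ta ++ toFrames Dr)))
      ≡⟨ sym (glueDiasR-++ T (toFrames bef) _) ⟩
        glueDiasR (T ++ toFrames bef) (glueDotR (toFrameM mb) (vertex l (acc ++ red c ∷ ps) , toFrames Ta ++ toFrames Dr))
      ≡⟨ cong (λ z → glueDiasR (T ++ toFrames bef) (glueDotR (toFrameM mb) (vertex l (acc ++ red c ∷ ps) , z)))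
           (trans (sym (toFrames-++ Ta Dr)) (cong toFrames (take++drop≡id na aft))) ⟩
        resumeR (vertex l (acc ++ red c ∷ ps)) (toFrameM mb) (T ++ toFrames bef) (toFrames aft)
      ∎
      where
        open ≡-Reasoning
        na = pred (excess c) ∸ suc k
        Ta = take na aft
        Dr = drop na aft
        ea : length aft ≡ na + excessPs ps
        ea = sym (m<n∧n+o≡m+suc[p]⇒[n∸suc[m]]+o≡p (pred (excess c)) (excessPs ps) k (length aft) k< ee)
        eTa : length Ta ≡ na
        eTa = length-take-+ na (excessPs ps) aft ea
        eDr : length Dr ≡ excessPs ps
        eDr = length-drop-+ na (excessPs ps) aft ea
        Ad = pearlRooted diamond l mb accC (companionPs l ps Dr)
        frameA : toFrame Ad ≡ frame l (toFrameM mb) acc T ps (toFrames Dr)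
        frameA rewrite h | unPs-companionPs l ps Dr vps eDr = refl

  ValidPs-++ : ∀ xs ys → ValidPs xs → ValidPs ys → ValidPs (xs ++ ys)
  ValidPs-++ [] ys _ v = v
  ValidPs-++ (x ∷ xs) ys (a , b) v = a , ValidPs-++ xs ys b v

  excessPs-++ : ∀ xs ys → excessPs (xs ++ ys) ≡ excessPs xs + excessPs ys
  excessPs-++ [] ys = refl
  excessPs-++ (x ∷ xs) ys = trans (cong (excessP x +_) (excessPs-++ xs ys)) (sym (+-assoc (excessP x) (excessPs xs) (excessPs ys)))

  markAfter-snoc : ∀ acc (q : Pearl) ps (m : MarkPs ps) →
    _≡_ {A = Σ (List Pearl) MarkPs} ((acc ++ q ∷ []) ++ ps , markAfter (acc ++ q ∷ []) m) (acc ++ q ∷ ps , markAfter acc (later m))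
  markAfter-snoc [] q ps m = refl
  markAfter-snoc (a ∷ acc) q ps m = cong (λ z → a ∷ proj₁ z , later (proj₂ z)) (markAfter-snoc acc q ps m)

  toFrames-take-drop₃ : ∀ a b ts →
    (toFrames (take a ts) ++ toFrames (take b (drop a ts))) ++ toFrames (drop (a + b) ts) ≡ toFrames ts
  toFrames-take-drop₃ a b ts = begin
    (toFrames (take a ts) ++ toFrames (take b (drop a ts))) ++ toFrames (drop (a + b) ts)
      ≡⟨ ++-assoc (toFrames (take a ts)) _ _ ⟩
    toFrames (take a ts) ++ (toFrames (take b (drop a ts)) ++ toFrames (drop (a + b) ts))
      ≡⟨ cong (toFrames (take a ts) ++_) (toFrames-++ (take b (drop a ts)) _) ⟨
    toFrames (take a ts) ++ toFrames (take b (drop a ts) ++ drop (a + b) ts)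
      ≡⟨ toFrames-++ (take a ts) _ ⟨
    toFrames (take a ts ++ (take b (drop a ts) ++ drop (a + b) ts))
      ≡⟨ cong toFrames (take++drop≡id₃ a b ts) ⟩
    toFrames ts ∎
    where open ≡-Reasoning

  mutual
    unProd-rootAtMark : ∀ t m ts mb → Valid t → length ts ≡ excess t →
                unProd (rootAtMark t m ts mb) ≡ resumeU (t , m) (toFrameM mb) (toFrames ts)
    unProd-rootAtMark (vertex l ps) here ts mb v e rewrite unPs-companionPs l ps ts v e = refl
    unProd-rootAtMark (vertex l ps) (inside m) ts mb v e = unProd-rootAtMarkPs l [] ps m ts mb tt v e

    unProd-rootAtMarkPs : ∀ l acc ps m ts mb → ValidPs acc → ValidPs ps → length ts ≡ excessPs acc + excessPs ps →
                  unProd (rootAtMarkPs l acc ps m ts mb) ≡ resumeU (vertex l (acc ++ ps) , inside (markAfter acc m)) (toFrameM mb) (toFrames ts)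
    unProd-rootAtMarkPs l acc (p ∷ ps) (later m) ts mb va (vp , vps) e =
      trans (unProd-rootAtMarkPs l (acc ++ p ∷ []) ps m ts mb (ValidPs-++ acc (p ∷ []) va (vp , tt)) vps e')
            (cong (λ z → resumeU (vertex l (proj₁ z) , inside (proj₂ z)) (toFrameM mb) (toFrames ts)) (markAfter-snoc acc p ps m))
      where
        e' : length ts ≡ excessPs (acc ++ p ∷ []) + excessPs ps
        e' = trans e (trans (sym (+-assoc (excessPs acc) (excessP p) (excessPs ps)))
               (cong (_+ excessPs ps) (sym (trans (excessPs-++ acc (p ∷ [])) (cong (excessPs acc +_) (+-identityʳ (excessP p)))))))
    unProd-rootAtMarkPs l acc (black c ∷ ps) (inBlack m) ts mb va (vc , vps) e =
      begin
        unProd (rootAtMark c m Ch (just Dd))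
      ≡⟨ unProd-rootAtMark c m Ch (just Dd) vc eCh ⟩
        resumeU (c , m) (just (toFrame Dd)) (toFrames Ch)
      ≡⟨ cong (λ f → resumeU (c , m) (just f) (toFrames Ch)) frameD ⟩
        glueDiasU (toFrames Ch) (glueDiasU (toFrames Ca) (glueDiasU (toFrames Cb) S0))
      ≡⟨ cong (glueDiasU (toFrames Ch)) (sym (glueDiasU-++ (toFrames Cb) (toFrames Ca) S0)) ⟩
        glueDiasU (toFrames Ch) (glueDiasU (toFrames Cb ++ toFrames Ca) S0)
      ≡⟨ sym (glueDiasU-++ (toFrames Cb ++ toFrames Ca) (toFrames Ch) S0) ⟩
        glueDiasU ((toFrames Cb ++ toFrames Ca) ++ toFrames Ch) S0
      ≡⟨ cong (λ z → glueDiasU z S0) (toFrames-take-drop₃ nb na ts) ⟩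
        glueDiasU (toFrames ts) S0
      ∎
      where
        open ≡-Reasoning
        nb = excessPs acc
        na = excessPs ps
        Cb = take nb ts
        Ca = take na (drop nb ts)
        Ch = drop (nb + na) ts
        S0 = glueDotU (toFrameM mb) (vertex l (acc ++ black c ∷ ps) , inside (markAfter acc (inBlack m)))
        e1 : length ts ≡ nb + (na + excess c)
        e1 = trans e (cong (nb +_) (+-comm (excess c) na))
        e2 : length ts ≡ (nb + na) + excess c
        e2 = trans e1 (sym (+-assoc nb na (excess c)))
        eCb : length Cb ≡ nb
        eCb = length-take-+ nb (na + excess c) ts e1
        eCa : length Ca ≡ na
        eCa = length-take-+ na (excess c) (drop nb ts) (length-drop-+ nb (na + excess c) ts e1)
        eCh : length Ch ≡ excess c
        eCh = length-drop-+ (nb + na) (excess c) ts e2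
        Dd = pearlRooted dot l mb (companionPs l acc Cb) (companionPs l ps Ca)
        frameD : toFrame Dd ≡ frame l (toFrameM mb) acc (toFrames Cb) ps (toFrames Ca)
        frameD rewrite unPs-companionPs l acc Cb va eCb | unPs-companionPs l ps Ca vps eCa = refl
    unProd-rootAtMarkPs l acc (red c ∷ ps) (inRed m) ts mb va ((p0 , vc) , vps) e =
      begin
        unProd (rootAtMark c m (Ad ∷ Ch) nothing)
      ≡⟨ unProd-rootAtMark c m (Ad ∷ Ch) nothing vc (trans (cong suc eCh) (m>0⇒suc[pred[m]]≡m (excess c) p0)) ⟩
        glueDiasU (toFrames Ch) (glueDiaU (toFrame Ad) (c , m))
      ≡⟨ cong (λ f → glueDiasU (toFrames Ch) (glueDiaU f (c , m))) frameA ⟩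
        glueDiasU (toFrames Ch) (glueDiasU (toFrames Ca) (glueDiasU (toFrames Cb) S0))
      ≡⟨ cong (glueDiasU (toFrames Ch)) (sym (glueDiasU-++ (toFrames Cb) (toFrames Ca) S0)) ⟩
        glueDiasU (toFrames Ch) (glueDiasU (toFrames Cb ++ toFrames Ca) S0)
      ≡⟨ sym (glueDiasU-++ (toFrames Cb ++ toFrames Ca) (toFrames Ch) S0) ⟩
        glueDiasU ((toFrames Cb ++ toFrames Ca) ++ toFrames Ch) S0
      ≡⟨ cong (λ z → glueDiasU z S0) (toFrames-take-drop₃ nb na ts) ⟩
        glueDiasU (toFrames ts) S0
      ∎
      where
        open ≡-Reasoning
        nb = excessPs acc
        na = excessPs ps
        x = pred (excess c)
        Cb = take nb ts
        Ca = take na (drop nb ts)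
        Ch = drop (nb + na) ts
        S0 = glueDotU (toFrameM mb) (vertex l (acc ++ red c ∷ ps) , inside (markAfter acc (inRed m)))
        e1 : length ts ≡ nb + (na + x)
        e1 = trans e (cong (nb +_) (+-comm x na))
        e2 : length ts ≡ (nb + na) + x
        e2 = trans e1 (sym (+-assoc nb na x))
        eCb : length Cb ≡ nb
        eCb = length-take-+ nb (na + x) ts e1
        eCa : length Ca ≡ na
        eCa = length-take-+ na x (drop nb ts) (length-drop-+ nb (na + x) ts e1)
        eCh : length Ch ≡ x
        eCh = length-drop-+ (nb + na) x ts e2
        Ad = pearlRooted diamond l mb (companionPs l acc Cb) (companionPs l ps Ca)
        frameA : toFrame Ad ≡ frame l (toFrameM mb) acc (toFrames Cb) ps (toFrames Ca)
        frameA rewrite unPs-companionPs l acc Cb va eCb | unPs-companionPs l ps Ca vps eCa = refl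

module RightInverse (L : Set) where

  open import Data.Nat using (ℕ; suc; _+_; _∸_; pred; _<_; _≤_; z≤n; s≤s; _<?_)
  open import Data.Nat.Properties
  open import Data.Nat.Tactic.RingSolver
  open import Data.List using (List; []; _∷_; _++_; take; drop; length)
  open import Data.List.Properties using (drop-drop; ++-assoc; ++-identityʳ; length-++)
  open import Data.Maybe using (Maybe; just; nothing)
  open import Data.Product using (_×_; _,_; proj₁; proj₂)
  open import Data.Unit using (⊤; tt)
  open import Data.Empty using (⊥-elim)
  open import Relation.Nullary using (yes; no)
  open import Relation.Binary.PropositionalEquality
  open ListFacts
  open Trees L
  open LeftInverse L

  mutual
    FrameValid : Frame → Set
    FrameValid (frame l mb pb tb pa' ta) = (excessPs pb ≡ length tb) × (excessPs pa' ≡ length ta) × FrameValidM mb × FramesValid tb × FramesValid ta × ValidPs pb × ValidPs pa'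
    FrameValidM : Maybe Frame → Set
    FrameValidM nothing = ⊤
    FrameValidM (just f) = FrameValid f
    FramesValid : List Frame → Set
    FramesValid [] = ⊤
    FramesValid (f ∷ fs) = FrameValid f × FramesValid fs

  FramesValid-++ : ∀ xs ys → FramesValid xs → FramesValid ys → FramesValid (xs ++ ys)
  FramesValid-++ [] ys _ v = v
  FramesValid-++ (x ∷ xs) ys (a , b) v = a , FramesValid-++ xs ys b v

  InvariantR : ℕ → Tree × List Frame → Set
  InvariantR n s = Valid (proj₁ s) × (excess (proj₁ s) ≡ n + suc (length (proj₂ s))) × FramesValid (proj₂ s)

  mutual
    glueDotR-invariant : ∀ mb n s → FrameValidM mb → InvariantR n s → InvariantR n (glueDotR mb s)
    glueDotR-invariant nothing n s _ h = h
    glueDotR-invariant (just (frame l mb pb tb pa' ta)) n (cur , aft) (e1 , e2 , fm , ftb , fta , vpb , vpa) (vc , ec , fa) =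
      glueDiasR-invariant tb n _ ftb (glueDotR-invariant mb (length tb + n) _ fm
        (ValidPs-++ pb (black cur ∷ pa') vpb (vc , vpa) ,
         trans (excessPs-++ pb (black cur ∷ pa')) (trans (cong₂ (λ x y → x + (y + excessPs pa')) e1 ec)
           (trans (cong (λ z → length tb + ((n + suc (length aft)) + z)) e2)
             (trans (m+[[n+suc[o]]+p]≡[m+n]+suc[o+p] (length tb) n (length aft) (length ta)) (cong (λ z → (length tb + n) + suc z) (sym (length-++ aft)))))) ,
         FramesValid-++ aft ta fa fta))

    glueDiaR-invariant : ∀ f n s → FrameValid f → InvariantR (suc n) s → InvariantR n (glueDiaR f s)
    glueDiaR-invariant (frame l mb pb tb pa' ta) n (cur , aft) (e1 , e2 , fm , ftb , fta , vpb , vpa) (vc , ec , fa) =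
      glueDiasR-invariant tb n _ ftb (glueDotR-invariant mb (length tb + n) _ fm
        (ValidPs-++ pb (red cur ∷ pa') vpb (((subst (0 <_) (sym ec) (s≤s z≤n)) , vc) , vpa) ,
         trans (excessPs-++ pb (red cur ∷ pa')) (trans (cong₂ (λ x y → x + (pred y + excessPs pa')) e1 ec)
           (trans (cong (λ z → length tb + ((n + suc (length aft)) + z)) e2)
             (trans (m+[[n+suc[o]]+p]≡[m+n]+suc[o+p] (length tb) n (length aft) (length ta)) (cong (λ z → (length tb + n) + suc z) (sym (length-++ aft)))))) ,
         FramesValid-++ aft ta fa fta))

    glueDiasR-invariant : ∀ fs n s → FramesValid fs → InvariantR (length fs + n) s → InvariantR n (glueDiasR fs s)
    glueDiasR-invariant [] n s _ h = h
    glueDiasR-invariant (f ∷ fs) n s (fv , fvs) h = glueDiasR-invariant fs n (glueDiaR f s) fvs (glueDiaR-invariant f (length fs + n) s fv h)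

  InvariantU : ℕ → MarkedTree → Set
  InvariantU n s = Valid (proj₁ s) × (excess (proj₁ s) ≡ n)

  mutual
    glueDotU-invariant : ∀ mb n s → FrameValidM mb → InvariantU n s → InvariantU n (glueDotU mb s)
    glueDotU-invariant nothing n s _ h = h
    glueDotU-invariant (just (frame l mb pb tb pa' ta)) n (cur , m) (e1 , e2 , fm , ftb , fta , vpb , vpa) (vc , ec) =
      glueDiasU-invariant ta n _ fta (glueDiasU-invariant tb (length ta + n) _ ftb (glueDotU-invariant mb (length tb + (length ta + n)) _ fm
        (ValidPs-++ pb (black cur ∷ pa') vpb (vc , vpa) ,
         trans (excessPs-++ pb (black cur ∷ pa')) (trans (cong₃ (λ a b c → a + (b + c)) e1 ec e2) (cong (length tb +_) (+-comm n (length ta)))))))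

    glueDiaU-invariant : ∀ f n s → FrameValid f → InvariantU (suc n) s → InvariantU n (glueDiaU f s)
    glueDiaU-invariant (frame l mb pb tb pa' ta) n (cur , m) (e1 , e2 , fm , ftb , fta , vpb , vpa) (vc , ec) =
      glueDiasU-invariant ta n _ fta (glueDiasU-invariant tb (length ta + n) _ ftb (glueDotU-invariant mb (length tb + (length ta + n)) _ fm
        (ValidPs-++ pb (red cur ∷ pa') vpb ((subst (0 <_) (sym ec) (s≤s z≤n) , vc) , vpa) ,
         trans (excessPs-++ pb (red cur ∷ pa')) (trans (cong₃ (λ a b c → a + (b + c)) e1 (cong pred ec) e2) (cong (length tb +_) (+-comm n (length ta)))))))

    glueDiasU-invariant : ∀ fs n s → FramesValid fs → InvariantU (length fs + n) s → InvariantU n (glueDiasU fs s)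
    glueDiasU-invariant [] n s _ h = h
    glueDiasU-invariant (f ∷ fs) n s (fv , fvs) h = glueDiasU-invariant fs n (glueDiaU f s) fvs (glueDiaU-invariant f (length fs + n) s fv h)

  mutual
    unBox-valid : ∀ b → Valid (proj₁ (unBox b)) × (length (proj₂ (unBox b)) ≡ excess (proj₁ (unBox b))) × FramesValid (proj₂ (unBox b))
    unBox-valid (boxRooted l cs) = unPs-valid cs

    unPs-valid : ∀ cs → ValidPs (proj₁ (unPs cs)) × (length (proj₂ (unPs cs)) ≡ excessPs (proj₁ (unPs cs))) × FramesValid (proj₂ (unPs cs))
    unPs-valid [] = tt , refl , tt
    unPs-valid (toBox b ∷ cs) with unBox-valid b | unPs-valid cs
    ... | (v1 , e1 , f1) | (v2 , e2 , f2) =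
      (v1 , v2) , trans (length-++ (proj₂ (unBox b))) (cong₂ _+_ e1 e2) , FramesValid-++ _ _ f1 f2
    unPs-valid (toTriangle r ∷ cs) with unTri-valid r | unPs-valid cs
    ... | (v1 , e1 , f1) | (v2 , e2 , f2) =
      ((subst (0 <_) e1 (s≤s z≤n) , v1) , v2) , trans (length-++ (proj₂ (unTri r))) (cong₂ _+_ (cong pred e1) e2) , FramesValid-++ _ _ f1 f2
    unPs-valid (toDiamond a ∷ cs) with unPs-valid cs
    ... | (v2 , e2 , f2) = (tt , v2) , cong suc e2 , toFrame-valid a , f2

    unTri-valid : ∀ r → Valid (proj₁ (unTri r)) × (suc (length (proj₂ (unTri r))) ≡ excess (proj₁ (unTri r))) × FramesValid (proj₂ (unTri r))
    unTri-valid (pearlRooted .triangle l mb bs as) with unPs-valid bs | unPs-valid as | glueDiasR-invariant (proj₂ (unPs bs)) 0 _ (proj₂ (proj₂ (unPs-valid bs)))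
      (glueDotR-invariant (toFrameM mb) (length (proj₂ (unPs bs)) + 0) (vertex l (proj₁ (unPs bs) ++ free ∷ proj₁ (unPs as)) , proj₂ (unPs as)) (toFrameM-valid mb)
        (ValidPs-++ (proj₁ (unPs bs)) (free ∷ proj₁ (unPs as)) (proj₁ (unPs-valid bs)) (tt , proj₁ (unPs-valid as)) ,
         trans (excessPs-++ (proj₁ (unPs bs)) (free ∷ proj₁ (unPs as)))
           (trans (cong₂ (λ x y → x + suc y) (sym (proj₁ (proj₂ (unPs-valid bs)))) (sym (proj₁ (proj₂ (unPs-valid as)))))
             (cong (_+ suc (length (proj₂ (unPs as)))) (sym (+-identityʳ _)))) ,
         proj₂ (proj₂ (unPs-valid as))))
    ... | _ | _ | (v , e , f) = v , sym e , f

    toFrame-valid : ∀ {ℓ} (c : CRooted ℓ) → FrameValid (toFrame c)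
    toFrame-valid (pearlRooted ℓ l mb bs as) with unPs-valid bs | unPs-valid as
    ... | (v1 , e1 , f1) | (v2 , e2 , f2) = sym e1 , sym e2 , toFrameM-valid mb , f1 , f2 , v1 , v2

    toFrameM-valid : ∀ mb → FrameValidM (toFrameM mb)
    toFrameM-valid nothing = tt
    toFrameM-valid (just d) = toFrame-valid d

  fromFrames-++ : ∀ xs ys → fromFrames (xs ++ ys) ≡ fromFrames xs ++ fromFrames ys
  fromFrames-++ [] ys = refl
  fromFrames-++ (x ∷ xs) ys = cong (fromFrame diamond x ∷_) (fromFrames-++ xs ys)

  length-fromFrames : ∀ xs → length (fromFrames xs) ≡ length xs
  length-fromFrames [] = refl
  length-fromFrames (x ∷ xs) = cong suc (length-fromFrames xs)

  rerootPs-hit : ∀ l accC p ps k bef aft mb → k < excessP p → rerootPs l accC (p ∷ ps) k bef aft mb ≡ rerootAt l accC p ps k bef aft mb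
  rerootPs-hit l accC p ps k bef aft mb lt with k <? excessP p
  ... | yes _ = refl
  ... | no nlt = ⊥-elim (nlt lt)

  rerootPs-miss : ∀ l accC p ps k bef aft mb → excessP p ≤ k →
    rerootPs l accC (p ∷ ps) k bef aft mb ≡ rerootPs l (accC ++ companionP l p (take (excessP p) bef) ∷ []) ps (k ∸ excessP p) (drop (excessP p) bef) aft mb
  rerootPs-miss l accC p ps k bef aft mb le with k <? excessP p
  ... | yes lt = ⊥-elim (<⇒≱ lt le)
  ... | no _ = refl

  rerootPs-skip : ∀ l accC pb ps T k bef aft mb → excessPs pb ≡ length T →
    rerootPs l accC (pb ++ ps) (length T + k) (T ++ bef) aft mb ≡ rerootPs l (accC ++ companionPs l pb T) ps k bef aft mb
  rerootPs-skip l accC [] ps [] k bef aft mb e rewrite ++-identityʳ accC = refl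
  rerootPs-skip l accC (p ∷ pb) ps T k bef aft mb e =
    begin
      rerootPs l accC (p ∷ (pb ++ ps)) (length T + k) (T ++ bef) aft mb
    ≡⟨ rerootPs-miss l accC p (pb ++ ps) (length T + k) (T ++ bef) aft mb le2 ⟩
      rerootPs l (accC ++ companionP l p (take (excessP p) (T ++ bef)) ∷ []) (pb ++ ps) ((length T + k) ∸ excessP p) (drop (excessP p) (T ++ bef)) aft mb
    ≡⟨ cong₃ (λ a b c → rerootPs l (accC ++ companionP l p a ∷ []) (pb ++ ps) b c aft mb)
         (take-++-≤ (excessP p) T bef le1) eqn (drop-++-≤ (excessP p) T bef le1) ⟩
      rerootPs l (accC ++ companionP l p (take (excessP p) T) ∷ []) (pb ++ ps) (length (drop (excessP p) T) + k) (drop (excessP p) T ++ bef) aft mb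
    ≡⟨ rerootPs-skip l (accC ++ companionP l p (take (excessP p) T) ∷ []) pb ps (drop (excessP p) T) k bef aft mb (sym eD) ⟩
      rerootPs l ((accC ++ companionP l p (take (excessP p) T) ∷ []) ++ companionPs l pb (drop (excessP p) T)) ps k bef aft mb
    ≡⟨ cong (λ z → rerootPs l z ps k bef aft mb) (++-assoc accC _ _) ⟩
      rerootPs l (accC ++ companionPs l (p ∷ pb) T) ps k bef aft mb
    ∎
    where
      open ≡-Reasoning
      eT : length T ≡ excessP p + excessPs pb
      eT = sym e
      le1 : excessP p ≤ length T
      le1 = subst (excessP p ≤_) (sym eT) (m≤m+n (excessP p) (excessPs pb))
      le2 : excessP p ≤ length T + k
      le2 = ≤-trans le1 (m≤m+n (length T) k)
      eD : length (drop (excessP p) T) ≡ excessPs pb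
      eD = length-drop-+ (excessP p) (excessPs pb) T eT
      eqn : (length T + k) ∸ excessP p ≡ length (drop (excessP p) T) + k
      eqn = trans (cong (λ z → (z + k) ∸ excessP p) eT) (trans (cong (_∸ excessP p) (+-assoc (excessP p) (excessPs pb) k))
              (trans (m+n∸m≡n (excessP p) (excessPs pb + k)) (cong (_+ k) (sym eD))))
  rerootPs-skip l accC [] ps (x ∷ T) k bef aft mb ()

  length-++-fromFrames : ∀ xs ys → length (xs ++ ys) ≡ length (fromFrames xs) + length ys
  length-++-fromFrames xs ys = trans (length-++ xs) (cong (_+ length ys) (sym (length-fromFrames xs)))

  reroot-glueDot : ∀ l mb pb tb pa' ta cur bef aft → excessPs pb ≡ length tb → excessPs pa' ≡ length ta → excess cur ≡ length bef + suc (length aft) →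
    reroot (vertex l (pb ++ black cur ∷ pa')) (length (tb ++ bef)) (fromFrames (tb ++ bef)) (fromFrames (aft ++ ta)) (fromFrameM mb)
      ≡ reroot cur (length bef) (fromFrames bef) (fromFrames aft) (fromFrameM (just (frame l mb pb tb pa' ta)))
  reroot-glueDot l mb pb tb pa' ta cur bef aft e1 e2 ec =
    begin
      rerootPs l [] (pb ++ black cur ∷ pa') (length (tb ++ bef)) (fromFrames (tb ++ bef)) AL (fromFrameM mb)
    ≡⟨ cong₂ (λ a b → rerootPs l [] (pb ++ black cur ∷ pa') a b AL (fromFrameM mb)) (length-++-fromFrames tb bef) (fromFrames-++ tb bef) ⟩
      rerootPs l [] (pb ++ black cur ∷ pa') (length (fromFrames tb) + length bef) (fromFrames tb ++ fromFrames bef) AL (fromFrameM mb)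
    ≡⟨ rerootPs-skip l [] pb (black cur ∷ pa') (fromFrames tb) (length bef) (fromFrames bef) AL (fromFrameM mb) (trans e1 (sym (length-fromFrames tb))) ⟩
      rerootPs l (companionPs l pb (fromFrames tb)) (black cur ∷ pa') (length bef) (fromFrames bef) AL (fromFrameM mb)
    ≡⟨ rerootPs-hit l _ (black cur) pa' (length bef) (fromFrames bef) AL (fromFrameM mb)
         (subst (length bef <_) (sym ec) (m<m+n (length bef) (s≤s z≤n))) ⟩
      reroot cur (length bef) (fromFrames bef) (take na AL)
        (just (pearlRooted dot l (fromFrameM mb) (companionPs l pb (fromFrames tb)) (companionPs l pa' (drop na AL))))
    ≡⟨ cong₂ (λ a b → reroot cur (length bef) (fromFrames bef) a (just (pearlRooted dot l (fromFrameM mb) (companionPs l pb (fromFrames tb)) (companionPs l pa' b)))) eTk eDr ⟩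
      reroot cur (length bef) (fromFrames bef) (fromFrames aft) (fromFrameM (just (frame l mb pb tb pa' ta)))
    ∎
    where
      open ≡-Reasoning
      AL = fromFrames (aft ++ ta)
      na = excess cur ∸ suc (length bef)
      ena : na ≡ length (fromFrames aft)
      ena = trans (cong (_∸ suc (length bef)) ec) (trans ([m+suc[n]]∸suc[m]≡n (length bef) (length aft)) (sym (length-fromFrames aft)))
      eTk : take na AL ≡ fromFrames aft
      eTk = trans (cong (take na) (fromFrames-++ aft ta)) (take-prefix na (fromFrames aft) (fromFrames ta) (sym ena))
      eDr : drop na AL ≡ fromFrames ta
      eDr = trans (cong (drop na) (fromFrames-++ aft ta)) (drop-prefix na (fromFrames aft) (fromFrames ta) (sym ena))

  reroot-glueDia : ∀ l mb pb tb pa' ta cur bef aft → excessPs pb ≡ length tb → excessPs pa' ≡ length ta → excess cur ≡ suc (length bef) + suc (length aft) →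
    reroot (vertex l (pb ++ red cur ∷ pa')) (length (tb ++ bef)) (fromFrames (tb ++ bef)) (fromFrames (aft ++ ta)) (fromFrameM mb)
      ≡ reroot cur (suc (length bef)) (fromFrame diamond (frame l mb pb tb pa' ta) ∷ fromFrames bef) (fromFrames aft) nothing
  reroot-glueDia l mb pb tb pa' ta cur bef aft e1 e2 ec =
    begin
      rerootPs l [] (pb ++ red cur ∷ pa') (length (tb ++ bef)) (fromFrames (tb ++ bef)) AL (fromFrameM mb)
    ≡⟨ cong₂ (λ a b → rerootPs l [] (pb ++ red cur ∷ pa') a b AL (fromFrameM mb)) (length-++-fromFrames tb bef) (fromFrames-++ tb bef) ⟩
      rerootPs l [] (pb ++ red cur ∷ pa') (length (fromFrames tb) + length bef) (fromFrames tb ++ fromFrames bef) AL (fromFrameM mb)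
    ≡⟨ rerootPs-skip l [] pb (red cur ∷ pa') (fromFrames tb) (length bef) (fromFrames bef) AL (fromFrameM mb) (trans e1 (sym (length-fromFrames tb))) ⟩
      rerootPs l (companionPs l pb (fromFrames tb)) (red cur ∷ pa') (length bef) (fromFrames bef) AL (fromFrameM mb)
    ≡⟨ rerootPs-hit l _ (red cur) pa' (length bef) (fromFrames bef) AL (fromFrameM mb)
         (subst (length bef <_) (sym (cong pred ec)) (m<m+n (length bef) (s≤s z≤n))) ⟩
      reroot cur (suc (length bef)) (pearlRooted diamond l (fromFrameM mb) (companionPs l pb (fromFrames tb)) (companionPs l pa' (drop na AL)) ∷ fromFrames bef) (take na AL) nothing
    ≡⟨ cong₂ (λ a b → reroot cur (suc (length bef)) (pearlRooted diamond l (fromFrameM mb) (companionPs l pb (fromFrames tb)) (companionPs l pa' b) ∷ fromFrames bef) a nothing) eTk eDr ⟩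
      reroot cur (suc (length bef)) (fromFrame diamond (frame l mb pb tb pa' ta) ∷ fromFrames bef) (fromFrames aft) nothing
    ∎
    where
      open ≡-Reasoning
      AL = fromFrames (aft ++ ta)
      na = pred (excess cur) ∸ suc (length bef)
      ena : na ≡ length (fromFrames aft)
      ena = trans (cong (λ z → pred z ∸ suc (length bef)) ec) (trans ([m+suc[n]]∸suc[m]≡n (length bef) (length aft)) (sym (length-fromFrames aft)))
      eTk : take na AL ≡ fromFrames aft
      eTk = trans (cong (take na) (fromFrames-++ aft ta)) (take-prefix na (fromFrames aft) (fromFrames ta) (sym ena))
      eDr : drop na AL ≡ fromFrames ta
      eDr = trans (cong (drop na) (fromFrames-++ aft ta)) (drop-prefix na (fromFrames aft) (fromFrames ta) (sym ena))

  mutual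
    frameSize : Frame → ℕ
    frameSize (frame l mb pb tb pa' ta) = suc (frameSizeM mb + (framesSize tb + framesSize ta))
    frameSizeM : Maybe Frame → ℕ
    frameSizeM nothing = 0
    frameSizeM (just f) = frameSize f
    framesSize : List Frame → ℕ
    framesSize [] = 0
    framesSize (f ∷ fs) = frameSize f + framesSize fs

  framesSize-++ : ∀ xs ys → framesSize (xs ++ ys) ≡ framesSize xs + framesSize ys
  framesSize-++ [] ys = refl
  framesSize-++ (x ∷ xs) ys = trans (cong (frameSize x +_) (framesSize-++ xs ys)) (sym (+-assoc (frameSize x) (framesSize xs) (framesSize ys)))

  ltA : ∀ a b c d n → suc (a + (b + c)) + d < suc n → a + (b + d) < n
  ltA a b c d n (s≤s h) = ≤-trans (s≤s (subst (a + (b + d) ≤_) (ar9 a b c d) (m≤m+n (a + (b + d)) c))) h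
    where
      ar9 : ∀ a b c d → a + (b + d) + c ≡ a + (b + c) + d
      ar9 = solve-∀

  resumeR-dot : ∀ l mb' pb tb pa' ta cur bef aft →
    resumeR cur (just (frame l mb' pb tb pa' ta)) bef aft ≡ resumeR (vertex l (pb ++ black cur ∷ pa')) mb' (tb ++ bef) (aft ++ ta)
  resumeR-dot l mb' pb tb pa' ta cur bef aft = sym (glueDiasR-++ tb bef _)

  resumeR-dia : ∀ l mb' pb tb pa' ta cur bef aft →
    resumeR cur nothing (frame l mb' pb tb pa' ta ∷ bef) aft ≡ resumeR (vertex l (pb ++ red cur ∷ pa')) mb' (tb ++ bef) (aft ++ ta)
  resumeR-dia l mb' pb tb pa' ta cur bef aft = sym (glueDiasR-++ tb bef _)

  excess-glueR : ∀ l pb q pa' (tb ta bef aft : List Frame) → excessPs pb ≡ length tb → excessPs pa' ≡ length ta → excessP q ≡ length bef + suc (length aft) →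
    excess (vertex l (pb ++ q ∷ pa')) ≡ length (tb ++ bef) + suc (length (aft ++ ta))
  excess-glueR l pb q pa' tb ta bef aft e1 e2 eq =
    trans (excessPs-++ pb (q ∷ pa')) (trans (cong₂ (λ x y → x + (y + excessPs pa')) e1 eq)
      (trans (cong (λ z → length tb + ((length bef + suc (length aft)) + z)) e2)
        (trans (m+[[n+suc[o]]+p]≡[m+n]+suc[o+p] (length tb) (length bef) (length aft) (length ta))
          (sym (cong₂ (λ x y → x + suc y) (length-++ tb) (length-++ aft))))))

  -- Gluing a frame replaces it by its (smaller) pending frames; n bounds their total
  -- size, so that the recursion is structural.
  companionTri-resumeR : ∀ n mb bef cur aft → frameSizeM mb + framesSize bef < n → FrameValidM mb → FramesValid bef → excess cur ≡ length bef + suc (length aft) →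
    companionTri (proj₁ (resumeR cur mb bef aft)) (fromFrames (proj₂ (resumeR cur mb bef aft)))
      ≡ reroot cur (length bef) (fromFrames bef) (fromFrames aft) (fromFrameM mb)
  companionTri-resumeR (suc n) nothing [] cur aft lt _ _ ec = refl
  companionTri-resumeR (suc n) (just (frame l mb' pb tb pa' ta)) bef cur aft lt (e1 , e2 , fm , ftb , fta , vpb , vpa) fb ec =
    begin
      companionTri (proj₁ (resumeR cur (just (frame l mb' pb tb pa' ta)) bef aft)) (fromFrames (proj₂ (resumeR cur (just (frame l mb' pb tb pa' ta)) bef aft)))
    ≡⟨ cong (λ r → companionTri (proj₁ r) (fromFrames (proj₂ r))) (resumeR-dot l mb' pb tb pa' ta cur bef aft) ⟩
      companionTri (proj₁ (resumeR cur' mb' (tb ++ bef) (aft ++ ta))) (fromFrames (proj₂ (resumeR cur' mb' (tb ++ bef) (aft ++ ta))))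
    ≡⟨ companionTri-resumeR n mb' (tb ++ bef) cur' (aft ++ ta) lt' fm (FramesValid-++ tb bef ftb fb) (excess-glueR l pb (black cur) pa' tb ta bef aft e1 e2 ec) ⟩
      reroot cur' (length (tb ++ bef)) (fromFrames (tb ++ bef)) (fromFrames (aft ++ ta)) (fromFrameM mb')
    ≡⟨ reroot-glueDot l mb' pb tb pa' ta cur bef aft e1 e2 ec ⟩
      reroot cur (length bef) (fromFrames bef) (fromFrames aft) (fromFrameM (just (frame l mb' pb tb pa' ta)))
    ∎
    where
      open ≡-Reasoning
      cur' = vertex l (pb ++ black cur ∷ pa')
      lt' : frameSizeM mb' + framesSize (tb ++ bef) < n
      lt' = subst (λ z → frameSizeM mb' + z < n) (sym (framesSize-++ tb bef)) (ltA (frameSizeM mb') (framesSize tb) (framesSize ta) (framesSize bef) n lt)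
  companionTri-resumeR (suc n) nothing (frame l mb' pb tb pa' ta ∷ bef) cur aft lt _ ((e1 , e2 , fm , ftb , fta , vpb , vpa) , fb) ec =
    begin
      companionTri (proj₁ (resumeR cur nothing (f ∷ bef) aft)) (fromFrames (proj₂ (resumeR cur nothing (f ∷ bef) aft)))
    ≡⟨ cong (λ r → companionTri (proj₁ r) (fromFrames (proj₂ r))) (resumeR-dia l mb' pb tb pa' ta cur bef aft) ⟩
      companionTri (proj₁ (resumeR cur' mb' (tb ++ bef) (aft ++ ta))) (fromFrames (proj₂ (resumeR cur' mb' (tb ++ bef) (aft ++ ta))))
    ≡⟨ companionTri-resumeR n mb' (tb ++ bef) cur' (aft ++ ta) lt' fm (FramesValid-++ tb bef ftb fb)
         (excess-glueR l pb (red cur) pa' tb ta bef aft e1 e2 (cong pred ec)) ⟩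
      reroot cur' (length (tb ++ bef)) (fromFrames (tb ++ bef)) (fromFrames (aft ++ ta)) (fromFrameM mb')
    ≡⟨ reroot-glueDia l mb' pb tb pa' ta cur bef aft e1 e2 ec ⟩
      reroot cur (suc (length bef)) (fromFrame diamond f ∷ fromFrames bef) (fromFrames aft) nothing
    ∎
    where
      open ≡-Reasoning
      f = frame l mb' pb tb pa' ta
      cur' = vertex l (pb ++ red cur ∷ pa')
      lt' : frameSizeM mb' + framesSize (tb ++ bef) < n
      lt' = subst (λ z → frameSizeM mb' + z < n) (sym (framesSize-++ tb bef)) (ltA (frameSizeM mb') (framesSize tb) (framesSize ta) (framesSize bef) n lt)

  rootAtMarkPs-skip : ∀ l acc pb ps (m : MarkPs ps) ts mb → rootAtMarkPs l acc (pb ++ ps) (markAfter pb m) ts mb ≡ rootAtMarkPs l (acc ++ pb) ps m ts mb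
  rootAtMarkPs-skip l acc [] ps m ts mb rewrite ++-identityʳ acc = refl
  rootAtMarkPs-skip l acc (p ∷ pb) ps m ts mb =
    trans (rootAtMarkPs-skip l (acc ++ p ∷ []) pb ps m ts mb) (cong (λ z → rootAtMarkPs l z ps m ts mb) (++-assoc acc (p ∷ []) pb))

  module _ (l : L) (mb : Maybe Frame) (pb : List Pearl) (tb : List Frame) (pa' : List Pearl) (ta : List Frame) (ts : List Frame)
           (e1 : excessPs pb ≡ length tb) (e2 : excessPs pa' ≡ length ta) where
    private
      T = fromFrames (tb ++ (ta ++ ts))
      eT : T ≡ fromFrames tb ++ (fromFrames ta ++ fromFrames ts)
      eT = trans (fromFrames-++ tb (ta ++ ts)) (cong (fromFrames tb ++_) (fromFrames-++ ta ts))
      e1' : length (fromFrames tb) ≡ excessPs pb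
      e1' = trans (length-fromFrames tb) (sym e1)
      e2' : length (fromFrames ta) ≡ excessPs pa'
      e2' = trans (length-fromFrames ta) (sym e2)
      tk1 : take (excessPs pb) T ≡ fromFrames tb
      tk1 = trans (cong (take (excessPs pb)) eT) (take-prefix _ _ _ e1')
      dr1 : drop (excessPs pb) T ≡ fromFrames ta ++ fromFrames ts
      dr1 = trans (cong (drop (excessPs pb)) eT) (drop-prefix _ (fromFrames tb) _ e1')
      tk2 : take (excessPs pa') (drop (excessPs pb) T) ≡ fromFrames ta
      tk2 = trans (cong (take (excessPs pa')) dr1) (take-prefix _ _ _ e2')
      dr2 : drop (excessPs pb + excessPs pa') T ≡ fromFrames ts
      dr2 = trans (sym (drop-drop (excessPs pb) (excessPs pa') T)) (trans (cong (drop (excessPs pa')) dr1) (drop-prefix _ (fromFrames ta) _ e2'))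

    rootAtMark-glueDot : ∀ cur m → rootAtMark (vertex l (pb ++ black cur ∷ pa')) (inside (markAfter pb (inBlack m))) T (fromFrameM mb)
                          ≡ rootAtMark cur m (fromFrames ts) (fromFrameM (just (frame l mb pb tb pa' ta)))
    rootAtMark-glueDot cur m = trans (rootAtMarkPs-skip l [] pb (black cur ∷ pa') (inBlack m) T (fromFrameM mb))
      (cong₃ (λ a b c → rootAtMark cur m c (just (pearlRooted dot l (fromFrameM mb) (companionPs l pb a) (companionPs l pa' b))))
         tk1 tk2 dr2)

    rootAtMark-glueDia : ∀ cur m → rootAtMark (vertex l (pb ++ red cur ∷ pa')) (inside (markAfter pb (inRed m))) T (fromFrameM mb)
                          ≡ rootAtMark cur m (fromFrame diamond (frame l mb pb tb pa' ta) ∷ fromFrames ts) nothing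
    rootAtMark-glueDia cur m = trans (rootAtMarkPs-skip l [] pb (red cur ∷ pa') (inRed m) T (fromFrameM mb))
      (cong₃ (λ a b c → rootAtMark cur m (pearlRooted diamond l (fromFrameM mb) (companionPs l pb a) (companionPs l pa' b) ∷ c) nothing)
         tk1 tk2 dr2)

  toProd : MarkedTree → Prod
  toProd s = rootAtMark (proj₁ s) (proj₂ s) [] nothing

  ltB : ∀ a b c d n → suc (a + (b + c)) + d < suc n → a + (b + (c + d)) < n
  ltB a b c d n (s≤s h) = subst (_< n) (ar a b c d) h
    where
      ar : ∀ a b c d → a + (b + c) + d ≡ a + (b + (c + d))
      ar = solve-∀

  excess-glueU : ∀ l pb q pa' (tb ta ts : List Frame) → excessPs pb ≡ length tb → excessPs pa' ≡ length ta → excessP q ≡ length ts →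
    excess (vertex l (pb ++ q ∷ pa')) ≡ length (tb ++ (ta ++ ts))
  excess-glueU l pb q pa' tb ta ts e1 e2 eq =
    trans (excessPs-++ pb (q ∷ pa')) (trans (cong₂ (λ x y → x + (y + excessPs pa')) e1 eq)
      (trans (cong (λ z → length tb + (length ts + z)) e2)
        (trans (cong (length tb +_) (+-comm (length ts) (length ta)))
          (sym (trans (length-++ tb) (cong (length tb +_) (length-++ ta)))))))

  resumeU-dot : ∀ l mb' pb tb pa' ta s ts →
    resumeU s (just (frame l mb' pb tb pa' ta)) ts ≡ glueDiasU (tb ++ (ta ++ ts)) (glueDotU mb' (vertex l (pb ++ black (proj₁ s) ∷ pa') , inside (markAfter pb (inBlack (proj₂ s)))))
  resumeU-dot l mb' pb tb pa' ta (cur , m) ts =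
    sym (trans (glueDiasU-++ tb (ta ++ ts) _) (glueDiasU-++ ta ts _))

  resumeU-dia : ∀ l mb' pb tb pa' ta s ts →
    resumeU s nothing (frame l mb' pb tb pa' ta ∷ ts) ≡ glueDiasU (tb ++ (ta ++ ts)) (glueDotU mb' (vertex l (pb ++ red (proj₁ s) ∷ pa') , inside (markAfter pb (inRed (proj₂ s)))))
  resumeU-dia l mb' pb tb pa' ta (cur , m) ts =
    sym (trans (glueDiasU-++ tb (ta ++ ts) _) (glueDiasU-++ ta ts _))

  toProd-resumeU : ∀ n mb ts cur m → frameSizeM mb + framesSize ts < n → FrameValidM mb → FramesValid ts → excess cur ≡ length ts →
    toProd (resumeU (cur , m) mb ts) ≡ rootAtMark cur m (fromFrames ts) (fromFrameM mb)
  toProd-resumeU (suc n) nothing [] cur m lt _ _ ec = refl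
  toProd-resumeU (suc n) (just (frame l mb' pb tb pa' ta)) ts cur m lt (e1 , e2 , fm , ftb , fta , vpb , vpa) fts ec =
    trans (cong toProd (resumeU-dot l mb' pb tb pa' ta (cur , m) ts))
      (trans (toProd-resumeU n mb' (tb ++ (ta ++ ts)) _ _
                (subst (λ z → frameSizeM mb' + z < n) (sym (trans (framesSize-++ tb (ta ++ ts)) (cong (framesSize tb +_) (framesSize-++ ta ts))))
                   (ltB (frameSizeM mb') (framesSize tb) (framesSize ta) (framesSize ts) n lt))
                fm (FramesValid-++ tb _ ftb (FramesValid-++ ta ts fta fts)) (excess-glueU l pb (black cur) pa' tb ta ts e1 e2 ec))
        (rootAtMark-glueDot l mb' pb tb pa' ta ts e1 e2 cur m))
  toProd-resumeU (suc n) nothing (frame l mb' pb tb pa' ta ∷ ts) cur m lt _ ((e1 , e2 , fm , ftb , fta , vpb , vpa) , fts) ec =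
    trans (cong toProd (resumeU-dia l mb' pb tb pa' ta (cur , m) ts))
      (trans (toProd-resumeU n mb' (tb ++ (ta ++ ts)) _ _
                (subst (λ z → frameSizeM mb' + z < n) (sym (trans (framesSize-++ tb (ta ++ ts)) (cong (framesSize tb +_) (framesSize-++ ta ts))))
                   (ltB (frameSizeM mb') (framesSize tb) (framesSize ta) (framesSize ts) n lt))
                fm (FramesValid-++ tb _ ftb (FramesValid-++ ta ts fta fts)) (excess-glueU l pb (red cur) pa' tb ta ts e1 e2 (cong pred ec)))
        (rootAtMark-glueDia l mb' pb tb pa' ta ts e1 e2 cur m))

  mutual
    companion-unBox : ∀ b → companion (proj₁ (unBox b)) (fromFrames (proj₂ (unBox b))) ≡ b
    companion-unBox (boxRooted l cs) = cong (boxRooted l) (companionPs-unPs l cs)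

    companionPs-unPs : ∀ d cs → companionPs d (proj₁ (unPs cs)) (fromFrames (proj₂ (unPs cs))) ≡ cs
    companionPs-unPs d [] = refl
    companionPs-unPs d (toBox b ∷ cs) =
      cong₂ _∷_ (cong toBox (trans (cong (companion (proj₁ (unBox b))) tk) (companion-unBox b)))
                (trans (cong (companionPs d (proj₁ (unPs cs))) dr) (companionPs-unPs d cs))
      where
        ts1 = proj₂ (unBox b)
        ts2 = proj₂ (unPs cs)
        e : length (fromFrames ts1) ≡ excess (proj₁ (unBox b))
        e = trans (length-fromFrames ts1) (proj₁ (proj₂ (unBox-valid b)))
        tk : take (excess (proj₁ (unBox b))) (fromFrames (ts1 ++ ts2)) ≡ fromFrames ts1
        tk = trans (cong (take _) (fromFrames-++ ts1 ts2)) (take-prefix _ _ _ e)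
        dr : drop (excess (proj₁ (unBox b))) (fromFrames (ts1 ++ ts2)) ≡ fromFrames ts2
        dr = trans (cong (drop (excess (proj₁ (unBox b)))) (fromFrames-++ ts1 ts2)) (drop-prefix _ (fromFrames ts1) _ e)
    companionPs-unPs d (toTriangle r ∷ cs) =
      cong₂ _∷_ (cong toTriangle (trans (cong (companionTri (proj₁ (unTri r))) tk) (companionTri-unTri r)))
                (trans (cong (companionPs d (proj₁ (unPs cs))) dr) (companionPs-unPs d cs))
      where
        ts1 = proj₂ (unTri r)
        ts2 = proj₂ (unPs cs)
        e : length (fromFrames ts1) ≡ pred (excess (proj₁ (unTri r)))
        e = trans (length-fromFrames ts1) (cong pred (proj₁ (proj₂ (unTri-valid r))))
        tk : take (pred (excess (proj₁ (unTri r)))) (fromFrames (ts1 ++ ts2)) ≡ fromFrames ts1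
        tk = trans (cong (take _) (fromFrames-++ ts1 ts2)) (take-prefix _ _ _ e)
        dr : drop (pred (excess (proj₁ (unTri r)))) (fromFrames (ts1 ++ ts2)) ≡ fromFrames ts2
        dr = trans (cong (drop (pred (excess (proj₁ (unTri r))))) (fromFrames-++ ts1 ts2)) (drop-prefix _ (fromFrames ts1) _ e)
    companionPs-unPs d (toDiamond a ∷ cs) = cong₂ _∷_ (cong toDiamond (fromFrame-toFrame a)) (companionPs-unPs d cs)

    fromFrame-toFrame : ∀ {ℓ} (c : CRooted ℓ) → fromFrame ℓ (toFrame c) ≡ c
    fromFrame-toFrame (pearlRooted ℓ l mb bs as) = cong₃ (pearlRooted ℓ l) (fromFrameM-toFrameM mb) (companionPs-unPs l bs) (companionPs-unPs l as)

    fromFrameM-toFrameM : ∀ mb → fromFrameM (toFrameM mb) ≡ mb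
    fromFrameM-toFrameM nothing = refl
    fromFrameM-toFrameM (just d) = cong just (fromFrame-toFrame d)

    companionTri-unTri : ∀ r → companionTri (proj₁ (unTri r)) (fromFrames (proj₂ (unTri r))) ≡ r
    companionTri-unTri (pearlRooted .triangle l mb bs as) =
      begin
        companionTri (proj₁ (resumeR cur0 (toFrameM mb) tb ta)) (fromFrames (proj₂ (resumeR cur0 (toFrameM mb) tb ta)))
      ≡⟨ companionTri-resumeR (suc (frameSizeM (toFrameM mb) + framesSize tb)) (toFrameM mb) tb cur0 ta ≤-refl (toFrameM-valid mb) (proj₂ (proj₂ (unPs-valid bs))) ecur ⟩
        rerootPs l [] (pb ++ free ∷ pa') (length tb) (fromFrames tb) (fromFrames ta) mbb
      ≡⟨ cong₂ (λ x y → rerootPs l [] (pb ++ free ∷ pa') x y (fromFrames ta) mbb)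
           (trans (sym (length-fromFrames tb)) (sym (+-identityʳ _))) (sym (++-identityʳ (fromFrames tb))) ⟩
        rerootPs l [] (pb ++ free ∷ pa') (length (fromFrames tb) + 0) (fromFrames tb ++ []) (fromFrames ta) mbb
      ≡⟨ rerootPs-skip l [] pb (free ∷ pa') (fromFrames tb) 0 [] (fromFrames ta) mbb (trans (sym (proj₁ (proj₂ (unPs-valid bs)))) (sym (length-fromFrames tb))) ⟩
        rerootPs l (companionPs l pb (fromFrames tb)) (free ∷ pa') 0 [] (fromFrames ta) mbb
      ≡⟨ rerootPs-hit l _ free pa' 0 [] (fromFrames ta) mbb (s≤s z≤n) ⟩
        pearlRooted triangle l mbb (companionPs l pb (fromFrames tb)) (companionPs l pa' (fromFrames ta))
      ≡⟨ cong₃ (pearlRooted triangle l) (fromFrameM-toFrameM mb) (companionPs-unPs l bs) (companionPs-unPs l as) ⟩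
        pearlRooted triangle l mb bs as
      ∎
      where
        open ≡-Reasoning
        pb = proj₁ (unPs bs)
        tb = proj₂ (unPs bs)
        pa' = proj₁ (unPs as)
        ta = proj₂ (unPs as)
        cur0 = vertex l (pb ++ free ∷ pa')
        mbb = fromFrameM (toFrameM mb)
        ecur : excess cur0 ≡ length tb + suc (length ta)
        ecur = trans (excessPs-++ pb (free ∷ pa')) (cong₂ (λ x y → x + suc y) (sym (proj₁ (proj₂ (unPs-valid bs)))) (sym (proj₁ (proj₂ (unPs-valid as)))))

module Bijection (L : Set) where

  open import Data.Nat using (suc; _+_)
  open import Data.Nat.Properties
  open import Data.List using (List; []; _∷_; length)
  open import Data.Maybe using (Maybe; nothing)
  open import Data.Product using (Σ; _×_; _,_; proj₁; proj₂)
  open import Data.Unit using (tt)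
  open import Relation.Binary.PropositionalEquality
  open import Function.Bundles using (_↔_; mk↔ₛ′)
  open ListFacts
  open Trees L
  open LeftInverse L
  open RightInverse L

  mutual
    Valid-irrelevant : ∀ t (a b : Valid t) → a ≡ b
    Valid-irrelevant (vertex l ps) a b = ValidPs-irrelevant ps a b
    ValidPs-irrelevant : ∀ ps (a b : ValidPs ps) → a ≡ b
    ValidPs-irrelevant [] tt tt = refl
    ValidPs-irrelevant (p ∷ ps) (a , b) (c , d) = cong₂ _,_ (ValidP-irrelevant p a c) (ValidPs-irrelevant ps b d)
    ValidP-irrelevant : ∀ p (a b : ValidP p) → a ≡ b
    ValidP-irrelevant (black t) a b = Valid-irrelevant t a b
    ValidP-irrelevant (red t) (a , b) (c , d) = cong₂ _,_ (≤-irrelevant a c) (Valid-irrelevant t b d)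
    ValidP-irrelevant free tt tt = refl

  HasZeroExcess : MarkedTree → Set
  HasZeroExcess (t , _) = Valid t × excess t ≡ 0

  ZeroExcess : Set
  ZeroExcess = Σ MarkedTree HasZeroExcess

  HasZeroExcess-irrelevant : ∀ {s} (p q : HasZeroExcess s) → p ≡ q
  HasZeroExcess-irrelevant {t , _} (v , e) (v′ , e′) = cong₂ _,_ (Valid-irrelevant t v v′) (≡-irrelevant e e′)

  toZeroExcess : ZeroExcess → Prod
  toZeroExcess (s , _) = toProd s

  unProd-invariant : ∀ x → InvariantU 0 (unProd x)
  unProd-invariant (mb , l , cs) =
    glueDiasU-invariant (proj₂ (unPs cs)) 0 _ (proj₂ (proj₂ (unPs-valid cs)))
      (glueDotU-invariant (toFrameM mb) (length (proj₂ (unPs cs)) + 0) _ (toFrameM-valid mb)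
        (proj₁ (unPs-valid cs) , trans (sym (proj₁ (proj₂ (unPs-valid cs)))) (sym (+-identityʳ _))))

  fromZeroExcess : Prod → ZeroExcess
  fromZeroExcess x = unProd x , unProd-invariant x

  toProd-unProd : ∀ x → toZeroExcess (fromZeroExcess x) ≡ x
  toProd-unProd (mb , l , cs) =
    trans (toProd-resumeU (suc (frameSizeM (toFrameM mb) + framesSize (proj₂ (unPs cs)))) (toFrameM mb) (proj₂ (unPs cs)) _ here ≤-refl (toFrameM-valid mb)
             (proj₂ (proj₂ (unPs-valid cs))) (sym (proj₁ (proj₂ (unPs-valid cs)))))
          (cong₂ (λ a b → a , l , b) (fromFrameM-toFrameM mb) (companionPs-unPs l cs))

  unProd-toProd : ∀ y → fromZeroExcess (toZeroExcess y) ≡ y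
  unProd-toProd ((t , m) , v , e) =
    Σ-≡-irrelevant (λ {s} → HasZeroExcess-irrelevant {s}) (unProd-rootAtMark t m [] nothing v (sym e))

  ZeroExcess↔Prod : ZeroExcess ↔ Prod
  ZeroExcess↔Prod = mk↔ₛ′ toZeroExcess fromZeroExcess toProd-unProd unProd-toProd

module Spelling (L : Set) (word : L → Word) where

  open import Data.Nat using (zero; suc; _+_; _∸_; pred; _<_; s≤s; _<?_)
  open import Data.Nat.Properties
  open import Data.List using (List; []; _∷_; _++_; take; drop; length; map)
  open import Data.List.Properties using (++-assoc; map-++)
  open import Data.Maybe using (Maybe; just; nothing)
  open import Data.Product using (Σ; _×_; _,_; proj₁; proj₂)
  open import Data.Unit using (⊤; tt)
  open import Data.Empty using (⊥-elim)
  open import Relation.Nullary using (yes; no)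
  open import Relation.Binary.PropositionalEquality
  open import Function.Bundles using (_↔_)
  open ListFacts
  open Trees L
  open LeftInverse L
  open RightInverse L
  open Bijection L

  pearlLetter : Pearl → Letter
  pearlLetter (black _) = dot
  pearlLetter (red _) = diamond
  pearlLetter free = triangle

  edgeLetter : CEdge → Letter
  edgeLetter (toBox _) = dot
  edgeLetter (toTriangle _) = diamond
  edgeLetter (toDiamond _) = triangle

  mutual
    Spelt : Tree → Set
    Spelt (vertex l ps) = (word l ≡ map pearlLetter ps) × SpeltPs ps
    SpeltPs : List Pearl → Set
    SpeltPs [] = ⊤
    SpeltPs (p ∷ ps) = SpeltP p × SpeltPs ps
    SpeltP : Pearl → Set
    SpeltP (black t) = Spelt t
    SpeltP (red t) = Spelt t
    SpeltP free = ⊤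

  mutual
    SpeltBox : CBox → Set
    SpeltBox (boxRooted l cs) = (word l ≡ map edgeLetter cs) × SpeltEdges cs
    SpeltRooted : ∀ {ℓ} → CRooted ℓ → Set
    SpeltRooted (pearlRooted ℓ l mb bs as) = (word l ≡ map edgeLetter bs ++ ℓ ∷ map edgeLetter as) × SpeltM mb × SpeltEdges bs × SpeltEdges as
    SpeltM : Maybe CDot → Set
    SpeltM nothing = ⊤
    SpeltM (just d) = SpeltRooted d
    SpeltEdges : List CEdge → Set
    SpeltEdges [] = ⊤
    SpeltEdges (c ∷ cs) = SpeltEdge c × SpeltEdges cs
    SpeltEdge : CEdge → Set
    SpeltEdge (toBox b) = SpeltBox b
    SpeltEdge (toTriangle r) = SpeltRooted r
    SpeltEdge (toDiamond a) = SpeltRooted a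

  SpeltDiamonds : List CDiamond → Set
  SpeltDiamonds [] = ⊤
  SpeltDiamonds (a ∷ as) = SpeltRooted a × SpeltDiamonds as

  SpeltProd : Prod → Set
  SpeltProd (mb , l , cs) = (word l ≡ map edgeLetter cs) × SpeltM mb × SpeltEdges cs

  mutual
    SpeltFrame : Letter → Frame → Set
    SpeltFrame ℓ (frame l mb pb tb pa' ta) = (word l ≡ map pearlLetter pb ++ ℓ ∷ map pearlLetter pa') × SpeltFrameM mb × SpeltFrames tb × SpeltFrames ta × SpeltPs pb × SpeltPs pa'
    SpeltFrameM : Maybe Frame → Set
    SpeltFrameM nothing = ⊤
    SpeltFrameM (just f) = SpeltFrame dot f
    SpeltFrames : List Frame → Set
    SpeltFrames [] = ⊤
    SpeltFrames (f ∷ fs) = SpeltFrame diamond f × SpeltFrames fs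

  SpeltDiamonds-take : ∀ n xs → SpeltDiamonds xs → SpeltDiamonds (take n xs)
  SpeltDiamonds-take zero xs _ = tt
  SpeltDiamonds-take (suc n) [] _ = tt
  SpeltDiamonds-take (suc n) (x ∷ xs) (a , b) = a , SpeltDiamonds-take n xs b
  SpeltDiamonds-drop : ∀ n xs → SpeltDiamonds xs → SpeltDiamonds (drop n xs)
  SpeltDiamonds-drop zero xs c = c
  SpeltDiamonds-drop (suc n) [] _ = tt
  SpeltDiamonds-drop (suc n) (x ∷ xs) (a , b) = SpeltDiamonds-drop n xs b
  SpeltEdges-++ : ∀ xs ys → SpeltEdges xs → SpeltEdges ys → SpeltEdges (xs ++ ys)
  SpeltEdges-++ [] ys _ b = b
  SpeltEdges-++ (x ∷ xs) ys (a , b) c = a , SpeltEdges-++ xs ys b c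
  SpeltPs-++ : ∀ xs ys → SpeltPs xs → SpeltPs ys → SpeltPs (xs ++ ys)
  SpeltPs-++ [] ys _ b = b
  SpeltPs-++ (x ∷ xs) ys (a , b) c = a , SpeltPs-++ xs ys b c
  SpeltFrames-++ : ∀ xs ys → SpeltFrames xs → SpeltFrames ys → SpeltFrames (xs ++ ys)
  SpeltFrames-++ [] ys _ b = b
  SpeltFrames-++ (x ∷ xs) ys (a , b) c = a , SpeltFrames-++ xs ys b c

  edgeLetter-companionP : ∀ d p ts → edgeLetter (companionP d p ts) ≡ pearlLetter p
  edgeLetter-companionP d (black t) ts = refl
  edgeLetter-companionP d (red t) ts = refl
  edgeLetter-companionP d free [] = refl
  edgeLetter-companionP d free (x ∷ ts) = refl

  edgeLetters-companionPs : ∀ d ps ts → map edgeLetter (companionPs d ps ts) ≡ map pearlLetter ps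
  edgeLetters-companionPs d [] ts = refl
  edgeLetters-companionPs d (p ∷ ps) ts = cong₂ _∷_ (edgeLetter-companionP d p _) (edgeLetters-companionPs d ps _)

  mutual
    companion-spelt : ∀ t ts → Valid t → length ts ≡ excess t → Spelt t → SpeltDiamonds ts → SpeltBox (companion t ts)
    companion-spelt (vertex l ps) ts v e (w , c) ct' = trans w (sym (edgeLetters-companionPs l ps ts)) , companionPs-spelt l ps ts v e c ct'

    companionPs-spelt : ∀ d ps ts → ValidPs ps → length ts ≡ excessPs ps → SpeltPs ps → SpeltDiamonds ts → SpeltEdges (companionPs d ps ts)
    companionPs-spelt d [] ts v e c ct' = tt
    companionPs-spelt d (p ∷ ps) ts (vp , vps) e (cp , cps) ct' =
      companionP-spelt d p (take (excessP p) ts) vp (length-take-+ (excessP p) (excessPs ps) ts e) cp (SpeltDiamonds-take (excessP p) ts ct') ,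
      companionPs-spelt d ps (drop (excessP p) ts) vps (length-drop-+ (excessP p) (excessPs ps) ts e) cps (SpeltDiamonds-drop (excessP p) ts ct')

    companionP-spelt : ∀ d p Tp → ValidP p → length Tp ≡ excessP p → SpeltP p → SpeltDiamonds Tp → SpeltEdge (companionP d p Tp)
    companionP-spelt d (black t) Tp v e c ct' = companion-spelt t Tp v e c ct'
    companionP-spelt d (red t) Tp (p0 , v) e c ct' = reroot-spelt t 0 [] Tp nothing v refl (trans (sym (m>0⇒suc[pred[m]]≡m (excess t) p0)) (cong suc (sym e))) c tt ct' tt
    companionP-spelt d free (a ∷ []) v e c (ca' , _) = ca'

    reroot-spelt : ∀ t k bef aft mb → Valid t → length bef ≡ k → excess t ≡ k + suc (length aft) → Spelt t → SpeltDiamonds bef → SpeltDiamonds aft → SpeltM mb →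
              SpeltRooted (reroot t k bef aft mb)
    reroot-spelt (vertex l ps) k bef aft mb v eb ee (w , c) cb' ca' cm = rerootPs-spelt l [] ps k bef aft mb w tt v c eb ee cb' ca' cm

    rerootPs-spelt : ∀ l accC ps k bef aft mb → word l ≡ map edgeLetter accC ++ map pearlLetter ps → SpeltEdges accC → ValidPs ps → SpeltPs ps →
                length bef ≡ k → excessPs ps ≡ k + suc (length aft) → SpeltDiamonds bef → SpeltDiamonds aft → SpeltM mb → SpeltRooted (rerootPs l accC ps k bef aft mb)
    rerootPs-spelt l accC [] k bef aft mb w cc v c eb ee cb' ca' cm = ⊥-elim (0≢m+suc[n] k (length aft) ee)
    rerootPs-spelt l accC (p ∷ ps) k bef aft mb w cc (vp , vps) (cp , cps) eb ee cb' ca' cm with k <? excessP p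
    ... | yes k< = rerootAt-spelt l accC p ps k bef aft mb w cc vp vps cp cps eb ee cb' ca' cm k<
    ... | no k≮ =
      rerootPs-spelt l (accC ++ companionP l p Tp ∷ []) ps (k ∸ excessP p) (drop (excessP p) bef) aft mb w' cc' vps cps
        (length-drop-+ (excessP p) (k ∸ excessP p) bef (trans eb (sym (m+[n∸m]≡n x≤k))))
        (m≤n∧m+o≡n+p⇒o≡[n∸m]+p (excessP p) (excessPs ps) k (suc (length aft)) x≤k ee) (SpeltDiamonds-drop (excessP p) bef cb') ca' cm
      where
        x≤k = ≮⇒≥ k≮
        Tp = take (excessP p) bef
        w' : word l ≡ map edgeLetter (accC ++ companionP l p Tp ∷ []) ++ map pearlLetter ps
        w' = trans w (trans (cong (λ z → map edgeLetter accC ++ z ∷ map pearlLetter ps) (sym (edgeLetter-companionP l p Tp)))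
               (trans (sym (++-assoc (map edgeLetter accC) _ _)) (cong (_++ map pearlLetter ps) (sym (map-++ edgeLetter accC _)))))
        cc' = SpeltEdges-++ accC _ cc (companionP-spelt l p Tp vp (length-take-+ (excessP p) (k ∸ excessP p) bef (trans eb (sym (m+[n∸m]≡n x≤k)))) cp (SpeltDiamonds-take (excessP p) bef cb') , tt)

    rerootAt-spelt : ∀ l accC p ps k bef aft mb → word l ≡ map edgeLetter accC ++ pearlLetter p ∷ map pearlLetter ps → SpeltEdges accC → ValidP p → ValidPs ps →
                SpeltP p → SpeltPs ps → length bef ≡ k → excessP p + excessPs ps ≡ k + suc (length aft) →
                SpeltDiamonds bef → SpeltDiamonds aft → SpeltM mb → k < excessP p → SpeltRooted (rerootAt l accC p ps k bef aft mb)
    rerootAt-spelt l accC free ps zero [] aft mb w cc vp vps cp cps eb ee cb' ca' cm k< =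
      trans w (cong (λ z → map edgeLetter accC ++ triangle ∷ z) (sym (edgeLetters-companionPs l ps aft))) , cm , cc ,
      companionPs-spelt l ps aft vps (sym (suc-injective ee)) cps ca'
    rerootAt-spelt l accC free ps zero (x ∷ bef) aft mb w cc vp vps cp cps () ee cb' ca' cm k<
    rerootAt-spelt l accC free ps (suc k) bef aft mb w cc vp vps cp cps eb ee cb' ca' cm (s≤s ())
    rerootAt-spelt l accC (black c) ps k bef aft mb w cc vc vps cp cps eb ee cb' ca' cm k< =
      reroot-spelt c k bef (take na aft) _ vc eb (trans (m<n⇒n≡m+suc[n∸suc[m]] (excess c) k k<) (cong (λ z → k + suc z) (sym eTa))) cp cb'
        (SpeltDiamonds-take na aft ca')
        (trans w (cong (λ z → map edgeLetter accC ++ dot ∷ z) (sym (edgeLetters-companionPs l ps _))) , cm , cc ,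
         companionPs-spelt l ps (drop na aft) vps (length-drop-+ na (excessPs ps) aft ea) cps (SpeltDiamonds-drop na aft ca'))
      where
        na = excess c ∸ suc k
        ea : length aft ≡ na + excessPs ps
        ea = sym (m<n∧n+o≡m+suc[p]⇒[n∸suc[m]]+o≡p (excess c) (excessPs ps) k (length aft) k< ee)
        eTa = length-take-+ na (excessPs ps) aft ea
    rerootAt-spelt l accC (red c) ps k bef aft mb w cc (p0 , vc) vps cp cps eb ee cb' ca' cm k< =
      reroot-spelt c (suc k) (_ ∷ bef) (take na aft) nothing vc (cong suc eb)
        (trans (sym (m>0⇒suc[pred[m]]≡m (excess c) p0)) (cong suc (trans (m<n⇒n≡m+suc[n∸suc[m]] (pred (excess c)) k k<) (cong (λ z → k + suc z) (sym eTa))))) cp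
        ((trans w (cong (λ z → map edgeLetter accC ++ diamond ∷ z) (sym (edgeLetters-companionPs l ps _))) , cm , cc ,
         companionPs-spelt l ps (drop na aft) vps (length-drop-+ na (excessPs ps) aft ea) cps (SpeltDiamonds-drop na aft ca')) , cb')
        (SpeltDiamonds-take na aft ca') tt
      where
        na = pred (excess c) ∸ suc k
        ea : length aft ≡ na + excessPs ps
        ea = sym (m<n∧n+o≡m+suc[p]⇒[n∸suc[m]]+o≡p (pred (excess c)) (excessPs ps) k (length aft) k< ee)
        eTa = length-take-+ na (excessPs ps) aft ea

  mutual
    rootAtMark-spelt : ∀ t m ts mb → Valid t → length ts ≡ excess t → Spelt t → SpeltDiamonds ts → SpeltM mb → SpeltProd (rootAtMark t m ts mb)
    rootAtMark-spelt (vertex l ps) here ts mb v e (w , c) ct' cm = trans w (sym (edgeLetters-companionPs l ps ts)) , cm , companionPs-spelt l ps ts v e c ct'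
    rootAtMark-spelt (vertex l ps) (inside m) ts mb v e (w , c) ct' cm = rootAtMarkPs-spelt l [] ps m ts mb tt v tt c w e ct' cm

    rootAtMarkPs-spelt : ∀ l acc ps m ts mb → ValidPs acc → ValidPs ps → SpeltPs acc → SpeltPs ps → word l ≡ map pearlLetter acc ++ map pearlLetter ps →
             length ts ≡ excessPs acc + excessPs ps → SpeltDiamonds ts → SpeltM mb → SpeltProd (rootAtMarkPs l acc ps m ts mb)
    rootAtMarkPs-spelt l acc (p ∷ ps) (later m) ts mb va (vp , vps) cAc (cp , cps) w e ct' cm =
      rootAtMarkPs-spelt l (acc ++ p ∷ []) ps m ts mb (ValidPs-++ acc (p ∷ []) va (vp , tt)) vps (SpeltPs-++ acc (p ∷ []) cAc (cp , tt)) cps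
        (trans w (trans (sym (++-assoc (map pearlLetter acc) (pearlLetter p ∷ []) _)) (cong (_++ map pearlLetter ps) (sym (map-++ pearlLetter acc (p ∷ []))))))
        (trans e (trans (sym (+-assoc (excessPs acc) (excessP p) (excessPs ps)))
               (cong (_+ excessPs ps) (sym (trans (excessPs-++ acc (p ∷ [])) (cong (excessPs acc +_) (+-identityʳ (excessP p))))))))
        ct' cm
    rootAtMarkPs-spelt l acc (black c ∷ ps) (inBlack m) ts mb va (vc , vps) cAc (cc , cps) w e ct' cm =
      rootAtMark-spelt c m (drop (nb + na) ts) _ vc (length-drop-+ (nb + na) (excess c) ts e2) cc (SpeltDiamonds-drop (nb + na) ts ct')
        (trans w (cong₂ (λ x y → x ++ dot ∷ y) (sym (edgeLetters-companionPs l acc _)) (sym (edgeLetters-companionPs l ps _))) , cm ,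
         companionPs-spelt l acc (take nb ts) va (length-take-+ nb (na + excess c) ts e1) cAc (SpeltDiamonds-take nb ts ct') ,
         companionPs-spelt l ps (take na (drop nb ts)) vps (length-take-+ na (excess c) (drop nb ts) (length-drop-+ nb (na + excess c) ts e1)) cps
           (SpeltDiamonds-take na (drop nb ts) (SpeltDiamonds-drop nb ts ct')))
      where
        nb = excessPs acc
        na = excessPs ps
        e1 : length ts ≡ nb + (na + excess c)
        e1 = trans e (cong (nb +_) (+-comm (excess c) na))
        e2 : length ts ≡ (nb + na) + excess c
        e2 = trans e1 (sym (+-assoc nb na (excess c)))
    rootAtMarkPs-spelt l acc (red c ∷ ps) (inRed m) ts mb va ((p0 , vc) , vps) cAc (cc , cps) w e ct' cm =
      rootAtMark-spelt c m (_ ∷ drop (nb + na) ts) nothing vc (trans (cong suc (length-drop-+ (nb + na) x ts e2)) (m>0⇒suc[pred[m]]≡m (excess c) p0)) cc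
        ((trans w (cong₂ (λ x y → x ++ diamond ∷ y) (sym (edgeLetters-companionPs l acc _)) (sym (edgeLetters-companionPs l ps _))) , cm ,
         companionPs-spelt l acc (take nb ts) va (length-take-+ nb (na + x) ts e1) cAc (SpeltDiamonds-take nb ts ct') ,
         companionPs-spelt l ps (take na (drop nb ts)) vps (length-take-+ na x (drop nb ts) (length-drop-+ nb (na + x) ts e1)) cps
           (SpeltDiamonds-take na (drop nb ts) (SpeltDiamonds-drop nb ts ct'))) , SpeltDiamonds-drop (nb + na) ts ct') tt
      where
        nb = excessPs acc
        na = excessPs ps
        x = pred (excess c)
        e1 : length ts ≡ nb + (na + x)
        e1 = trans e (cong (nb +_) (+-comm x na))
        e2 : length ts ≡ (nb + na) + x
        e2 = trans e1 (sym (+-assoc nb na x))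

  pearlLetters-unPs : ∀ cs → map pearlLetter (proj₁ (unPs cs)) ≡ map edgeLetter cs
  pearlLetters-unPs [] = refl
  pearlLetters-unPs (toBox b ∷ cs) = cong (dot ∷_) (pearlLetters-unPs cs)
  pearlLetters-unPs (toTriangle r ∷ cs) = cong (diamond ∷_) (pearlLetters-unPs cs)
  pearlLetters-unPs (toDiamond a ∷ cs) = cong (triangle ∷_) (pearlLetters-unPs cs)

  SpeltR : Tree × List Frame → Set
  SpeltR s = Spelt (proj₁ s) × SpeltFrames (proj₂ s)

  spelt-vertex : ∀ l pb q pa' ℓ → word l ≡ map pearlLetter pb ++ ℓ ∷ map pearlLetter pa' → pearlLetter q ≡ ℓ → word l ≡ map pearlLetter (pb ++ q ∷ pa')
  spelt-vertex l pb q pa' ℓ w refl = trans w (sym (map-++ pearlLetter pb (q ∷ pa')))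

  mutual
    glueDotR-spelt : ∀ mb s → SpeltFrameM mb → SpeltR s → SpeltR (glueDotR mb s)
    glueDotR-spelt nothing s _ h = h
    glueDotR-spelt (just (frame l mb pb tb pa' ta)) (cur , aft) (w , cm , ctb , cta , cpb , cpa) (cc , ca') =
      glueDiasR-spelt tb _ ctb (glueDotR-spelt mb _ cm ((spelt-vertex l pb (black cur) pa' dot w refl , SpeltPs-++ pb (black cur ∷ pa') cpb (cc , cpa)) , SpeltFrames-++ aft ta ca' cta))
    glueDiaR-spelt : ∀ f s → SpeltFrame diamond f → SpeltR s → SpeltR (glueDiaR f s)
    glueDiaR-spelt (frame l mb pb tb pa' ta) (cur , aft) (w , cm , ctb , cta , cpb , cpa) (cc , ca') =
      glueDiasR-spelt tb _ ctb (glueDotR-spelt mb _ cm ((spelt-vertex l pb (red cur) pa' diamond w refl , SpeltPs-++ pb (red cur ∷ pa') cpb (cc , cpa)) , SpeltFrames-++ aft ta ca' cta))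
    glueDiasR-spelt : ∀ fs s → SpeltFrames fs → SpeltR s → SpeltR (glueDiasR fs s)
    glueDiasR-spelt [] s _ h = h
    glueDiasR-spelt (f ∷ fs) s (cf , cfs) h = glueDiasR-spelt fs _ cfs (glueDiaR-spelt f s cf h)

  mutual
    glueDotU-spelt : ∀ mb s → SpeltFrameM mb → Spelt (proj₁ s) → Spelt (proj₁ (glueDotU mb s))
    glueDotU-spelt nothing s _ h = h
    glueDotU-spelt (just (frame l mb pb tb pa' ta)) (cur , m) (w , cm , ctb , cta , cpb , cpa) cc =
      glueDiasU-spelt ta _ cta (glueDiasU-spelt tb _ ctb (glueDotU-spelt mb _ cm (spelt-vertex l pb (black cur) pa' dot w refl , SpeltPs-++ pb (black cur ∷ pa') cpb (cc , cpa))))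
    glueDiaU-spelt : ∀ f s → SpeltFrame diamond f → Spelt (proj₁ s) → Spelt (proj₁ (glueDiaU f s))
    glueDiaU-spelt (frame l mb pb tb pa' ta) (cur , m) (w , cm , ctb , cta , cpb , cpa) cc =
      glueDiasU-spelt ta _ cta (glueDiasU-spelt tb _ ctb (glueDotU-spelt mb _ cm (spelt-vertex l pb (red cur) pa' diamond w refl , SpeltPs-++ pb (red cur ∷ pa') cpb (cc , cpa))))
    glueDiasU-spelt : ∀ fs s → SpeltFrames fs → Spelt (proj₁ s) → Spelt (proj₁ (glueDiasU fs s))
    glueDiasU-spelt [] s _ h = h
    glueDiasU-spelt (f ∷ fs) s (cf , cfs) h = glueDiasU-spelt fs _ cfs (glueDiaU-spelt f s cf h)

  mutual
    unBox-spelt : ∀ b → SpeltBox b → Spelt (proj₁ (unBox b)) × SpeltFrames (proj₂ (unBox b))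
    unBox-spelt (boxRooted l cs) (w , c) = (trans w (sym (pearlLetters-unPs cs)) , proj₁ (unPs-spelt cs c)) , proj₂ (unPs-spelt cs c)

    unPs-spelt : ∀ cs → SpeltEdges cs → SpeltPs (proj₁ (unPs cs)) × SpeltFrames (proj₂ (unPs cs))
    unPs-spelt [] _ = tt , tt
    unPs-spelt (toBox b ∷ cs) (c1 , c2) = (proj₁ (unBox-spelt b c1) , proj₁ (unPs-spelt cs c2)) , SpeltFrames-++ _ _ (proj₂ (unBox-spelt b c1)) (proj₂ (unPs-spelt cs c2))
    unPs-spelt (toTriangle r ∷ cs) (c1 , c2) = (proj₁ (unTri-spelt r c1) , proj₁ (unPs-spelt cs c2)) , SpeltFrames-++ _ _ (proj₂ (unTri-spelt r c1)) (proj₂ (unPs-spelt cs c2))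
    unPs-spelt (toDiamond a ∷ cs) (c1 , c2) = (tt , proj₁ (unPs-spelt cs c2)) , toFrame-spelt a c1 , proj₂ (unPs-spelt cs c2)

    unTri-spelt : ∀ r → SpeltRooted r → SpeltR (unTri r)
    unTri-spelt (pearlRooted .triangle l mb bs as) (w , cm , cbs , cas) =
      glueDiasR-spelt _ _ (proj₂ (unPs-spelt bs cbs)) (glueDotR-spelt (toFrameM mb) _ (toFrameM-spelt mb cm)
        ((trans w (trans (cong₂ (λ x y → x ++ triangle ∷ y) (sym (pearlLetters-unPs bs)) (sym (pearlLetters-unPs as))) (sym (map-++ pearlLetter _ (free ∷ _)))) ,
          SpeltPs-++ _ (free ∷ _) (proj₁ (unPs-spelt bs cbs)) (tt , proj₁ (unPs-spelt as cas))) , proj₂ (unPs-spelt as cas)))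

    toFrame-spelt : ∀ {ℓ} (c : CRooted ℓ) → SpeltRooted c → SpeltFrame ℓ (toFrame c)
    toFrame-spelt (pearlRooted ℓ l mb bs as) (w , cm , cbs , cas) =
      trans w (cong₂ (λ x y → x ++ ℓ ∷ y) (sym (pearlLetters-unPs bs)) (sym (pearlLetters-unPs as))) , toFrameM-spelt mb cm ,
      proj₂ (unPs-spelt bs cbs) , proj₂ (unPs-spelt as cas) , proj₁ (unPs-spelt bs cbs) , proj₁ (unPs-spelt as cas)

    toFrameM-spelt : ∀ mb → SpeltM mb → SpeltFrameM (toFrameM mb)
    toFrameM-spelt nothing _ = tt
    toFrameM-spelt (just d) c = toFrame-spelt d c

  unProd-spelt : ∀ x → SpeltProd x → Spelt (proj₁ (unProd x))
  unProd-spelt (mb , l , cs) (w , cm , c) =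
    glueDiasU-spelt _ _ (proj₂ (unPs-spelt cs c)) (glueDotU-spelt (toFrameM mb) _ (toFrameM-spelt mb cm) (trans w (sym (pearlLetters-unPs cs)) , proj₁ (unPs-spelt cs c)))

  mutual
    Spelt-irrelevant : ∀ t (a b : Spelt t) → a ≡ b
    Spelt-irrelevant (vertex l ps) (x , y) (x' , y') = cong₂ _,_ (Word-≡-irrelevant x x') (SpeltPs-irrelevant ps y y')
    SpeltPs-irrelevant : ∀ ps (a b : SpeltPs ps) → a ≡ b
    SpeltPs-irrelevant [] tt tt = refl
    SpeltPs-irrelevant (black t ∷ ps) (a , b) (a' , b') = cong₂ _,_ (Spelt-irrelevant t a a') (SpeltPs-irrelevant ps b b')
    SpeltPs-irrelevant (red t ∷ ps) (a , b) (a' , b') = cong₂ _,_ (Spelt-irrelevant t a a') (SpeltPs-irrelevant ps b b')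
    SpeltPs-irrelevant (free ∷ ps) (a , b) (a' , b') = cong (tt ,_) (SpeltPs-irrelevant ps b b')

  mutual
    SpeltBox-irrelevant : ∀ b (x y : SpeltBox b) → x ≡ y
    SpeltBox-irrelevant (boxRooted l cs) (a , b) (a' , b') = cong₂ _,_ (Word-≡-irrelevant a a') (SpeltEdges-irrelevant cs b b')
    SpeltRooted-irrelevant : ∀ {ℓ} (r : CRooted ℓ) (x y : SpeltRooted r) → x ≡ y
    SpeltRooted-irrelevant (pearlRooted ℓ l mb bs as) (a , b , c , d) (a' , b' , c' , d') =
      cong₂ _,_ (Word-≡-irrelevant a a') (cong₂ _,_ (SpeltM-irrelevant mb b b') (cong₂ _,_ (SpeltEdges-irrelevant bs c c') (SpeltEdges-irrelevant as d d')))
    SpeltM-irrelevant : ∀ mb (x y : SpeltM mb) → x ≡ y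
    SpeltM-irrelevant nothing tt tt = refl
    SpeltM-irrelevant (just d) x y = SpeltRooted-irrelevant d x y
    SpeltEdges-irrelevant : ∀ cs (x y : SpeltEdges cs) → x ≡ y
    SpeltEdges-irrelevant [] tt tt = refl
    SpeltEdges-irrelevant (toBox b ∷ cs) (a , b') (a' , b'') = cong₂ _,_ (SpeltBox-irrelevant b a a') (SpeltEdges-irrelevant cs b' b'')
    SpeltEdges-irrelevant (toTriangle r ∷ cs) (a , b') (a' , b'') = cong₂ _,_ (SpeltRooted-irrelevant r a a') (SpeltEdges-irrelevant cs b' b'')
    SpeltEdges-irrelevant (toDiamond r ∷ cs) (a , b') (a' , b'') = cong₂ _,_ (SpeltRooted-irrelevant r a a') (SpeltEdges-irrelevant cs b' b'')

  SpeltProd-irrelevant : ∀ x (a b : SpeltProd x) → a ≡ b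
  SpeltProd-irrelevant (mb , l , cs) (a , b , c) (a' , b' , c') = cong₂ _,_ (Word-≡-irrelevant a a') (cong₂ _,_ (SpeltM-irrelevant mb b b') (SpeltEdges-irrelevant cs c c'))

  SpeltZeroExcess : Set
  SpeltZeroExcess = Σ ZeroExcess λ z → Spelt (proj₁ (proj₁ z))

  SpeltZeroExcess↔SpeltProd : SpeltZeroExcess ↔ Σ Prod SpeltProd
  SpeltZeroExcess↔SpeltProd =
    ↔-restrict ZeroExcess↔Prod (λ {z} → Spelt-irrelevant (proj₁ (proj₁ z))) (λ {y} → SpeltProd-irrelevant y)
      (λ { {(t , m) , v , e} c → rootAtMark-spelt t m [] nothing v (sym e) c tt tt })
      (λ {y} → unProd-spelt y)

module Labels (L : Set) where

  open import Data.Nat using (zero; suc; _+_; _∸_; pred; _<_; s≤s; _<?_)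
  open import Data.Nat.Properties
  open import Data.List using (List; []; _∷_; _++_; take; drop; length)
  open import Data.List.Properties using (++-assoc; ++-identityʳ; take++drop≡id)
  open import Data.Maybe using (Maybe; just; nothing)
  open import Data.Product using (_,_)
  open import Data.Unit using (tt)
  open import Data.Empty using (⊥-elim)
  open import Relation.Nullary using (yes; no)
  open import Relation.Binary.PropositionalEquality as Eq using (_≡_; cong; sym)
  open import Data.List.Relation.Binary.Permutation.Propositional
  open import Data.List.Relation.Binary.Permutation.Propositional.Properties using (++-commutativeMonoid; ++⁺)
  open ListFacts
  open Trees L
  open LeftInverse L
  open RightInverse L

  open import Algebra.Solver.CommutativeMonoid (++-commutativeMonoid {A = L})

  mutual
    labels : Tree → List L
    labels (vertex l ps) = l ∷ labelsPs ps
    labelsPs : List Pearl → List L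
    labelsPs [] = []
    labelsPs (p ∷ ps) = labelsP p ++ labelsPs ps
    labelsP : Pearl → List L
    labelsP (black t) = labels t
    labelsP (red t) = labels t
    labelsP free = []

  mutual
    labelsBox : CBox → List L
    labelsBox (boxRooted l cs) = l ∷ labelsEdges cs
    labelsRooted : ∀ {ℓ} → CRooted ℓ → List L
    labelsRooted (pearlRooted ℓ l mb bs as) = l ∷ (labelsM mb ++ (labelsEdges bs ++ labelsEdges as))
    labelsM : Maybe CDot → List L
    labelsM nothing = []
    labelsM (just d) = labelsRooted d
    labelsEdges : List CEdge → List L
    labelsEdges [] = []
    labelsEdges (c ∷ cs) = labelsEdge c ++ labelsEdges cs
    labelsEdge : CEdge → List L
    labelsEdge (toBox b) = labelsBox b
    labelsEdge (toTriangle r) = labelsRooted r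
    labelsEdge (toDiamond a) = labelsRooted a

  labelsDiamonds : List CDiamond → List L
  labelsDiamonds [] = []
  labelsDiamonds (a ∷ as) = labelsRooted a ++ labelsDiamonds as

  labelsProd : Prod → List L
  labelsProd (mb , l , cs) = l ∷ (labelsM mb ++ labelsEdges cs)

  labelsDiamonds-++ : ∀ xs ys → labelsDiamonds (xs ++ ys) ≡ labelsDiamonds xs ++ labelsDiamonds ys
  labelsDiamonds-++ [] ys = Eq.refl
  labelsDiamonds-++ (x ∷ xs) ys = Eq.trans (cong (labelsRooted x ++_) (labelsDiamonds-++ xs ys)) (sym (++-assoc (labelsRooted x) _ _))

  labelsDiamonds-take-drop : ∀ n ts → labelsDiamonds ts ≡ labelsDiamonds (take n ts) ++ labelsDiamonds (drop n ts)
  labelsDiamonds-take-drop n ts = Eq.trans (cong labelsDiamonds (sym (take++drop≡id n ts))) (labelsDiamonds-++ (take n ts) (drop n ts))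

  labelsEdges-++ : ∀ xs ys → labelsEdges (xs ++ ys) ≡ labelsEdges xs ++ labelsEdges ys
  labelsEdges-++ [] ys = Eq.refl
  labelsEdges-++ (x ∷ xs) ys = Eq.trans (cong (labelsEdge x ++_) (labelsEdges-++ xs ys)) (sym (++-assoc (labelsEdge x) _ _))

  labelsPs-++ : ∀ xs ys → labelsPs (xs ++ ys) ≡ labelsPs xs ++ labelsPs ys
  labelsPs-++ [] ys = Eq.refl
  labelsPs-++ (x ∷ xs) ys = Eq.trans (cong (labelsP x ++_) (labelsPs-++ xs ys)) (sym (++-assoc (labelsP x) _ _))

  mutual
    companion-labels : ∀ t ts → Valid t → length ts ≡ excess t → labelsBox (companion t ts) ↭ labels t ++ labelsDiamonds ts
    companion-labels (vertex l ps) ts v e = prep l (companionPs-labels l ps ts v e)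

    companionPs-labels : ∀ d ps ts → ValidPs ps → length ts ≡ excessPs ps → labelsEdges (companionPs d ps ts) ↭ labelsPs ps ++ labelsDiamonds ts
    companionPs-labels d [] [] v e = refl
    companionPs-labels d (p ∷ ps) ts (vp , vps) e =
      ↭-trans (++⁺ (companionP-labels d p T1 vp (length-take-+ (excessP p) (excessPs ps) ts e)) (companionPs-labels d ps T2 vps (length-drop-+ (excessP p) (excessPs ps) ts e)))
        (↭-trans (solve 4 (λ x0 x1 x2 x3 → ((x0 ⊕ x1) ⊕ (x2 ⊕ x3))
                    ⊜ ((x0 ⊕ x2) ⊕ (x1 ⊕ x3)))
                    ↭-refl (labelsP p) (labelsDiamonds T1) (labelsPs ps) (labelsDiamonds T2))
          (↭-reflexive (cong ((labelsP p ++ labelsPs ps) ++_) (sym (labelsDiamonds-take-drop (excessP p) ts)))))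
      where
        T1 = take (excessP p) ts
        T2 = drop (excessP p) ts

    companionP-labels : ∀ d p Tp → ValidP p → length Tp ≡ excessP p → labelsEdge (companionP d p Tp) ↭ labelsP p ++ labelsDiamonds Tp
    companionP-labels d (black t) Tp v e = companion-labels t Tp v e
    companionP-labels d (red t) Tp (p0 , v) e =
      ↭-trans (reroot-labels t 0 [] Tp nothing v Eq.refl (Eq.trans (sym (m>0⇒suc[pred[m]]≡m (excess t) p0)) (cong suc (sym e))))
        (↭-reflexive (cong (labels t ++_) (++-identityʳ (labelsDiamonds Tp))))
    companionP-labels d free (a ∷ []) v e = ↭-reflexive (sym (++-identityʳ (labelsRooted a)))

    reroot-labels : ∀ t k bef aft mb → Valid t → length bef ≡ k → excess t ≡ k + suc (length aft) →
            labelsRooted (reroot t k bef aft mb) ↭ labels t ++ (labelsDiamonds bef ++ (labelsDiamonds aft ++ labelsM mb))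
    reroot-labels (vertex l ps) k bef aft mb v eb ee = rerootPs-labels l [] ps k bef aft mb v eb ee

    rerootPs-labels : ∀ l accC ps k bef aft mb → ValidPs ps → length bef ≡ k → excessPs ps ≡ k + suc (length aft) →
              labelsRooted (rerootPs l accC ps k bef aft mb) ↭ l ∷ (labelsEdges accC ++ (labelsPs ps ++ (labelsDiamonds bef ++ (labelsDiamonds aft ++ labelsM mb))))
    rerootPs-labels l accC [] k bef aft mb v eb ee = ⊥-elim (0≢m+suc[n] k (length aft) ee)
    rerootPs-labels l accC (p ∷ ps) k bef aft mb (vp , vps) eb ee with k <? excessP p
    ... | yes k< = rerootAt-labels l accC p ps k bef aft mb vp vps eb ee k<
    ... | no k≮ =
      ↭-trans (rerootPs-labels l (accC ++ x ∷ []) ps (k ∸ excessP p) (drop (excessP p) bef) aft mb vps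
                 (length-drop-+ (excessP p) (k ∸ excessP p) bef (Eq.trans eb (sym (m+[n∸m]≡n x≤k))))
                 (m≤n∧m+o≡n+p⇒o≡[n∸m]+p (excessP p) (excessPs ps) k (suc (length aft)) x≤k ee))
        (prep l (↭-trans (↭-reflexive (cong (_++ (labelsPs ps ++ (labelsDiamonds Dr ++ (labelsDiamonds aft ++ labelsM mb)))) (Eq.trans (labelsEdges-++ accC (x ∷ [])) (cong (labelsEdges accC ++_) (++-identityʳ (labelsEdge x))))))
          (↭-trans (++⁺ (++⁺ (refl {xs = labelsEdges accC}) (companionP-labels l p Tp vp eTp)) refl)
            (↭-trans (solve 7 (λ x0 x1 x2 x3 x4 x5 x6 → ((x0 ⊕ (x1 ⊕ x2)) ⊕ (x3 ⊕ (x4 ⊕ (x5 ⊕ x6))))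
                        ⊜ (x0 ⊕ ((x1 ⊕ x3) ⊕ ((x2 ⊕ x4) ⊕ (x5 ⊕ x6)))))
                        ↭-refl (labelsEdges accC) (labelsP p) (labelsDiamonds Tp) (labelsPs ps) (labelsDiamonds Dr) (labelsDiamonds aft) (labelsM mb))
              (↭-reflexive (cong (λ z → labelsEdges accC ++ ((labelsP p ++ labelsPs ps) ++ (z ++ (labelsDiamonds aft ++ labelsM mb)))) (sym (labelsDiamonds-take-drop (excessP p) bef))))))))
      where
        x≤k = ≮⇒≥ k≮
        Tp = take (excessP p) bef
        Dr = drop (excessP p) bef
        x = companionP l p Tp
        eTp = length-take-+ (excessP p) (k ∸ excessP p) bef (Eq.trans eb (sym (m+[n∸m]≡n x≤k)))

    rerootAt-labels : ∀ l accC p ps k bef aft mb → ValidP p → ValidPs ps → length bef ≡ k → excessP p + excessPs ps ≡ k + suc (length aft) → k < excessP p →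
              labelsRooted (rerootAt l accC p ps k bef aft mb) ↭ l ∷ (labelsEdges accC ++ ((labelsP p ++ labelsPs ps) ++ (labelsDiamonds bef ++ (labelsDiamonds aft ++ labelsM mb))))
    rerootAt-labels l accC free ps zero [] aft mb vp vps eb ee k< =
      prep l (↭-trans (++⁺ (refl {xs = labelsM mb}) (++⁺ (refl {xs = labelsEdges accC}) (companionPs-labels l ps aft vps (sym (suc-injective ee)))))
        (solve 4 (λ x0 x1 x2 x3 → (x0 ⊕ (x1 ⊕ (x2 ⊕ x3)))
           ⊜ (x1 ⊕ (x2 ⊕ (x3 ⊕ x0))))
           ↭-refl (labelsM mb) (labelsEdges accC) (labelsPs ps) (labelsDiamonds aft)))
    rerootAt-labels l accC free ps zero (_ ∷ bef) aft mb vp vps () ee k<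
    rerootAt-labels l accC free ps (suc k) bef aft mb vp vps eb ee (s≤s ())
    rerootAt-labels l accC (black c) ps k bef aft mb vc vps eb ee k< =
      ↭-trans (reroot-labels c k bef Ta _ vc eb (Eq.trans (m<n⇒n≡m+suc[n∸suc[m]] (excess c) k k<) (cong (λ z → k + suc z) (sym eTa))))
        (↭-trans (++⁺ (refl {xs = labels c}) (++⁺ (refl {xs = labelsDiamonds bef}) (++⁺ (refl {xs = labelsDiamonds Ta})
                   (prep l (++⁺ (refl {xs = labelsM mb}) (++⁺ (refl {xs = labelsEdges accC}) (companionPs-labels l ps Dr vps eDr)))))))
          (↭-trans (solve 8 (λ x0 x1 x2 x3 x4 x5 x6 x7 → (x0 ⊕ (x1 ⊕ (x2 ⊕ (x3 ⊕ (x4 ⊕ (x5 ⊕ (x6 ⊕ x7)))))))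
                      ⊜ (x3 ⊕ (x5 ⊕ ((x0 ⊕ x6) ⊕ (x1 ⊕ ((x2 ⊕ x7) ⊕ x4))))))
                      ↭-refl (labels c) (labelsDiamonds bef) (labelsDiamonds Ta) (l ∷ []) (labelsM mb) (labelsEdges accC) (labelsPs ps) (labelsDiamonds Dr))
            (↭-reflexive (cong (λ z → l ∷ (labelsEdges accC ++ ((labels c ++ labelsPs ps) ++ (labelsDiamonds bef ++ (z ++ labelsM mb))))) (sym (labelsDiamonds-take-drop na aft))))))
      where
        na = excess c ∸ suc k
        ea : length aft ≡ na + excessPs ps
        ea = sym (m<n∧n+o≡m+suc[p]⇒[n∸suc[m]]+o≡p (excess c) (excessPs ps) k (length aft) k< ee)
        Ta = take na aft
        Dr = drop na aft
        eTa = length-take-+ na (excessPs ps) aft ea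
        eDr = length-drop-+ na (excessPs ps) aft ea
    rerootAt-labels l accC (red c) ps k bef aft mb (p0 , vc) vps eb ee k< =
      ↭-trans (reroot-labels c (suc k) (Ad ∷ bef) Ta nothing vc (cong suc eb)
                 (Eq.trans (sym (m>0⇒suc[pred[m]]≡m (excess c) p0)) (cong suc (Eq.trans (m<n⇒n≡m+suc[n∸suc[m]] (pred (excess c)) k k<) (cong (λ z → k + suc z) (sym eTa))))))
        (↭-trans (++⁺ (refl {xs = labels c}) (++⁺ (++⁺ (prep l (++⁺ (refl {xs = labelsM mb}) (++⁺ (refl {xs = labelsEdges accC}) (companionPs-labels l ps Dr vps eDr))))
                                                (refl {xs = labelsDiamonds bef})) (refl {xs = labelsDiamonds Ta ++ []})))
          (↭-trans (solve 8 (λ x0 x1 x2 x3 x4 x5 x6 x7 → (x0 ⊕ (((x3 ⊕ (x4 ⊕ (x5 ⊕ (x6 ⊕ x7)))) ⊕ x1) ⊕ (x2 ⊕ id)))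
                      ⊜ (x3 ⊕ (x5 ⊕ ((x0 ⊕ x6) ⊕ (x1 ⊕ ((x2 ⊕ x7) ⊕ x4))))))
                      ↭-refl (labels c) (labelsDiamonds bef) (labelsDiamonds Ta) (l ∷ []) (labelsM mb) (labelsEdges accC) (labelsPs ps) (labelsDiamonds Dr))
            (↭-reflexive (cong (λ z → l ∷ (labelsEdges accC ++ ((labels c ++ labelsPs ps) ++ (labelsDiamonds bef ++ (z ++ labelsM mb))))) (sym (labelsDiamonds-take-drop na aft))))))
      where
        na = pred (excess c) ∸ suc k
        ea : length aft ≡ na + excessPs ps
        ea = sym (m<n∧n+o≡m+suc[p]⇒[n∸suc[m]]+o≡p (pred (excess c)) (excessPs ps) k (length aft) k< ee)
        Ta = take na aft
        Dr = drop na aft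
        eTa = length-take-+ na (excessPs ps) aft ea
        eDr = length-drop-+ na (excessPs ps) aft ea
        Ad = pearlRooted diamond l mb accC (companionPs l ps Dr)

  labelsDiamonds-take-drop₃ : ∀ a b ts →
    labelsDiamonds (take a ts) ++ (labelsDiamonds (take b (drop a ts)) ++ labelsDiamonds (drop (a + b) ts)) ≡ labelsDiamonds ts
  labelsDiamonds-take-drop₃ a b ts =
    Eq.trans (cong (labelsDiamonds (take a ts) ++_) (sym (labelsDiamonds-++ (take b (drop a ts)) _)))
      (Eq.trans (sym (labelsDiamonds-++ (take a ts) _)) (cong labelsDiamonds (take++drop≡id₃ a b ts)))

  mutual
    rootAtMark-labels : ∀ t m ts mb → Valid t → length ts ≡ excess t → labelsProd (rootAtMark t m ts mb) ↭ labels t ++ (labelsDiamonds ts ++ labelsM mb)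
    rootAtMark-labels (vertex l ps) here ts mb v e =
      prep l (↭-trans (++⁺ (refl {xs = labelsM mb}) (companionPs-labels l ps ts v e))
        (solve 3 (λ x0 x1 x2 → (x0 ⊕ (x1 ⊕ x2)) ⊜ (x1 ⊕ (x2 ⊕ x0))) ↭-refl (labelsM mb) (labelsPs ps) (labelsDiamonds ts)))
    rootAtMark-labels (vertex l ps) (inside m) ts mb v e = rootAtMarkPs-labels l [] ps m ts mb tt v e

    rootAtMarkPs-labels : ∀ l acc ps m ts mb → ValidPs acc → ValidPs ps → length ts ≡ excessPs acc + excessPs ps →
           labelsProd (rootAtMarkPs l acc ps m ts mb) ↭ l ∷ (labelsPs acc ++ (labelsPs ps ++ (labelsDiamonds ts ++ labelsM mb)))
    rootAtMarkPs-labels l acc (p ∷ ps) (later m) ts mb va (vp , vps) e =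
      ↭-trans (rootAtMarkPs-labels l (acc ++ p ∷ []) ps m ts mb (ValidPs-++ acc (p ∷ []) va (vp , tt)) vps e')
        (prep l (↭-trans (↭-reflexive (cong (_++ (labelsPs ps ++ (labelsDiamonds ts ++ labelsM mb))) (Eq.trans (labelsPs-++ acc (p ∷ [])) (cong (labelsPs acc ++_) (++-identityʳ (labelsP p))))))
          (solve 5 (λ x0 x1 x2 x3 x4 → ((x0 ⊕ x1) ⊕ (x2 ⊕ (x3 ⊕ x4)))
             ⊜ (x0 ⊕ ((x1 ⊕ x2) ⊕ (x3 ⊕ x4))))
             ↭-refl (labelsPs acc) (labelsP p) (labelsPs ps) (labelsDiamonds ts) (labelsM mb))))
      where
        e' : length ts ≡ excessPs (acc ++ p ∷ []) + excessPs ps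
        e' = Eq.trans e (Eq.trans (sym (+-assoc (excessPs acc) (excessP p) (excessPs ps)))
               (cong (_+ excessPs ps) (sym (Eq.trans (excessPs-++ acc (p ∷ [])) (cong (excessPs acc +_) (+-identityʳ (excessP p)))))))
    rootAtMarkPs-labels l acc (black c ∷ ps) (inBlack m) ts mb va (vc , vps) e =
      ↭-trans (rootAtMark-labels c m Ch _ vc eCh)
        (↭-trans (++⁺ (refl {xs = labels c}) (++⁺ (refl {xs = labelsDiamonds Ch}) (prep l (++⁺ (refl {xs = labelsM mb})
                   (++⁺ (companionPs-labels l acc Cb va eCb) (companionPs-labels l ps Ca vps eCa))))))
          (↭-trans (solve 8 (λ x0 x1 x2 x3 x4 x5 x6 x7 → (x0 ⊕ (x1 ⊕ (x2 ⊕ (x3 ⊕ ((x4 ⊕ x5) ⊕ (x6 ⊕ x7))))))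
                      ⊜ (x2 ⊕ (x4 ⊕ ((x0 ⊕ x6) ⊕ ((x5 ⊕ (x7 ⊕ x1)) ⊕ x3)))))
                      ↭-refl (labels c) (labelsDiamonds Ch) (l ∷ []) (labelsM mb) (labelsPs acc) (labelsDiamonds Cb) (labelsPs ps) (labelsDiamonds Ca))
            (↭-reflexive (cong (λ z → l ∷ (labelsPs acc ++ ((labels c ++ labelsPs ps) ++ (z ++ labelsM mb)))) (labelsDiamonds-take-drop₃ nb na ts)))))
      where
        nb = excessPs acc
        na = excessPs ps
        Cb = take nb ts
        Ca = take na (drop nb ts)
        Ch = drop (nb + na) ts
        e1 : length ts ≡ nb + (na + excess c)
        e1 = Eq.trans e (cong (nb +_) (+-comm (excess c) na))
        e2 : length ts ≡ (nb + na) + excess c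
        e2 = Eq.trans e1 (sym (+-assoc nb na (excess c)))
        eCb = length-take-+ nb (na + excess c) ts e1
        eCa = length-take-+ na (excess c) (drop nb ts) (length-drop-+ nb (na + excess c) ts e1)
        eCh = length-drop-+ (nb + na) (excess c) ts e2
    rootAtMarkPs-labels l acc (red c ∷ ps) (inRed m) ts mb va ((p0 , vc) , vps) e =
      ↭-trans (rootAtMark-labels c m (Ad ∷ Ch) nothing vc (Eq.trans (cong suc eCh) (m>0⇒suc[pred[m]]≡m (excess c) p0)))
        (↭-trans (++⁺ (refl {xs = labels c}) (++⁺ (++⁺ (prep l (++⁺ (refl {xs = labelsM mb})
                   (++⁺ (companionPs-labels l acc Cb va eCb) (companionPs-labels l ps Ca vps eCa)))) (refl {xs = labelsDiamonds Ch})) (refl {xs = []})))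
          (↭-trans (solve 8 (λ x0 x1 x2 x3 x4 x5 x6 x7 → (x0 ⊕ ((x2 ⊕ (x3 ⊕ ((x4 ⊕ x5) ⊕ (x6 ⊕ x7)))) ⊕ x1) ⊕ id)
                      ⊜ (x2 ⊕ (x4 ⊕ ((x0 ⊕ x6) ⊕ ((x5 ⊕ (x7 ⊕ x1)) ⊕ x3)))))
                      ↭-refl (labels c) (labelsDiamonds Ch) (l ∷ []) (labelsM mb) (labelsPs acc) (labelsDiamonds Cb) (labelsPs ps) (labelsDiamonds Ca))
            (↭-reflexive (cong (λ z → l ∷ (labelsPs acc ++ ((labels c ++ labelsPs ps) ++ (z ++ labelsM mb)))) (labelsDiamonds-take-drop₃ nb na ts)))))
      where
        nb = excessPs acc
        na = excessPs ps
        x = pred (excess c)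
        Cb = take nb ts
        Ca = take na (drop nb ts)
        Ch = drop (nb + na) ts
        e1 : length ts ≡ nb + (na + x)
        e1 = Eq.trans e (cong (nb +_) (+-comm x na))
        e2 : length ts ≡ (nb + na) + x
        e2 = Eq.trans e1 (sym (+-assoc nb na x))
        eCb = length-take-+ nb (na + x) ts e1
        eCa = length-take-+ na x (drop nb ts) (length-drop-+ nb (na + x) ts e1)
        eCh = length-drop-+ (nb + na) x ts e2
        Ad = pearlRooted diamond l mb (companionPs l acc Cb) (companionPs l ps Ca)

module LabelQ (Q : Word → Set) where

  open import Data.Nat using (zero; suc; _+_; _≤_; z≤n; s≤s)
  open import Data.Nat.Properties
  open import Data.List using (List; []; _∷_; _++_; map)
  open import Data.List.Properties using (map-++)
  open import Data.List.Relation.Unary.All using (All; []; _∷_)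
  open import Data.List.Relation.Unary.All.Properties using (++⁺; ++⁻ˡ; ++⁻ʳ)
  open import Data.Maybe using (Maybe)
  open import Data.Product using (Σ; _×_; _,_; proj₁; proj₂)
  open import Data.Unit using (tt)
  open import Data.Empty using (⊥-elim)
  open import Relation.Binary.PropositionalEquality
  open import Function.Bundles using (_↔_; mk↔ₛ′)

  L : Set
  L = Σ Word Q

  open ListFacts
  open Trees L
  open LeftInverse L
  open Bijection L
  open Spelling L proj₁
  open Labels L

  mutual
    label : (t : QTree) → All Q (necklacesQ t) → Tree
    label (node ps) (q ∷ a) = vertex (map qLetter ps , q) (labelPs ps a)
    labelPs : (ps : List QPearl) → All Q (necklacesQs ps) → List Pearl
    labelPs [] _ = []
    labelPs (dotE t ∷ ps) a = black (label t (++⁻ˡ (necklacesQ t) a)) ∷ labelPs ps (++⁻ʳ (necklacesQ t) a)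
    labelPs (diaE t ∷ ps) a = red (label t (++⁻ˡ (necklacesQ t) a)) ∷ labelPs ps (++⁻ʳ (necklacesQ t) a)
    labelPs (triP ∷ ps) a = free ∷ labelPs ps a

  mutual
    unlabel : Tree → QTree
    unlabel (vertex l ps) = node (unlabelPs ps)
    unlabelPs : List Pearl → List QPearl
    unlabelPs [] = []
    unlabelPs (black t ∷ ps) = dotE (unlabel t) ∷ unlabelPs ps
    unlabelPs (red t ∷ ps) = diaE (unlabel t) ∷ unlabelPs ps
    unlabelPs (free ∷ ps) = triP ∷ unlabelPs ps

  letters-unlabelPs : ∀ ps → map pearlLetter ps ≡ map qLetter (unlabelPs ps)
  letters-unlabelPs [] = refl
  letters-unlabelPs (black t ∷ ps) = cong (dot ∷_) (letters-unlabelPs ps)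
  letters-unlabelPs (red t ∷ ps) = cong (diamond ∷_) (letters-unlabelPs ps)
  letters-unlabelPs (free ∷ ps) = cong (triangle ∷_) (letters-unlabelPs ps)

  letters-labelPs : ∀ ps a → map qLetter ps ≡ map pearlLetter (labelPs ps a)
  letters-labelPs [] a = refl
  letters-labelPs (dotE t ∷ ps) a = cong (dot ∷_) (letters-labelPs ps _)
  letters-labelPs (diaE t ∷ ps) a = cong (diamond ∷_) (letters-labelPs ps _)
  letters-labelPs (triP ∷ ps) a = cong (triangle ∷_) (letters-labelPs ps _)

  mutual
    label-spelt : ∀ t a → Spelt (label t a)
    label-spelt (node ps) (q ∷ a) = letters-labelPs ps a , labelPs-spelt ps a
    labelPs-spelt : ∀ ps a → SpeltPs (labelPs ps a)
    labelPs-spelt [] a = tt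
    labelPs-spelt (dotE t ∷ ps) a = label-spelt t _ , labelPs-spelt ps _
    labelPs-spelt (diaE t ∷ ps) a = label-spelt t _ , labelPs-spelt ps _
    labelPs-spelt (triP ∷ ps) a = tt , labelPs-spelt ps _

  mutual
    unlabel-inQ : (t : Tree) → Spelt t → All Q (necklacesQ (unlabel t))
    unlabel-inQ (vertex (w , q) ps) (e , c) = subst Q (trans e (letters-unlabelPs ps)) q ∷ unlabelPs-inQ ps c
    unlabelPs-inQ : (ps : List Pearl) → SpeltPs ps → All Q (necklacesQs (unlabelPs ps))
    unlabelPs-inQ [] _ = []
    unlabelPs-inQ (black t ∷ ps) (c1 , c2) = ++⁺ (unlabel-inQ t c1) (unlabelPs-inQ ps c2)
    unlabelPs-inQ (red t ∷ ps) (c1 , c2) = ++⁺ (unlabel-inQ t c1) (unlabelPs-inQ ps c2)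
    unlabelPs-inQ (free ∷ ps) (_ , c2) = unlabelPs-inQ ps c2

  mutual
    labelMark : ∀ {t a} → MarkQ t → Mark (label t a)
    labelMark {node ps} {q ∷ a} here = here
    labelMark {node ps} {q ∷ a} (inside m) = inside (labelMarkPs m)
    labelMarkPs : ∀ {ps a} → MarkQs ps → MarkPs (labelPs ps a)
    labelMarkPs {dotE t ∷ ps} (inDot m) = inBlack (labelMark m)
    labelMarkPs {diaE t ∷ ps} (inDia m) = inRed (labelMark m)
    labelMarkPs {dotE t ∷ ps} (later m) = later (labelMarkPs m)
    labelMarkPs {diaE t ∷ ps} (later m) = later (labelMarkPs m)
    labelMarkPs {triP ∷ ps} (later m) = later (labelMarkPs m)

  mutual
    unlabelMark : ∀ {t} → Mark t → MarkQ (unlabel t)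
    unlabelMark {vertex l ps} here = here
    unlabelMark (inside m) = inside (unlabelMarkPs m)
    unlabelMarkPs : ∀ {ps} → MarkPs ps → MarkQs (unlabelPs ps)
    unlabelMarkPs (inBlack m) = inDot (unlabelMark m)
    unlabelMarkPs (inRed m) = inDia (unlabelMark m)
    unlabelMarkPs {black t ∷ ps} (later m) = later (unlabelMarkPs m)
    unlabelMarkPs {red t ∷ ps} (later m) = later (unlabelMarkPs m)
    unlabelMarkPs {free ∷ ps} (later m) = later (unlabelMarkPs m)

  QTreeIn : Set
  QTreeIn = Σ QTree (λ t → All Q (necklacesQ t))
  MarkedQTreeIn : Set
  MarkedQTreeIn = Σ QTree (λ t → All Q (necklacesQ t) × MarkQ t)
  QPearlsIn : Set
  QPearlsIn = Σ (List QPearl) (λ ps → All Q (necklacesQs ps))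
  MarkedQPearlsIn : Set
  MarkedQPearlsIn = Σ (List QPearl) (λ ps → All Q (necklacesQs ps) × MarkQs ps)

  subst-≡-id : ∀ {w} (e : w ≡ w) (q : Q w) → subst Q e q ≡ q
  subst-≡-id e q rewrite Word-≡-irrelevant e refl = refl

  ≡-node : ∀ {ps X} {a : All Q (necklacesQs ps)} {Y} → _≡_ {A = QPearlsIn} (X , Y) (ps , a) →
    (e : map qLetter ps ≡ map qLetter X) (q : Q (map qLetter ps)) → _≡_ {A = QTreeIn} (node X , subst Q e q ∷ Y) (node ps , q ∷ a)
  ≡-node {ps} {a = a} refl e q = cong (λ z → node ps , z ∷ a) (subst-≡-id e q)

  ≡-node-here : ∀ {ps X} {a : All Q (necklacesQs ps)} {Y} → _≡_ {A = QPearlsIn} (X , Y) (ps , a) →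
    (e : map qLetter ps ≡ map qLetter X) (q : Q (map qLetter ps)) → _≡_ {A = MarkedQTreeIn} (node X , subst Q e q ∷ Y , here) (node ps , q ∷ a , here)
  ≡-node-here {ps} {a = a} refl e q = cong (λ z → node ps , z ∷ a , here) (subst-≡-id e q)

  ≡-node-inside : ∀ {ps X} {a : All Q (necklacesQs ps)} {Y} {m : MarkQs ps} {M} → _≡_ {A = MarkedQPearlsIn} (X , Y , M) (ps , a , m) →
    (e : map qLetter ps ≡ map qLetter X) (q : Q (map qLetter ps)) → _≡_ {A = MarkedQTreeIn} (node X , subst Q e q ∷ Y , inside M) (node ps , q ∷ a , inside m)
  ≡-node-inside {ps} {a = a} {m = m} refl e q = cong (λ z → node ps , z ∷ a , inside m) (subst-≡-id e q)

  ≡-dotE : ∀ {t ps T X a1 a2 A Y} → _≡_ {A = QTreeIn} (T , A) (t , a1) → _≡_ {A = QPearlsIn} (X , Y) (ps , a2) →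
         _≡_ {A = QPearlsIn} (dotE T ∷ X , ++⁺ A Y) (dotE t ∷ ps , ++⁺ a1 a2)
  ≡-dotE refl refl = refl
  ≡-diaE : ∀ {t ps T X a1 a2 A Y} → _≡_ {A = QTreeIn} (T , A) (t , a1) → _≡_ {A = QPearlsIn} (X , Y) (ps , a2) →
         _≡_ {A = QPearlsIn} (diaE T ∷ X , ++⁺ A Y) (diaE t ∷ ps , ++⁺ a1 a2)
  ≡-diaE refl refl = refl
  ≡-dotE-inDot : ∀ {t ps T X a1 a2 A Y m M} → _≡_ {A = MarkedQTreeIn} (T , A , M) (t , a1 , m) → _≡_ {A = QPearlsIn} (X , Y) (ps , a2) →
         _≡_ {A = MarkedQPearlsIn} (dotE T ∷ X , ++⁺ A Y , inDot M) (dotE t ∷ ps , ++⁺ a1 a2 , inDot m)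
  ≡-dotE-inDot refl refl = refl
  ≡-diaE-inDia : ∀ {t ps T X a1 a2 A Y m M} → _≡_ {A = MarkedQTreeIn} (T , A , M) (t , a1 , m) → _≡_ {A = QPearlsIn} (X , Y) (ps , a2) →
         _≡_ {A = MarkedQPearlsIn} (diaE T ∷ X , ++⁺ A Y , inDia M) (diaE t ∷ ps , ++⁺ a1 a2 , inDia m)
  ≡-diaE-inDia refl refl = refl
  ≡-dotE-later : ∀ {t ps T X a1 a2 A Y m M} → _≡_ {A = QTreeIn} (T , A) (t , a1) → _≡_ {A = MarkedQPearlsIn} (X , Y , M) (ps , a2 , m) →
         _≡_ {A = MarkedQPearlsIn} (dotE T ∷ X , ++⁺ A Y , later M) (dotE t ∷ ps , ++⁺ a1 a2 , later m)
  ≡-dotE-later refl refl = refl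
  ≡-diaE-later : ∀ {t ps T X a1 a2 A Y m M} → _≡_ {A = QTreeIn} (T , A) (t , a1) → _≡_ {A = MarkedQPearlsIn} (X , Y , M) (ps , a2 , m) →
         _≡_ {A = MarkedQPearlsIn} (diaE T ∷ X , ++⁺ A Y , later M) (diaE t ∷ ps , ++⁺ a1 a2 , later m)
  ≡-diaE-later refl refl = refl

  mutual
    unlabel-label : ∀ t a → _≡_ {A = QTreeIn} (unlabel (label t a) , unlabel-inQ (label t a) (label-spelt t a)) (t , a)
    unlabel-label (node ps) (q ∷ a) = ≡-node (unlabelPs-labelPs ps a) (trans (letters-labelPs ps a) (letters-unlabelPs (labelPs ps a))) q

    unlabelPs-labelPs : ∀ ps a → _≡_ {A = QPearlsIn} (unlabelPs (labelPs ps a) , unlabelPs-inQ (labelPs ps a) (labelPs-spelt ps a)) (ps , a)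
    unlabelPs-labelPs [] [] = refl
    unlabelPs-labelPs (dotE t ∷ ps) a = trans (≡-dotE (unlabel-label t _) (unlabelPs-labelPs ps _)) (cong (λ z → dotE t ∷ ps , z) (++⁺-++⁻ (necklacesQ t) a))
    unlabelPs-labelPs (diaE t ∷ ps) a = trans (≡-diaE (unlabel-label t _) (unlabelPs-labelPs ps _)) (cong (λ z → diaE t ∷ ps , z) (++⁺-++⁻ (necklacesQ t) a))
    unlabelPs-labelPs (triP ∷ ps) a = cong (λ z → triP ∷ proj₁ z , proj₂ z) (unlabelPs-labelPs ps a)

  mutual
    unlabelMark-labelMark : ∀ t a m → _≡_ {A = MarkedQTreeIn} (unlabel (label t a) , unlabel-inQ (label t a) (label-spelt t a) , unlabelMark (labelMark {t} {a} m)) (t , a , m)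
    unlabelMark-labelMark (node ps) (q ∷ a) here = ≡-node-here (unlabelPs-labelPs ps a) (trans (letters-labelPs ps a) (letters-unlabelPs (labelPs ps a))) q
    unlabelMark-labelMark (node ps) (q ∷ a) (inside m) = ≡-node-inside (unlabelMarkPs-labelMarkPs ps a m) (trans (letters-labelPs ps a) (letters-unlabelPs (labelPs ps a))) q

    unlabelMarkPs-labelMarkPs : ∀ ps a m → _≡_ {A = MarkedQPearlsIn} (unlabelPs (labelPs ps a) , unlabelPs-inQ (labelPs ps a) (labelPs-spelt ps a) , unlabelMarkPs (labelMarkPs {ps} {a} m)) (ps , a , m)
    unlabelMarkPs-labelMarkPs (dotE t ∷ ps) a (inDot m) = trans (≡-dotE-inDot (unlabelMark-labelMark t _ m) (unlabelPs-labelPs ps _)) (cong (λ z → dotE t ∷ ps , z , inDot m) (++⁺-++⁻ (necklacesQ t) a))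
    unlabelMarkPs-labelMarkPs (diaE t ∷ ps) a (inDia m) = trans (≡-diaE-inDia (unlabelMark-labelMark t _ m) (unlabelPs-labelPs ps _)) (cong (λ z → diaE t ∷ ps , z , inDia m) (++⁺-++⁻ (necklacesQ t) a))
    unlabelMarkPs-labelMarkPs (dotE t ∷ ps) a (later m) = trans (≡-dotE-later (unlabel-label t _) (unlabelMarkPs-labelMarkPs ps _ m)) (cong (λ z → dotE t ∷ ps , z , later m) (++⁺-++⁻ (necklacesQ t) a))
    unlabelMarkPs-labelMarkPs (diaE t ∷ ps) a (later m) = trans (≡-diaE-later (unlabel-label t _) (unlabelMarkPs-labelMarkPs ps _ m)) (cong (λ z → diaE t ∷ ps , z , later m) (++⁺-++⁻ (necklacesQ t) a))
    unlabelMarkPs-labelMarkPs (triP ∷ ps) a (later m) = cong (λ z → triP ∷ proj₁ z , proj₁ (proj₂ z) , later (proj₂ (proj₂ z))) (unlabelMarkPs-labelMarkPs ps a m)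

  ≡-subst : ∀ {w w' : Word} (e : w ≡ w') (q : Q w) → _≡_ {A = L} (w' , subst Q e q) (w , q)
  ≡-subst refl q = refl

  MarkedPearls : Set
  MarkedPearls = Σ (List Pearl) MarkPs

  ≡-inside : ∀ {l l' : L} {ps X} {m : MarkPs ps} {M : MarkPs X} → l' ≡ l → _≡_ {A = MarkedPearls} (X , M) (ps , m) →
          _≡_ {A = MarkedTree} (vertex l' X , inside M) (vertex l ps , inside m)
  ≡-inside refl refl = refl
  ≡-inBlack : ∀ {t T ps X} {m : Mark t} {M : Mark T} → _≡_ {A = MarkedTree} (T , M) (t , m) → X ≡ ps → _≡_ {A = MarkedPearls} (black T ∷ X , inBlack M) (black t ∷ ps , inBlack m)
  ≡-inBlack refl refl = refl
  ≡-inRed : ∀ {t T ps X} {m : Mark t} {M : Mark T} → _≡_ {A = MarkedTree} (T , M) (t , m) → X ≡ ps → _≡_ {A = MarkedPearls} (red T ∷ X , inRed M) (red t ∷ ps , inRed m)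
  ≡-inRed refl refl = refl
  ≡-later : ∀ {p P ps X} {m : MarkPs ps} {M : MarkPs X} → P ≡ p → _≡_ {A = MarkedPearls} (X , M) (ps , m) → _≡_ {A = MarkedPearls} (P ∷ X , later M) (p ∷ ps , later m)
  ≡-later refl refl = refl

  mutual
    label-unlabel : ∀ t c a' → a' ≡ unlabel-inQ t c → label (unlabel t) a' ≡ t
    label-unlabel (vertex (w , q) ps) (e , c) a' refl = cong₂ vertex (≡-subst (trans e (letters-unlabelPs ps)) q) (labelPs-unlabelPs ps c _ refl)

    labelPs-unlabelPs : ∀ ps c a' → a' ≡ unlabelPs-inQ ps c → labelPs (unlabelPs ps) a' ≡ ps
    labelPs-unlabelPs [] c a' e = refl
    labelPs-unlabelPs (black t ∷ ps) (c1 , c2) a' refl =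
      cong₂ _∷_ (cong black (label-unlabel t c1 _ inQˡ)) (labelPs-unlabelPs ps c2 _ inQʳ)
      where
        inQˡ = ++⁻ˡ-++⁺ (necklacesQ (unlabel t)) (unlabel-inQ t c1) (unlabelPs-inQ ps c2)
        inQʳ = ++⁻ʳ-++⁺ (necklacesQ (unlabel t)) (unlabel-inQ t c1) (unlabelPs-inQ ps c2)
    labelPs-unlabelPs (red t ∷ ps) (c1 , c2) a' refl =
      cong₂ _∷_ (cong red (label-unlabel t c1 _ inQˡ)) (labelPs-unlabelPs ps c2 _ inQʳ)
      where
        inQˡ = ++⁻ˡ-++⁺ (necklacesQ (unlabel t)) (unlabel-inQ t c1) (unlabelPs-inQ ps c2)
        inQʳ = ++⁻ʳ-++⁺ (necklacesQ (unlabel t)) (unlabel-inQ t c1) (unlabelPs-inQ ps c2)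
    labelPs-unlabelPs (free ∷ ps) (_ , c2) a' e = cong (free ∷_) (labelPs-unlabelPs ps c2 a' e)

  mutual
    labelMark-unlabelMark : ∀ t c a' m → a' ≡ unlabel-inQ t c → _≡_ {A = MarkedTree} (label (unlabel t) a' , labelMark {unlabel t} {a'} (unlabelMark m)) (t , m)
    labelMark-unlabelMark (vertex (w , q) ps) (e , c) a' here refl = cong (λ z → z , here) (label-unlabel (vertex (w , q) ps) (e , c) _ refl)
    labelMark-unlabelMark (vertex (w , q) ps) (e , c) a' (inside m) refl = ≡-inside (≡-subst (trans e (letters-unlabelPs ps)) q) (labelMarkPs-unlabelMarkPs ps c _ m refl)

    labelMarkPs-unlabelMarkPs : ∀ ps c a' m → a' ≡ unlabelPs-inQ ps c → _≡_ {A = MarkedPearls} (labelPs (unlabelPs ps) a' , labelMarkPs {unlabelPs ps} {a'} (unlabelMarkPs m)) (ps , m)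
    labelMarkPs-unlabelMarkPs (black t ∷ ps) (c1 , c2) a' (inBlack m) refl =
      ≡-inBlack (labelMark-unlabelMark t c1 _ m inQˡ) (labelPs-unlabelPs ps c2 _ inQʳ)
      where
        inQˡ = ++⁻ˡ-++⁺ (necklacesQ (unlabel t)) (unlabel-inQ t c1) (unlabelPs-inQ ps c2)
        inQʳ = ++⁻ʳ-++⁺ (necklacesQ (unlabel t)) (unlabel-inQ t c1) (unlabelPs-inQ ps c2)
    labelMarkPs-unlabelMarkPs (red t ∷ ps) (c1 , c2) a' (inRed m) refl =
      ≡-inRed (labelMark-unlabelMark t c1 _ m inQˡ) (labelPs-unlabelPs ps c2 _ inQʳ)
      where
        inQˡ = ++⁻ˡ-++⁺ (necklacesQ (unlabel t)) (unlabel-inQ t c1) (unlabelPs-inQ ps c2)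
        inQʳ = ++⁻ʳ-++⁺ (necklacesQ (unlabel t)) (unlabel-inQ t c1) (unlabelPs-inQ ps c2)
    labelMarkPs-unlabelMarkPs (black t ∷ ps) (c1 , c2) a' (later m) refl =
      ≡-later (cong black (label-unlabel t c1 _ inQˡ)) (labelMarkPs-unlabelMarkPs ps c2 _ m inQʳ)
      where
        inQˡ = ++⁻ˡ-++⁺ (necklacesQ (unlabel t)) (unlabel-inQ t c1) (unlabelPs-inQ ps c2)
        inQʳ = ++⁻ʳ-++⁺ (necklacesQ (unlabel t)) (unlabel-inQ t c1) (unlabelPs-inQ ps c2)
    labelMarkPs-unlabelMarkPs (red t ∷ ps) (c1 , c2) a' (later m) refl =
      ≡-later (cong red (label-unlabel t c1 _ inQˡ)) (labelMarkPs-unlabelMarkPs ps c2 _ m inQʳ)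
      where
        inQˡ = ++⁻ˡ-++⁺ (necklacesQ (unlabel t)) (unlabel-inQ t c1) (unlabelPs-inQ ps c2)
        inQʳ = ++⁻ʳ-++⁺ (necklacesQ (unlabel t)) (unlabel-inQ t c1) (unlabelPs-inQ ps c2)
    labelMarkPs-unlabelMarkPs (free ∷ ps) (_ , c2) a' (later m) e = ≡-later refl (labelMarkPs-unlabelMarkPs ps c2 a' m e)

  mutual
    label-valid : ∀ t a → NonNeg t → Valid (label t a) × (triT t ≡ excess (label t a) + diaT t)
    label-valid (node ps) (q ∷ a) (_ , nns) = labelPs-valid ps a nns

    labelPs-valid : ∀ ps a → NonNegs ps → ValidPs (labelPs ps a) × (triPs ps ≡ excessPs (labelPs ps a) + diaPs ps)
    labelPs-valid [] a _ = tt , refl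
    labelPs-valid (dotE t ∷ ps) a (le , nn , nns) with label-valid t (++⁻ˡ (necklacesQ t) a) nn | labelPs-valid ps (++⁻ʳ (necklacesQ t) a) nns
    ... | (v1 , e1) | (v2 , e2) = (v1 , v2) , trans (cong₂ _+_ e1 e2) ([m+n]+[o+p]≡[m+o]+[n+p] (excess (label t (++⁻ˡ (necklacesQ t) a))) (diaT t) _ _)
    labelPs-valid (diaE t ∷ ps) a (le , nn , nns) with label t (++⁻ˡ (necklacesQ t) a) | label-valid t (++⁻ˡ (necklacesQ t) a) nn | labelPs-valid ps (++⁻ʳ (necklacesQ t) a) nns
    ... | T | (v1 , e1) | (v2 , e2) with excess T in eqT
    ...   | zero = ⊥-elim (<-irrefl refl (subst (suc (diaT t) ≤_) e1 le))
    ...   | suc k = ((s≤s z≤n , v1) , v2) , trans (cong₂ _+_ e1 e2) ([suc[m]+n]+[o+p]≡[m+o]+suc[n+p] k _ _ _)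
    labelPs-valid (triP ∷ ps) a nns with labelPs-valid ps a nns
    ... | (v2 , e2) = (tt , v2) , cong suc e2

  mutual
    unlabel-nonNeg : ∀ t → Valid t → NonNeg (unlabel t) × (triT (unlabel t) ≡ excess t + diaT (unlabel t))
    unlabel-nonNeg (vertex l ps) v with unlabelPs-nonNeg ps v
    ... | (nn , e) = (subst (diaPs (unlabelPs ps) ≤_) (sym e) (m≤n+m _ _) , nn) , e

    unlabelPs-nonNeg : ∀ ps → ValidPs ps → NonNegs (unlabelPs ps) × (triPs (unlabelPs ps) ≡ excessPs ps + diaPs (unlabelPs ps))
    unlabelPs-nonNeg [] _ = tt , refl
    unlabelPs-nonNeg (black t ∷ ps) (v1 , v2) with unlabel-nonNeg t v1 | unlabelPs-nonNeg ps v2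
    ... | (nn1 , e1) | (nn2 , e2) = (subst (diaT (unlabel t) ≤_) (sym e1) (m≤n+m _ _) , nn1 , nn2) , trans (cong₂ _+_ e1 e2) ([m+n]+[o+p]≡[m+o]+[n+p] (excess t) (diaT (unlabel t)) _ _)
    unlabelPs-nonNeg (red t ∷ ps) ((p0 , v1) , v2) with unlabel-nonNeg t v1 | unlabelPs-nonNeg ps v2
    ... | (nn1 , e1) | (nn2 , e2) with excess t | p0
    ...   | suc k | _ = (subst (suc (diaT (unlabel t)) ≤_) (sym e1) (s≤s (m≤n+m _ _)) , nn1 , nn2) , trans (cong₂ _+_ e1 e2) ([suc[m]+n]+[o+p]≡[m+o]+suc[n+p] k _ _ _)
    unlabelPs-nonNeg (free ∷ ps) (_ , v2) with unlabelPs-nonNeg ps v2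
    ... | (nn2 , e2) = nn2 , cong suc e2

  mutual
    NonNeg-irrelevant : ∀ t (a b : NonNeg t) → a ≡ b
    NonNeg-irrelevant (node ps) (x , y) (x' , y') = cong₂ _,_ (≤-irrelevant x x') (NonNegs-irrelevant ps y y')
    NonNegs-irrelevant : ∀ ps (a b : NonNegs ps) → a ≡ b
    NonNegs-irrelevant [] tt tt = refl
    NonNegs-irrelevant (dotE t ∷ ps) (a , b , c) (a' , b' , c') = cong₂ _,_ (≤-irrelevant a a') (cong₂ _,_ (NonNeg-irrelevant t b b') (NonNegs-irrelevant ps c c'))
    NonNegs-irrelevant (diaE t ∷ ps) (a , b , c) (a' , b' , c') = cong₂ _,_ (≤-irrelevant a a') (cong₂ _,_ (NonNeg-irrelevant t b b') (NonNegs-irrelevant ps c c'))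
    NonNegs-irrelevant (triP ∷ ps) a b = NonNegs-irrelevant ps a b

  label-excess≡0 : ∀ t a → NonNeg t → triT t ≡ diaT t → excess (label t a) ≡ 0
  label-excess≡0 t a nn e = +-cancelʳ-≡ (diaT t) (excess (label t a)) 0 (trans (sym (proj₂ (label-valid t a nn))) e)

  toSpelt : F0∘ Q → SpeltZeroExcess
  toSpelt (t , a , nn , e , m) =
    ((label t a , labelMark m) , proj₁ (label-valid t a nn) , label-excess≡0 t a nn e) , label-spelt t a

  fromSpelt : SpeltZeroExcess → F0∘ Q
  fromSpelt (((t , m) , v , e) , c) =
    unlabel t , unlabel-inQ t c , proj₁ (unlabel-nonNeg t v) ,
    trans (proj₂ (unlabel-nonNeg t v)) (cong (_+ diaT (unlabel t)) e) , unlabelMark m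

  ≡-F0∘ : ∀ {t t′ a a′ m m′} → _≡_ {A = MarkedQTreeIn} (t , a , m) (t′ , a′ , m′) → ∀ nn nn′ e e′ →
          _≡_ {A = F0∘ Q} (t , a , nn , e , m) (t′ , a′ , nn′ , e′ , m′)
  ≡-F0∘ {t} {a = a} {m = m} refl nn nn′ e e′ =
    cong₂ (λ u v → t , a , u , v , m) (NonNeg-irrelevant t nn nn′) (≡-irrelevant e e′)

  F0∘↔SpeltZeroExcess : F0∘ Q ↔ SpeltZeroExcess
  F0∘↔SpeltZeroExcess = mk↔ₛ′ toSpelt fromSpelt to-from from-to
    where
      to-from : ∀ z → toSpelt (fromSpelt z) ≡ z
      to-from (((t , m) , v , e) , c) =
        Σ-≡-irrelevant (λ {z} → Spelt-irrelevant (proj₁ (proj₁ z)))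
          (Σ-≡-irrelevant (λ {s} → HasZeroExcess-irrelevant {s}) (labelMark-unlabelMark t c _ m refl))
      from-to : ∀ x → fromSpelt (toSpelt x) ≡ x
      from-to (t , a , nn , e , m) = ≡-F0∘ (unlabelMark-labelMark t a m) _ nn _ e

  mutual
    words-labels-label : ∀ t a → map proj₁ (labels (label t a)) ≡ necklacesQ t
    words-labels-label (node ps) (q ∷ a) = cong (map qLetter ps ∷_) (words-labelsPs-labelPs ps a)
    words-labelsPs-labelPs : ∀ ps a → map proj₁ (labelsPs (labelPs ps a)) ≡ necklacesQs ps
    words-labelsPs-labelPs [] a = refl
    words-labelsPs-labelPs (dotE t ∷ ps) a = trans (map-++ proj₁ (labels (label t _)) _) (cong₂ _++_ (words-labels-label t _) (words-labelsPs-labelPs ps _))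
    words-labelsPs-labelPs (diaE t ∷ ps) a = trans (map-++ proj₁ (labels (label t _)) _) (cong₂ _++_ (words-labels-label t _) (words-labelsPs-labelPs ps _))
    words-labelsPs-labelPs (triP ∷ ps) a = words-labelsPs-labelPs ps a

module LabelC (Q : Word → Set) where

  open import Data.List using (List; []; _∷_; _++_; map)
  open import Data.List.Properties using (map-++)
  open import Data.List.Relation.Unary.All using (All; []; _∷_)
  open import Data.List.Relation.Unary.All.Properties using (++⁺; ++⁻ˡ; ++⁻ʳ)
  open import Data.Maybe using (Maybe; just; nothing)
  open import Data.Product using (Σ; _,_; proj₁; proj₂)
  open import Data.Unit using (tt)
  open import Relation.Binary.PropositionalEquality
  open import Function.Bundles using (_↔_; mk↔ₛ′)

  L : Set
  L = Σ Word Q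

  open ListFacts
  open Trees L
  open Spelling L proj₁
  open Labels L
  open LabelQ Q using (subst-≡-id; ≡-subst)

  mutual
    labelBox : (t : CTree box) → All Q (necklacesC t) → CBox
    labelBox (boxRoot ps) (q ∷ a) = boxRooted (map cLetter ps , q) (labelEdges ps a)
    labelRooted : ∀ {ℓ} (t : CTree (pearl ℓ)) → All Q (necklacesC t) → CRooted ℓ
    labelRooted (letterRoot ℓ mb bs as) (q ∷ a) =
      pearlRooted ℓ (map cLetter bs ++ ℓ ∷ map cLetter as , q) (labelM mb (++⁻ˡ (necklacesCm mb) a))
        (labelEdges bs (++⁻ˡ (necklacesCs bs) (++⁻ʳ (necklacesCm mb) a))) (labelEdges as (++⁻ʳ (necklacesCs bs) (++⁻ʳ (necklacesCm mb) a)))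
    labelM : (mb : Maybe (CTree (pearl dot))) → All Q (necklacesCm mb) → Maybe CDot
    labelM nothing _ = nothing
    labelM (just t) a = just (labelRooted t a)
    labelEdges : (ps : List CPearl) → All Q (necklacesCs ps) → List CEdge
    labelEdges [] _ = []
    labelEdges (cDot t ∷ ps) a = toBox (labelBox t (++⁻ˡ (necklacesC t) a)) ∷ labelEdges ps (++⁻ʳ (necklacesC t) a)
    labelEdges (cDia t ∷ ps) a = toTriangle (labelRooted t (++⁻ˡ (necklacesC t) a)) ∷ labelEdges ps (++⁻ʳ (necklacesC t) a)
    labelEdges (cTri t ∷ ps) a = toDiamond (labelRooted t (++⁻ˡ (necklacesC t) a)) ∷ labelEdges ps (++⁻ʳ (necklacesC t) a)

  mutual
    unlabelBox : CBox → CTree box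
    unlabelBox (boxRooted l cs) = boxRoot (unlabelEdges cs)
    unlabelRooted : ∀ {ℓ} → CRooted ℓ → CTree (pearl ℓ)
    unlabelRooted (pearlRooted ℓ l mb bs as) = letterRoot ℓ (unlabelM mb) (unlabelEdges bs) (unlabelEdges as)
    unlabelM : Maybe CDot → Maybe (CTree (pearl dot))
    unlabelM nothing = nothing
    unlabelM (just d) = just (unlabelRooted d)
    unlabelEdges : List CEdge → List CPearl
    unlabelEdges [] = []
    unlabelEdges (toBox b ∷ cs) = cDot (unlabelBox b) ∷ unlabelEdges cs
    unlabelEdges (toTriangle r ∷ cs) = cDia (unlabelRooted r) ∷ unlabelEdges cs
    unlabelEdges (toDiamond a ∷ cs) = cTri (unlabelRooted a) ∷ unlabelEdges cs

  letters-unlabelEdges : ∀ cs → map edgeLetter cs ≡ map cLetter (unlabelEdges cs)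
  letters-unlabelEdges [] = refl
  letters-unlabelEdges (toBox b ∷ cs) = cong (dot ∷_) (letters-unlabelEdges cs)
  letters-unlabelEdges (toTriangle r ∷ cs) = cong (diamond ∷_) (letters-unlabelEdges cs)
  letters-unlabelEdges (toDiamond a ∷ cs) = cong (triangle ∷_) (letters-unlabelEdges cs)

  letters-labelEdges : ∀ ps a → map cLetter ps ≡ map edgeLetter (labelEdges ps a)
  letters-labelEdges [] a = refl
  letters-labelEdges (cDot t ∷ ps) a = cong (dot ∷_) (letters-labelEdges ps _)
  letters-labelEdges (cDia t ∷ ps) a = cong (diamond ∷_) (letters-labelEdges ps _)
  letters-labelEdges (cTri t ∷ ps) a = cong (triangle ∷_) (letters-labelEdges ps _)

  mutual
    labelBox-spelt : ∀ t a → SpeltBox (labelBox t a)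
    labelBox-spelt (boxRoot ps) (q ∷ a) = letters-labelEdges ps a , labelEdges-spelt ps a
    labelRooted-spelt : ∀ {ℓ} (t : CTree (pearl ℓ)) a → SpeltRooted (labelRooted t a)
    labelRooted-spelt (letterRoot ℓ mb bs as) (q ∷ a) =
      cong₂ (λ x y → x ++ ℓ ∷ y) (letters-labelEdges bs _) (letters-labelEdges as _) , labelM-spelt mb _ , labelEdges-spelt bs _ , labelEdges-spelt as _
    labelM-spelt : ∀ mb a → SpeltM (labelM mb a)
    labelM-spelt nothing a = tt
    labelM-spelt (just t) a = labelRooted-spelt t a
    labelEdges-spelt : ∀ ps a → SpeltEdges (labelEdges ps a)
    labelEdges-spelt [] a = tt
    labelEdges-spelt (cDot t ∷ ps) a = labelBox-spelt t _ , labelEdges-spelt ps _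
    labelEdges-spelt (cDia t ∷ ps) a = labelRooted-spelt t _ , labelEdges-spelt ps _
    labelEdges-spelt (cTri t ∷ ps) a = labelRooted-spelt t _ , labelEdges-spelt ps _

  letters-unlabelRooted : ∀ {ℓ} bs as → map edgeLetter bs ++ ℓ ∷ map edgeLetter as ≡ map cLetter (unlabelEdges bs) ++ ℓ ∷ map cLetter (unlabelEdges as)
  letters-unlabelRooted {ℓ} bs as = cong₂ (λ x y → x ++ ℓ ∷ y) (letters-unlabelEdges bs) (letters-unlabelEdges as)

  mutual
    unlabelBox-inQ : (b : CBox) → SpeltBox b → All Q (necklacesC (unlabelBox b))
    unlabelBox-inQ (boxRooted (w , q) cs) (e , c) = subst Q (trans e (letters-unlabelEdges cs)) q ∷ unlabelEdges-inQ cs c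
    unlabelRooted-inQ : ∀ {ℓ} (r : CRooted ℓ) → SpeltRooted r → All Q (necklacesC (unlabelRooted r))
    unlabelRooted-inQ (pearlRooted ℓ (w , q) mb bs as) (e , cm , cbs , cas) =
      subst Q (trans e (letters-unlabelRooted bs as)) q ∷ ++⁺ (unlabelM-inQ mb cm) (++⁺ (unlabelEdges-inQ bs cbs) (unlabelEdges-inQ as cas))
    unlabelM-inQ : (mb : Maybe CDot) → SpeltM mb → All Q (necklacesCm (unlabelM mb))
    unlabelM-inQ nothing _ = []
    unlabelM-inQ (just d) c = unlabelRooted-inQ d c
    unlabelEdges-inQ : (cs : List CEdge) → SpeltEdges cs → All Q (necklacesCs (unlabelEdges cs))
    unlabelEdges-inQ [] _ = []
    unlabelEdges-inQ (toBox b ∷ cs) (c1 , c2) = ++⁺ (unlabelBox-inQ b c1) (unlabelEdges-inQ cs c2)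
    unlabelEdges-inQ (toTriangle r ∷ cs) (c1 , c2) = ++⁺ (unlabelRooted-inQ r c1) (unlabelEdges-inQ cs c2)
    unlabelEdges-inQ (toDiamond a ∷ cs) (c1 , c2) = ++⁺ (unlabelRooted-inQ a c1) (unlabelEdges-inQ cs c2)

  mutual
    labelBox-unlabelBox : ∀ b c a' → a' ≡ unlabelBox-inQ b c → labelBox (unlabelBox b) a' ≡ b
    labelBox-unlabelBox (boxRooted (w , q) cs) (e , c) a' refl = cong₂ boxRooted (≡-subst (trans e (letters-unlabelEdges cs)) q) (labelEdges-unlabelEdges cs c _ refl)
    labelRooted-unlabelRooted : ∀ {ℓ} (r : CRooted ℓ) c a' → a' ≡ unlabelRooted-inQ r c → labelRooted (unlabelRooted r) a' ≡ r
    labelRooted-unlabelRooted (pearlRooted ℓ (w , q) mb bs as) (e , cm , cbs , cas) a' refl =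
      cong₄ (pearlRooted ℓ) (≡-subst (trans e (letters-unlabelRooted bs as)) q)
        (labelM-unlabelM mb cm _ (++⁻ˡ-++⁺ (necklacesCm (unlabelM mb)) (unlabelM-inQ mb cm) _))
        (labelEdges-unlabelEdges bs cbs _ (trans (cong (++⁻ˡ (necklacesCs (unlabelEdges bs))) (++⁻ʳ-++⁺ (necklacesCm (unlabelM mb)) (unlabelM-inQ mb cm) _))
                            (++⁻ˡ-++⁺ (necklacesCs (unlabelEdges bs)) (unlabelEdges-inQ bs cbs) (unlabelEdges-inQ as cas))))
        (labelEdges-unlabelEdges as cas _ (trans (cong (++⁻ʳ (necklacesCs (unlabelEdges bs))) (++⁻ʳ-++⁺ (necklacesCm (unlabelM mb)) (unlabelM-inQ mb cm) _))
                            (++⁻ʳ-++⁺ (necklacesCs (unlabelEdges bs)) (unlabelEdges-inQ bs cbs) (unlabelEdges-inQ as cas))))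
    labelM-unlabelM : ∀ mb c a' → a' ≡ unlabelM-inQ mb c → labelM (unlabelM mb) a' ≡ mb
    labelM-unlabelM nothing c a' e = refl
    labelM-unlabelM (just d) c a' e = cong just (labelRooted-unlabelRooted d c a' e)
    labelEdges-unlabelEdges : ∀ cs c a' → a' ≡ unlabelEdges-inQ cs c → labelEdges (unlabelEdges cs) a' ≡ cs
    labelEdges-unlabelEdges [] c a' e = refl
    labelEdges-unlabelEdges (toBox b ∷ cs) (c1 , c2) a' refl =
      cong₂ _∷_ (cong toBox (labelBox-unlabelBox b c1 _ (++⁻ˡ-++⁺ (necklacesC (unlabelBox b)) (unlabelBox-inQ b c1) (unlabelEdges-inQ cs c2))))
                (labelEdges-unlabelEdges cs c2 _ (++⁻ʳ-++⁺ (necklacesC (unlabelBox b)) (unlabelBox-inQ b c1) (unlabelEdges-inQ cs c2)))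
    labelEdges-unlabelEdges (toTriangle r ∷ cs) (c1 , c2) a' refl =
      cong₂ _∷_ (cong toTriangle (labelRooted-unlabelRooted r c1 _ (++⁻ˡ-++⁺ (necklacesC (unlabelRooted r)) (unlabelRooted-inQ r c1) (unlabelEdges-inQ cs c2))))
                (labelEdges-unlabelEdges cs c2 _ (++⁻ʳ-++⁺ (necklacesC (unlabelRooted r)) (unlabelRooted-inQ r c1) (unlabelEdges-inQ cs c2)))
    labelEdges-unlabelEdges (toDiamond r ∷ cs) (c1 , c2) a' refl =
      cong₂ _∷_ (cong toDiamond (labelRooted-unlabelRooted r c1 _ (++⁻ˡ-++⁺ (necklacesC (unlabelRooted r)) (unlabelRooted-inQ r c1) (unlabelEdges-inQ cs c2))))
                (labelEdges-unlabelEdges cs c2 _ (++⁻ʳ-++⁺ (necklacesC (unlabelRooted r)) (unlabelRooted-inQ r c1) (unlabelEdges-inQ cs c2)))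

  CBoxIn : Set
  CBoxIn = Σ (CTree box) (λ t → All Q (necklacesC t))
  CRootedIn : Letter → Set
  CRootedIn ℓ = Σ (CTree (pearl ℓ)) (λ t → All Q (necklacesC t))
  CDotIn : Set
  CDotIn = Σ (Maybe (CTree (pearl dot))) (λ m → All Q (necklacesCm m))
  CEdgesIn : Set
  CEdgesIn = Σ (List CPearl) (λ ps → All Q (necklacesCs ps))

  ≡-boxRoot : ∀ {ps X} {a : All Q (necklacesCs ps)} {Y} → _≡_ {A = CEdgesIn} (X , Y) (ps , a) →
    (e : map cLetter ps ≡ map cLetter X) (q : Q (map cLetter ps)) → _≡_ {A = CBoxIn} (boxRoot X , subst Q e q ∷ Y) (boxRoot ps , q ∷ a)
  ≡-boxRoot {ps} {a = a} refl e q = cong (λ z → boxRoot ps , z ∷ a) (subst-≡-id e q)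

  ≡-letterRoot : ∀ {ℓ mb bs as M X Y a1 a2 a3 AM AX AY} → _≡_ {A = CDotIn} (M , AM) (mb , a1) → _≡_ {A = CEdgesIn} (X , AX) (bs , a2) → _≡_ {A = CEdgesIn} (Y , AY) (as , a3) →
    (e : map cLetter bs ++ ℓ ∷ map cLetter as ≡ map cLetter X ++ ℓ ∷ map cLetter Y) (q : Q (map cLetter bs ++ ℓ ∷ map cLetter as)) →
    _≡_ {A = CRootedIn ℓ} (letterRoot ℓ M X Y , subst Q e q ∷ ++⁺ AM (++⁺ AX AY)) (letterRoot ℓ mb bs as , q ∷ ++⁺ a1 (++⁺ a2 a3))
  ≡-letterRoot {ℓ} {mb} {bs} {as} {a1 = a1} {a2} {a3} refl refl refl e q = cong (λ z → letterRoot ℓ mb bs as , z ∷ ++⁺ a1 (++⁺ a2 a3)) (subst-≡-id e q)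

  ≡-cDot : ∀ {t ps T X a1 a2 A Y} → _≡_ {A = CBoxIn} (T , A) (t , a1) → _≡_ {A = CEdgesIn} (X , Y) (ps , a2) →
       _≡_ {A = CEdgesIn} (cDot T ∷ X , ++⁺ A Y) (cDot t ∷ ps , ++⁺ a1 a2)
  ≡-cDot refl refl = refl
  ≡-cDia : ∀ {t ps T X a1 a2 A Y} → _≡_ {A = CRootedIn triangle} (T , A) (t , a1) → _≡_ {A = CEdgesIn} (X , Y) (ps , a2) →
       _≡_ {A = CEdgesIn} (cDia T ∷ X , ++⁺ A Y) (cDia t ∷ ps , ++⁺ a1 a2)
  ≡-cDia refl refl = refl
  ≡-cTri : ∀ {t ps T X a1 a2 A Y} → _≡_ {A = CRootedIn diamond} (T , A) (t , a1) → _≡_ {A = CEdgesIn} (X , Y) (ps , a2) →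
       _≡_ {A = CEdgesIn} (cTri T ∷ X , ++⁺ A Y) (cTri t ∷ ps , ++⁺ a1 a2)
  ≡-cTri refl refl = refl

  ++⁺-++⁻₃ : ∀ mb bs as (a : All Q (necklacesCm mb ++ (necklacesCs bs ++ necklacesCs as))) →
    ++⁺ (++⁻ˡ (necklacesCm mb) a) (++⁺ (++⁻ˡ (necklacesCs bs) (++⁻ʳ (necklacesCm mb) a)) (++⁻ʳ (necklacesCs bs) (++⁻ʳ (necklacesCm mb) a))) ≡ a
  ++⁺-++⁻₃ mb bs as a = trans (cong (++⁺ (++⁻ˡ (necklacesCm mb) a)) (++⁺-++⁻ (necklacesCs bs) (++⁻ʳ (necklacesCm mb) a))) (++⁺-++⁻ (necklacesCm mb) a)

  mutual
    unlabelBox-labelBox : ∀ t a → _≡_ {A = CBoxIn} (unlabelBox (labelBox t a) , unlabelBox-inQ (labelBox t a) (labelBox-spelt t a)) (t , a)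
    unlabelBox-labelBox (boxRoot ps) (q ∷ a) = ≡-boxRoot (unlabelEdges-labelEdges ps a) (trans (letters-labelEdges ps a) (letters-unlabelEdges (labelEdges ps a))) q
    unlabelRooted-labelRooted : ∀ {ℓ} (t : CTree (pearl ℓ)) a → _≡_ {A = CRootedIn ℓ} (unlabelRooted (labelRooted t a) , unlabelRooted-inQ (labelRooted t a) (labelRooted-spelt t a)) (t , a)
    unlabelRooted-labelRooted (letterRoot ℓ mb bs as) (q ∷ a) =
      trans (≡-letterRoot (unlabelM-labelM mb _) (unlabelEdges-labelEdges bs _) (unlabelEdges-labelEdges as _) _ q) (cong (λ z → letterRoot ℓ mb bs as , q ∷ z) (++⁺-++⁻₃ mb bs as a))
    unlabelM-labelM : ∀ mb a → _≡_ {A = CDotIn} (unlabelM (labelM mb a) , unlabelM-inQ (labelM mb a) (labelM-spelt mb a)) (mb , a)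
    unlabelM-labelM nothing [] = refl
    unlabelM-labelM (just t) a = cong (λ z → just (proj₁ z) , proj₂ z) (unlabelRooted-labelRooted t a)
    unlabelEdges-labelEdges : ∀ ps a → _≡_ {A = CEdgesIn} (unlabelEdges (labelEdges ps a) , unlabelEdges-inQ (labelEdges ps a) (labelEdges-spelt ps a)) (ps , a)
    unlabelEdges-labelEdges [] [] = refl
    unlabelEdges-labelEdges (cDot t ∷ ps) a = trans (≡-cDot (unlabelBox-labelBox t _) (unlabelEdges-labelEdges ps _)) (cong (λ z → cDot t ∷ ps , z) (++⁺-++⁻ (necklacesC t) a))
    unlabelEdges-labelEdges (cDia t ∷ ps) a = trans (≡-cDia (unlabelRooted-labelRooted t _) (unlabelEdges-labelEdges ps _)) (cong (λ z → cDia t ∷ ps , z) (++⁺-++⁻ (necklacesC t) a))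
    unlabelEdges-labelEdges (cTri t ∷ ps) a = trans (≡-cTri (unlabelRooted-labelRooted t _) (unlabelEdges-labelEdges ps _)) (cong (λ z → cTri t ∷ ps , z) (++⁺-++⁻ (necklacesC t) a))

  labelProd : (x : ProdRaw) → All Q (necklacesP x) → Prod
  labelProd (mb , ps) (q ∷ a) = labelM mb (++⁻ˡ (necklacesCm mb) a) , (map cLetter ps , q) , labelEdges ps (++⁻ʳ (necklacesCm mb) a)

  labelProd-spelt : ∀ x a → SpeltProd (labelProd x a)
  labelProd-spelt (mb , ps) (q ∷ a) = letters-labelEdges ps _ , labelM-spelt mb _ , labelEdges-spelt ps _

  unlabelProd : Prod → ProdRaw
  unlabelProd (mb , l , cs) = unlabelM mb , unlabelEdges cs

  unlabelProd-inQ : (x : Prod) → SpeltProd x → All Q (necklacesP (unlabelProd x))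
  unlabelProd-inQ (mb , (w , q) , cs) (e , cm , c) = subst Q (trans e (letters-unlabelEdges cs)) q ∷ ++⁺ (unlabelM-inQ mb cm) (unlabelEdges-inQ cs c)

  ≡-prod : ∀ {mb ps M X a1 a2 AM AX} → _≡_ {A = CDotIn} (M , AM) (mb , a1) → _≡_ {A = CEdgesIn} (X , AX) (ps , a2) →
    (e : map cLetter ps ≡ map cLetter X) (q : Q (map cLetter ps)) →
    _≡_ {A = ProdClass Q} ((M , X) , subst Q e q ∷ ++⁺ AM AX) ((mb , ps) , q ∷ ++⁺ a1 a2)
  ≡-prod {mb} {ps} {a1 = a1} {a2} refl refl e q = cong (λ z → (mb , ps) , z ∷ ++⁺ a1 a2) (subst-≡-id e q)

  unlabelProd-labelProd : ∀ x a → _≡_ {A = ProdClass Q} (unlabelProd (labelProd x a) , unlabelProd-inQ (labelProd x a) (labelProd-spelt x a)) (x , a)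
  unlabelProd-labelProd (mb , ps) (q ∷ a) = trans (≡-prod (unlabelM-labelM mb _) (unlabelEdges-labelEdges ps _) _ q) (cong (λ z → (mb , ps) , q ∷ z) (++⁺-++⁻ (necklacesCm mb) a))

  labelProd-unlabelProd : ∀ x c → labelProd (unlabelProd x) (unlabelProd-inQ x c) ≡ x
  labelProd-unlabelProd (mb , (w , q) , cs) (e , cm , c) =
    cong₃ (λ a b c → a , b , c) (labelM-unlabelM mb cm _ (++⁻ˡ-++⁺ (necklacesCm (unlabelM mb)) (unlabelM-inQ mb cm) (unlabelEdges-inQ cs c))) (≡-subst (trans e (letters-unlabelEdges cs)) q)
          (labelEdges-unlabelEdges cs c _ (++⁻ʳ-++⁺ (necklacesCm (unlabelM mb)) (unlabelM-inQ mb cm) (unlabelEdges-inQ cs c)))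

  ProdClass↔SpeltProd : ProdClass Q ↔ Σ Prod SpeltProd
  ProdClass↔SpeltProd =
    mk↔ₛ′ (λ (x , a) → labelProd x a , labelProd-spelt x a) (λ (y , c) → unlabelProd y , unlabelProd-inQ y c)
          (λ (y , c) → Σ-≡-irrelevant (λ {y} → SpeltProd-irrelevant y) (labelProd-unlabelProd y c))
          (λ (x , a) → unlabelProd-labelProd x a)

  mutual
    necklaces-unlabelBox : ∀ b → SpeltBox b → necklacesC (unlabelBox b) ≡ map proj₁ (labelsBox b)
    necklaces-unlabelBox (boxRooted (w , q) cs) (e , c) = cong₂ _∷_ (sym (trans e (letters-unlabelEdges cs))) (necklaces-unlabelEdges cs c)
    necklaces-unlabelRooted : ∀ {ℓ} (r : CRooted ℓ) → SpeltRooted r → necklacesC (unlabelRooted r) ≡ map proj₁ (labelsRooted r)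
    necklaces-unlabelRooted (pearlRooted ℓ (w , q) mb bs as) (e , cm , cbs , cas) =
      cong₂ _∷_ (sym (trans e (letters-unlabelRooted bs as)))
        (trans (cong₂ _++_ (necklaces-unlabelM mb cm) (trans (cong₂ _++_ (necklaces-unlabelEdges bs cbs) (necklaces-unlabelEdges as cas)) (sym (map-++ proj₁ (labelsEdges bs) (labelsEdges as)))))
               (sym (map-++ proj₁ (labelsM mb) _)))
    necklaces-unlabelM : ∀ mb → SpeltM mb → necklacesCm (unlabelM mb) ≡ map proj₁ (labelsM mb)
    necklaces-unlabelM nothing _ = refl
    necklaces-unlabelM (just d) c = necklaces-unlabelRooted d c
    necklaces-unlabelEdges : ∀ cs → SpeltEdges cs → necklacesCs (unlabelEdges cs) ≡ map proj₁ (labelsEdges cs)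
    necklaces-unlabelEdges [] _ = refl
    necklaces-unlabelEdges (toBox b ∷ cs) (c1 , c2) = trans (cong₂ _++_ (necklaces-unlabelBox b c1) (necklaces-unlabelEdges cs c2)) (sym (map-++ proj₁ (labelsBox b) _))
    necklaces-unlabelEdges (toTriangle r ∷ cs) (c1 , c2) = trans (cong₂ _++_ (necklaces-unlabelRooted r c1) (necklaces-unlabelEdges cs c2)) (sym (map-++ proj₁ (labelsRooted r) _))
    necklaces-unlabelEdges (toDiamond r ∷ cs) (c1 , c2) = trans (cong₂ _++_ (necklaces-unlabelRooted r c1) (necklaces-unlabelEdges cs c2)) (sym (map-++ proj₁ (labelsRooted r) _))

  necklaces-unlabelProd : ∀ y → SpeltProd y → necklacesP (unlabelProd y) ≡ map proj₁ (labelsProd y)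
  necklaces-unlabelProd (mb , (w , q) , cs) (e , cm , c) =
    cong₂ _∷_ (sym (trans e (letters-unlabelEdges cs))) (trans (cong₂ _++_ (necklaces-unlabelM mb cm) (necklaces-unlabelEdges cs c)) (sym (map-++ proj₁ (labelsM mb) _)))

module Main (Q : Word → Set) where

  open import Data.List using (List; []; _++_; map)
  open import Data.List.Properties using (++-identityʳ)
  open import Data.Maybe using (nothing)
  open import Data.Unit using (tt)
  open import Data.Product using (_,_; proj₁; proj₂)
  open import Relation.Binary.PropositionalEquality using (sym; cong)
  open import Data.List.Relation.Binary.Permutation.Propositional using (module PermutationReasoning)
  open import Data.List.Relation.Binary.Permutation.Propositional.Properties using (map⁺)
  open import Function.Properties.Inverse using (↔-trans; ↔-sym)

  L : Set
  L = Σ Word Q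

  open Trees L
  open RightInverse L
  open Spelling L proj₁
  open Labels L
  open LabelQ Q
  open LabelC Q

  F0∘↔ProdClass : F0∘ Q ↔ ProdClass Q
  F0∘↔ProdClass = ↔-trans F0∘↔SpeltZeroExcess (↔-trans SpeltZeroExcess↔SpeltProd (↔-sym ProdClass↔SpeltProd))

  F0∘↔ProdClass-necklaces : ∀ x → necklacesP (proj₁ (Inverse.to F0∘↔ProdClass x)) ↭ necklacesQ (proj₁ x)
  F0∘↔ProdClass-necklaces (t , a , nn , e , m) = begin
    necklacesP (unlabelProd y)             ≡⟨ necklaces-unlabelProd y y-spelt ⟩
    map proj₁ (labelsProd y)               ↭⟨ map⁺ proj₁ (rootAtMark-labels (label t a) (labelMark m) [] nothing v (sym e₀)) ⟩
    map proj₁ (labels (label t a) ++ [])   ≡⟨ cong (map proj₁) (++-identityʳ (labels (label t a))) ⟩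
    map proj₁ (labels (label t a))         ≡⟨ words-labels-label t a ⟩
    necklacesQ t                           ∎
    where
      open PermutationReasoning
      v = proj₁ (label-valid t a nn)
      e₀ = label-excess≡0 t a nn e
      y = toProd (label t a , labelMark m)
      y-spelt = rootAtMark-spelt (label t a) (labelMark m) [] nothing v (sym e₀) (label-spelt t a) tt tt

corollary3p8 : (Q : Word → Set) →
    (∃ λ w → Q w × All (_≡ triangle) w) →
    Σ (F0∘ Q ↔ ProdClass Q) λ φ →
    ∀ x → necklacesP (proj₁ (Inverse.to φ x)) ↭ necklacesQ (proj₁ x)
corollary3p8 Q _ = Main.F0∘↔ProdClass Q , Main.F0∘↔ProdClass-necklaces Q
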